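{- Let $\tau$ be a finite relational vocabulary and let $\mathcal{C}$ be a class of finite $\tau$-structures that admits MSO-definable ordered tree decompositions of bounded adhesion. Then every property definable in order-invariant first-order logic on $\mathcal{C}$ is definable in MSO on $\mathcal{C}$; that is, for every order-invariant first-order sentence $\varphi$ of vocabulary $\tau\cup\{\le\}$ there is an MSO-sentence $\psi$ of vocabulary $\tau$ such that every $A\in\mathcal{C}$ satisfies $\varphi$ (in the order-invariant sense) if and only if $A\models\psi$.
   Context: Structures are finite and vocabularies are finite and relational. $U(A)$ denotes the universe of $A$. Logics. MSO is monadic second-order logic (without counting predicates). Let $\le$ be a binary symbol not in $\tau$. A first-order sentence $\varphi$ of vocabulary $\tau\cup\{\le\}$ is order-invariant if for all $\tau$-structures $A$ and all linear orders $\le_1,\le_2$ of $U(A)$: $(A,\le_1)\models\varphi$ iff $(A,\le_2)\models\varphi$. A $\tau$-structure $A$ satisfies such $\varphi$ (in the order-invariant sense) if $(A,\le)\models\varphi$ for some (equivalently all) linear orders $\le$ of $U(A)$. Tree decompositions. A tree decomposition $(T,\beta)$ of a structure $A$ is a tree $T$ (directed away from a root) with $\beta\colon V(T)\to 2^{U(A)}$ such that for every $v\in U(A)$ the set $\{t\mid v\in\beta(t)\}$ is nonempty and connected in $T$, and for every tuple of a relation of $A$ some $\beta(t)$ contains all its entries. Its adhesion is $\max_{(t,u)\in E(T)}|\beta(t)\cap\beta(u)|$. Transductions. An MSO$[\tau,\tau']$-transduction $\Lambda$ of width $w$ with $p$ parameters consists of MSO-formulas over $\tau\cup\{P_1,\dots,P_p\}$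 ($P_j$ new unary symbols): a sentence $\lambda_{\mathrm{valid}}$, formulas $\lambda_U^1(x),\dots,\lambda_U^w(x)$, and for each $R\in\tau'$ of arity $r$ and each $(i_1,\dots,i_r)\in\{1,\dots,w\}^r$ a formula $\lambda_R^{(i_1,\dots,i_r)}(x_1,\dots,x_r)$. For a $\tau$-structure $A$ and $P_1,\dots,P_p\subseteq U(A)$, $\Lambda[A,P_1,\dots,P_p]$ is the $\tau'$-structure with universe $\{(a,i)\in U(A)\times\{1,\dots,w\}\mid (A,\bar P)\models\lambda_U^i(a)\}$ in which $R$ holds of $((a_1,i_1),\dots,(a_r,i_r))$ (tuples over this universe) iff $(A,\bar P)\models\lambda_R^{(i_1,\dots,i_r)}(a_1,\dots,a_r)$. Then $\Lambda[A]$ is the set of all $\Lambda[A,\bar P]$ with $(A,\bar P)\models\lambda_{\mathrm{valid}}$. Ordered tree extensions. Let $\tau^\star=\tau\cup\{V_S,V_T,E_T,R_\beta,R_\preceq\}$ with new symbols, $V_S,V_T$ unary, $E_T,R_\beta$ binary, $R_\preceq$ ternary. An ordered tree extension (otx) of a $\tau$-structure $A$ is a $\tau^\star$-structure $A^\star$ that extends $A$ by a tree decomposition $(T,\beta)$ of $A$ and a linear order $\preceq_t$ of $\beta(t)$ for each $t\in V(T)$: its universe is the disjoint union of $U(A)$ and $V(T)$, the symbols of $\tau$ are interpreted as in $A$, $V_S=U(A)$, $V_T=V(T)$, $E_T=E(T)$, $R_\beta=\{(t,v)\mid v\in\beta(t)\}$, $R_\preceq=\{(t,v,w)\mid v,w\in\beta(t),\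 v\preceq_t w\}$. Its adhesion is that of $(T,\beta)$. The class $\mathcal{C}$ admits MSO-definable ordered tree decompositions of bounded adhesion if there are $k\in\mathbb{N}$ and an MSO$[\tau,\tau^\star]$-transduction $\Lambda^\star$ such that for every $A\in\mathcal{C}$ the set $\Lambda^\star[A]$ is nonempty and each of its members is isomorphic to an otx of $A$ of adhesion at most $k$. -}

module Defs where

open import Level using (0ℓ; _⊔_) renaming (suc to lsuc)
open import Data.Bool.Base using (Bool; true; false; T; _∧_)
open import Data.Bool.Properties using (T-irrelevant; T?)
open import Data.Fin.Base using (Fin; zero; suc)
open import Data.Fin.Patterns using (0F)
import Data.Fin.Properties as Fin
import Data.Fin.Subset as FinSubset
open import Data.Fin.Subset.Properties using (anySubset?)
open import Data.List.Base as List using (List; filterᵇ; allFin; cartesianProduct)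
open import Data.List.Extrema.Nat using (max)
open import Data.Maybe.Base as Maybe using (Maybe; just; nothing)
open import Data.Nat.Base using (ℕ; zero; suc; _≤_; _+_; _*_)
open import Data.Product.Base using (Σ-syntax; ∃; ∃-syntax; _×_; _,_; proj₁; proj₂; uncurry)
open import Data.Product.Function.NonDependent.Propositional using (_×-↔_)
open import Data.Sum.Base using (_⊎_; inj₁; inj₂; [_,_])
open import Data.Sum.Function.Propositional using (_⊎-↔_)
open import Data.Unit.Base using (⊤; tt)
open import Data.Vec.Base using (Vec; []; _∷_; lookup; map; tabulate)
open import Data.Vec.Properties using (lookup∘tabulate)
open import Data.Vec.Relation.Unary.All using (All)
open import Function.Base using (_∘_)
open import Function.Bundles using (_↔_; mk↔ₛ′; Inverse; _⇔_)
open import Function.Construct.Composition using (_↔-∘_)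
open import Function.Construct.Identity using (↔-id)
open import Function.Construct.Symmetry using (↔-sym)
open import Function.Properties.Inverse using (↔⇒↣)
open import Relation.Binary.Construct.Closure.Equivalence using (EqClosure)
open import Relation.Binary.Construct.Closure.ReflexiveTransitive using (Star)
open import Relation.Binary.Definitions using (DecidableEquality)
open import Relation.Binary.PropositionalEquality
  using (_≡_; refl; sym; trans; cong; subst)
open import Relation.Binary.Structures using (IsTotalOrder)
open import Relation.Nullary using (¬_; Dec; yes; no)
open import Relation.Nullary.Decidable
  using (⌊_⌋; map′; ¬?; _×-dec_; _⊎-dec_; decidable-stable)
open import Relation.Unary using (Pred; Decidable; Satisfiable; _∈_)

Finite : Set → Set
Finite X = ∃[ n ] (X ↔ Fin n)

elements : ∀ {X} → Finite X → List X
elements (n , f) = List.map (Inverse.from f) (allFin n)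

-- Subsets of a finite set are given by their characteristic functions.
𝒫 : Set → Set
𝒫 X = X → Bool

Elem : ∀ {X} → 𝒫 X → Set
Elem {X} S = Σ[ x ∈ X ] T (S x)

_∩_ : ∀ {X} → 𝒫 X → 𝒫 X → 𝒫 X
(S ∩ S′) x = S x ∧ S′ x

card : ∀ {X} → Finite X → 𝒫 X → ℕ
card fin S = List.length (filterᵇ S (elements fin))

finite-⊤ : Finite ⊤
finite-⊤ = 1 , ↔-sym Fin.1↔⊤

finite-Fin : ∀ n → Finite (Fin n)
finite-Fin n = n , ↔-id (Fin n)

finite-⊎ : ∀ {X Y} → Finite X → Finite Y → Finite (X ⊎ Y)
finite-⊎ (m , f) (n , g) = m + n , ↔-sym Fin.+↔⊎ ↔-∘ (f ⊎-↔ g)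

finite-× : ∀ {X Y} → Finite X → Finite Y → Finite (X × Y)
finite-× (m , f) (n , g) = m * n , ↔-sym Fin.*↔× ↔-∘ (f ×-↔ g)

Elem-≡ : ∀ {X} (S : 𝒫 X) {p q : Elem S} → proj₁ p ≡ proj₁ q → p ≡ q
Elem-≡ S {x , p} {.x , q} refl = cong (x ,_) (T-irrelevant p q)

finite-FinElem : ∀ n (S : 𝒫 (Fin n)) → Finite (Elem S)
finite-FinElem zero    S = 0 , mk↔ₛ′ (λ ()) (λ ()) (λ ()) (λ ())
finite-FinElem (suc n) S with finite-FinElem n (S ∘ suc) | S zero in eq
... | m , f | true  = suc m , mk↔ₛ′ to from to∘from from∘to
  where
  to : Elem S → Fin (suc m)
  to (zero  , _) = zero
  to (suc i , p) = suc (Inverse.to f (i , p))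
  from : Fin (suc m) → Elem S
  from zero    = zero , subst T (sym eq) tt
  from (suc j) = let i , p = Inverse.from f j in suc i , p
  to∘from : ∀ j → to (from j) ≡ j
  to∘from zero    = refl
  to∘from (suc j) = cong suc (Inverse.strictlyInverseˡ f j)
  from∘to : ∀ x → from (to x) ≡ x
  from∘to (zero  , p) = Elem-≡ S refl
  from∘to (suc i , p) = Elem-≡ S (cong (suc ∘ proj₁) (Inverse.strictlyInverseʳ f (i , p)))
... | m , f | false = m , mk↔ₛ′ to from to∘from from∘to
  where
  to : Elem S → Fin m
  to (zero  , p) with () ← subst T eq p
  to (suc i , p) = Inverse.to f (i , p)
  from : Fin m → Elem S
  from j = let i , p = Inverse.from f j in suc i , p
  to∘from : ∀ j → to (from j) ≡ j
  to∘from j = Inverse.strictlyInverseˡ f j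
  from∘to : ∀ x → from (to x) ≡ x
  from∘to (zero  , p) with () ← subst T eq p
  from∘to (suc i , p) = Elem-≡ S (cong (suc ∘ proj₁) (Inverse.strictlyInverseʳ f (i , p)))

finite-Elem : ∀ {X} → Finite X → (S : 𝒫 X) → Finite (Elem S)
finite-Elem {X} (n , f) S =
  let m , g = finite-FinElem n (S ∘ Inverse.from f) in m , g ↔-∘ mk↔ₛ′ to from to∘from from∘to
  where
  to : Elem S → Elem (S ∘ Inverse.from f)
  to (x , p) = Inverse.to f x , subst (T ∘ S) (sym (Inverse.strictlyInverseʳ f x)) p
  from : Elem (S ∘ Inverse.from f) → Elem S
  from (i , p) = Inverse.from f i , p
  to∘from : ∀ y → to (from y) ≡ y
  to∘from (i , p) = Elem-≡ (S ∘ Inverse.from f) (Inverse.strictlyInverseˡ f i)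
  from∘to : ∀ y → from (to y) ≡ y
  from∘to (x , p) = Elem-≡ S (Inverse.strictlyInverseʳ f x)

finite-≟ : ∀ {X} → Finite X → DecidableEquality X
finite-≟ (n , f) = Fin.inj⇒≟ (↔⇒↣ f)

finite-∃? : ∀ {X} → Finite X → {P : X → Set} → Decidable P → Dec (∃ P)
finite-∃? (n , f) {P} P? = map′
  (λ (i , p) → Inverse.from f i , p)
  (λ (x , p) → Inverse.to f x , subst P (sym (Inverse.strictlyInverseʳ f x)) p)
  (Fin.any? (P? ∘ Inverse.from f))

finite-∃𝒫? : ∀ {X} → Finite X → {P : 𝒫 X → Set} →
             (∀ {S S′} → (∀ x → S x ≡ S′ x) → P S → P S′) → Decidable P → Dec (∃ P)
finite-∃𝒫? {X} (n , f) {P} ext P? = map′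
  (λ (S , p) → decode S , p)
  (λ (S , p) → encode S , ext (decode-encode S) p)
  (anySubset? (P? ∘ decode))
  where
  encode : 𝒫 X → FinSubset.Subset n
  encode S = tabulate (S ∘ Inverse.from f)
  decode : FinSubset.Subset n → 𝒫 X
  decode S x = lookup S (Inverse.to f x)
  decode-encode : ∀ S x → S x ≡ decode (encode S) x
  decode-encode S x = sym (trans (lookup∘tabulate (S ∘ Inverse.from f) (Inverse.to f x))
                                 (cong S (Inverse.strictlyInverseʳ f x)))

∃?⇒∀? : ∀ {X : Set} {P : X → Set} → Decidable P → Dec (∃ (¬_ ∘ P)) → Dec (∀ x → P x)
∃?⇒∀? P? = map′ (λ ∄ x → decidable-stable (P? x) λ ¬p → ∄ (x , ¬p))
                (λ ∀p (x , ¬p) → ¬p (∀p x))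
           ∘ ¬?

record Vocabulary : Set₁ where
  field
    Symbol : Set
    finite : Finite Symbol
    arity  : Symbol → ℕ

open Vocabulary public using (Symbol; arity)

-- Disjoint union, so the symbols of σ are new relative to τ.
infixl 6 _⊕_
_⊕_ : Vocabulary → Vocabulary → Vocabulary
τ ⊕ σ = record
  { Symbol = Symbol τ ⊎ Symbol σ
  ; finite = finite-⊎ (Vocabulary.finite τ) (Vocabulary.finite σ)
  ; arity  = [ arity τ , arity σ ]
  }

Interpretation : Vocabulary → Set → Set
Interpretation τ X = (R : Symbol τ) → 𝒫 (Vec X (arity τ R))

record Structure (τ : Vocabulary) : Set₁ where
  field
    U      : Set
    finite : Finite U
    rel    : Interpretation τ U

open Structure public using (U; rel)

expand : ∀ {τ σ} (A : Structure τ) → Interpretation σ (U A) → Structure (τ ⊕ σ)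
expand {τ} {σ} A I = record { U = U A ; finite = Structure.finite A ; rel = rel′ }
  where
  rel′ : Interpretation (τ ⊕ σ) (U A)
  rel′ (inj₁ R) = rel A R
  rel′ (inj₂ R) = I R

infix 4 _≅_
record _≅_ {τ} (A B : Structure τ) : Set where
  field
    bijection : U A ↔ U B
    preserves : ∀ R xs → rel A R xs ≡ rel B R (map (Inverse.to bijection) xs)

data Logic : Set where
  FO MSO : Logic

infix  9 _≐_ _∈ˢ_
infixr 8 ¬ᶠ_ ∃ᶠ_ ∀ᶠ_ ∃ˢ_ ∀ˢ_
infixr 7 _∧ᶠ_
infixr 6 _∨ᶠ_

-- Formulas with free element variables in Fin m and free set variables in
-- Fin s; the quantifiers bind de Bruijn index zero.
data Formula (τ : Vocabulary) : Logic → ℕ → ℕ → Set where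
  _≐_       : ∀ {L m s} → Fin m → Fin m → Formula τ L m s
  atom      : ∀ {L m s} (R : Symbol τ) → Vec (Fin m) (arity τ R) → Formula τ L m s
  _∈ˢ_      : ∀ {m s} → Fin m → Fin s → Formula τ MSO m s
  ¬ᶠ_       : ∀ {L m s} → Formula τ L m s → Formula τ L m s
  _∧ᶠ_ _∨ᶠ_ : ∀ {L m s} → Formula τ L m s → Formula τ L m s → Formula τ L m s
  ∃ᶠ_ ∀ᶠ_   : ∀ {L m s} → Formula τ L (suc m) s → Formula τ L m s
  ∃ˢ_ ∀ˢ_   : ∀ {m s} → Formula τ MSO m (suc s) → Formula τ MSO m s

Sentence : Vocabulary → Logic → Set
Sentence τ L = Formula τ L 0 0

Sat : ∀ {τ L m s} (A : Structure τ) → Vec (U A) m → Vec (𝒫 (U A)) s → Formula τ L m s → Set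
Sat A ρ η (x ≐ y)     = lookup ρ x ≡ lookup ρ y
Sat A ρ η (atom R xs) = T (rel A R (map (lookup ρ) xs))
Sat A ρ η (x ∈ˢ X)    = T (lookup η X (lookup ρ x))
Sat A ρ η (¬ᶠ φ)      = ¬ Sat A ρ η φ
Sat A ρ η (φ ∧ᶠ ψ)    = Sat A ρ η φ × Sat A ρ η ψ
Sat A ρ η (φ ∨ᶠ ψ)    = Sat A ρ η φ ⊎ Sat A ρ η ψ
Sat A ρ η (∃ᶠ φ)      = Σ[ a ∈ U A ] Sat A (a ∷ ρ) η φ
Sat A ρ η (∀ᶠ φ)      = (a : U A) → Sat A (a ∷ ρ) η φ
Sat A ρ η (∃ˢ φ)      = Σ[ S ∈ 𝒫 (U A) ] Sat A ρ (S ∷ η) φ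
Sat A ρ η (∀ˢ φ)      = (S : 𝒫 (U A)) → Sat A ρ (S ∷ η) φ

infix 4 _⊨_
_⊨_ : ∀ {τ L} → Structure τ → Sentence τ L → Set
A ⊨ φ = Sat A [] [] φ

infix 4 _≗ˢ_
_≗ˢ_ : ∀ {X s} → Vec (𝒫 X) s → Vec (𝒫 X) s → Set
η ≗ˢ η′ = ∀ i x → lookup η i x ≡ lookup η′ i x

≗ˢ-sym : ∀ {X s} {η η′ : Vec (𝒫 X) s} → η ≗ˢ η′ → η′ ≗ˢ η
≗ˢ-sym e i x = sym (e i x)

≗ˢ-∷ : ∀ {X s} {S S′ : 𝒫 X} {η η′ : Vec (𝒫 X) s} →
       (∀ x → S x ≡ S′ x) → η ≗ˢ η′ → (S ∷ η) ≗ˢ (S′ ∷ η′)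
≗ˢ-∷ d e zero    = d
≗ˢ-∷ d e (suc i) = e i

Sat-cong : ∀ {τ L m s} (A : Structure τ) (ρ : Vec (U A) m) {η η′ : Vec (𝒫 (U A)) s} →
           η ≗ˢ η′ → (φ : Formula τ L m s) → Sat A ρ η φ → Sat A ρ η′ φ
Sat-cong A ρ e (x ≐ y)     p        = p
Sat-cong A ρ e (atom R xs) p        = p
Sat-cong A ρ e (x ∈ˢ X)    p        = subst T (e X (lookup ρ x)) p
Sat-cong A ρ {η} {η′} e (¬ᶠ φ) p    = p ∘ Sat-cong A ρ (≗ˢ-sym {η = η} {η′} e) φ
Sat-cong A ρ e (φ ∧ᶠ ψ)    (p , q)  = Sat-cong A ρ e φ p , Sat-cong A ρ e ψ q
Sat-cong A ρ e (φ ∨ᶠ ψ)    (inj₁ p) = inj₁ (Sat-cong A ρ e φ p)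
Sat-cong A ρ e (φ ∨ᶠ ψ)    (inj₂ q) = inj₂ (Sat-cong A ρ e ψ q)
Sat-cong A ρ e (∃ᶠ φ)      (a , p)  = a , Sat-cong A (a ∷ ρ) e φ p
Sat-cong A ρ e (∀ᶠ φ)      p a      = Sat-cong A (a ∷ ρ) e φ (p a)
Sat-cong A ρ {η} {η′} e (∃ˢ φ) (S , p) =
  S , Sat-cong A ρ (≗ˢ-∷ {η = η} {η′} (λ _ → refl) e) φ p
Sat-cong A ρ {η} {η′} e (∀ˢ φ) p S     =
  Sat-cong A ρ (≗ˢ-∷ {η = η} {η′} (λ _ → refl) e) φ (p S)

sat? : ∀ {τ L m s} (A : Structure τ) (ρ : Vec (U A) m) (η : Vec (𝒫 (U A)) s)
       (φ : Formula τ L m s) → Dec (Sat A ρ η φ)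
sat? A ρ η (x ≐ y)     = finite-≟ (Structure.finite A) (lookup ρ x) (lookup ρ y)
sat? A ρ η (atom R xs) = T? (rel A R (map (lookup ρ) xs))
sat? A ρ η (x ∈ˢ X)    = T? (lookup η X (lookup ρ x))
sat? A ρ η (¬ᶠ φ)      = ¬? (sat? A ρ η φ)
sat? A ρ η (φ ∧ᶠ ψ)    = sat? A ρ η φ ×-dec sat? A ρ η ψ
sat? A ρ η (φ ∨ᶠ ψ)    = sat? A ρ η φ ⊎-dec sat? A ρ η ψ
sat? A ρ η (∃ᶠ φ)      = finite-∃? (Structure.finite A) (λ a → sat? A (a ∷ ρ) η φ)
sat? A ρ η (∀ᶠ φ)      = ∃?⇒∀? (λ a → sat? A (a ∷ ρ) η φ)
  (finite-∃? (Structure.finite A) (λ a → ¬? (sat? A (a ∷ ρ) η φ)))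
sat? A ρ η (∃ˢ φ)      = finite-∃𝒫? (Structure.finite A)
  (λ d → Sat-cong A ρ (≗ˢ-∷ {η = η} {η} d (λ _ _ → refl)) φ)
  (λ S → sat? A ρ (S ∷ η) φ)
sat? A ρ η (∀ˢ φ)      = ∃?⇒∀? (λ S → sat? A ρ (S ∷ η) φ)
  (finite-∃𝒫? (Structure.finite A)
    (λ d → Sat-cong A ρ (≗ˢ-∷ {η = η} {η} d (λ _ _ → refl)) (¬ᶠ φ))
    (λ S → ¬? (sat? A ρ (S ∷ η) φ)))

record LinearOrder (X : Set) : Set where
  field
    leq          : X → X → Bool
    isTotalOrder : IsTotalOrder _≡_ (λ x y → T (leq x y))

open LinearOrder public using (leq)

≤-vocabulary : Vocabulary
≤-vocabulary = record { Symbol = ⊤ ; finite = finite-⊤ ; arity = λ _ → 2 }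

infixl 5 _,≤_
_,≤_ : ∀ {τ} (A : Structure τ) → LinearOrder (U A) → Structure (τ ⊕ ≤-vocabulary)
A ,≤ o = expand A λ { _ (x ∷ y ∷ []) → leq o x y }

OrderInvariant : ∀ {τ} → Sentence (τ ⊕ ≤-vocabulary) FO → Set₁
OrderInvariant {τ} φ =
  (A : Structure τ) (o₁ o₂ : LinearOrder (U A)) → (A ,≤ o₁ ⊨ φ) ⇔ (A ,≤ o₂ ⊨ φ)

infix 4 _⊨ⁱⁿᵛ_
_⊨ⁱⁿᵛ_ : ∀ {τ} → Structure τ → Sentence (τ ⊕ ≤-vocabulary) FO → Set
A ⊨ⁱⁿᵛ φ = Σ[ o ∈ LinearOrder (U A) ] (A ,≤ o ⊨ φ)

record RootedTree : Set₁ where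
  field
    Node   : Set
    finite : Finite Node
    root   : Node
    edge   : Node → Node → Bool

  -- Edges point away from the root.
  Edge : Node → Node → Set
  Edge t u = T (edge t u)

  field
    root-no-parent : ∀ t → ¬ Edge t root
    parent-unique  : ∀ {t t′ u} → Edge t u → Edge t′ u → t ≡ t′
    reachable      : ∀ t → Star Edge root t

  edges : List (Node × Node)
  edges = filterᵇ (uncurry edge) (cartesianProduct (elements finite) (elements finite))

-- EqClosure forgets the direction of the edges.
Connected : (t : RootedTree) → 𝒫 (RootedTree.Node t) → Set
Connected 𝓣 S = ∀ t u → T (S t) → T (S u) →
  EqClosure (λ v w → Edge v w × T (S v) × T (S w)) t u
  where open RootedTree 𝓣

record TreeDecomposition {τ} (A : Structure τ) : Set₁ where
  field
    tree : RootedTree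
  open RootedTree tree public
  field
    β         : Node → 𝒫 (U A)
    nonempty  : ∀ v → Σ[ t ∈ Node ] T (β t v)
    connected : ∀ v → Connected tree (λ t → β t v)
    covers    : ∀ R xs → T (rel A R xs) → Σ[ t ∈ Node ] All (λ v → T (β t v)) xs

  -- The maximum over the empty set of edges is 0.
  adhesion : ℕ
  adhesion = max 0 (List.map (λ (t , u) → card (Structure.finite A) (β t ∩ β u)) edges)

data TreeSymbol : Set where
  V-S V-T E-T R-β R-≼ : TreeSymbol

tree-vocabulary : Vocabulary
tree-vocabulary = record
  { Symbol = TreeSymbol
  ; finite = 5 , mk↔ₛ′
      (λ { V-S → 0F ; V-T → suc 0F ; E-T → suc (suc 0F)
         ; R-β → suc (suc (suc 0F)) ; R-≼ → suc (suc (suc (suc 0F))) })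
      (lookup (V-S ∷ V-T ∷ E-T ∷ R-β ∷ R-≼ ∷ []))
      (λ { zero → refl ; (suc zero) → refl ; (suc (suc zero)) → refl
         ; (suc (suc (suc zero))) → refl ; (suc (suc (suc (suc zero)))) → refl })
      (λ { V-S → refl ; V-T → refl ; E-T → refl ; R-β → refl ; R-≼ → refl })
  ; arity  = λ { V-S → 1 ; V-T → 1 ; E-T → 2 ; R-β → 2 ; R-≼ → 3 }
  }

infix 8 _⋆
_⋆ : Vocabulary → Vocabulary
τ ⋆ = τ ⊕ tree-vocabulary

allInj₁ : ∀ {X Y : Set} {n} → Vec (X ⊎ Y) n → Maybe (Vec X n)
allInj₁ []            = just []
allInj₁ (inj₁ x ∷ zs) = Maybe.map (x ∷_) (allInj₁ zs)
allInj₁ (inj₂ _ ∷ _)  = nothing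

extendRel : ∀ {X} (S : 𝒫 X) → (Elem S → Elem S → Bool) → X → X → Bool
extendRel S r x y with T? (S x) | T? (S y)
... | yes p | yes q = r (x , p) (y , q)
... | _     | _     = false

record OrderedTreeExtension {τ} (A : Structure τ) : Set₁ where
  field
    decomposition : TreeDecomposition A
  open TreeDecomposition decomposition public
  field
    order : (t : Node) → LinearOrder (Elem (β t))

  structure : Structure (τ ⋆)
  structure = record
    { U      = U A ⊎ Node
    ; finite = finite-⊎ (Structure.finite A) finite
    ; rel    = rel⋆
    }
    where
    rel⋆ : Interpretation (τ ⋆) (U A ⊎ Node)
    rel⋆ (inj₁ R) zs = Maybe.maybe′ (rel A R) false (allInj₁ zs)
    rel⋆ (inj₂ V-S) (inj₁ _ ∷ [])                    = true
    rel⋆ (inj₂ V-T) (inj₂ _ ∷ [])                    = true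
    rel⋆ (inj₂ E-T) (inj₂ t ∷ inj₂ u ∷ [])           = edge t u
    rel⋆ (inj₂ R-β) (inj₂ t ∷ inj₁ v ∷ [])           = β t v
    rel⋆ (inj₂ R-≼) (inj₂ t ∷ inj₁ v ∷ inj₁ w ∷ [])  = extendRel (β t) (leq (order t)) v w
    rel⋆ (inj₂ _)   _                                = false

unary : ℕ → Vocabulary
unary p = record { Symbol = Fin p ; finite = finite-Fin p ; arity = λ _ → 1 }

record Transduction (τ τ′ : Vocabulary) (width parameters : ℕ) : Set where
  field
    λ-valid : Sentence (τ ⊕ unary parameters) MSO
    λ-U     : Fin width → Formula (τ ⊕ unary parameters) MSO 1 0
    λ-R     : (R : Symbol τ′) → Vec (Fin width) (arity τ′ R) →
              Formula (τ ⊕ unary parameters) MSO (arity τ′ R) 0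

module _ {τ τ′ w p} (Λ : Transduction τ τ′ w p) (A : Structure τ) where
  open Transduction Λ

  withParameters : (Fin p → 𝒫 (U A)) → Structure (τ ⊕ unary p)
  withParameters P = expand A λ { j (x ∷ []) → P j x }

  transduce : (Fin p → 𝒫 (U A)) → Structure τ′
  transduce P = record
    { U      = Elem universe
    ; finite = finite-Elem (finite-× (Structure.finite A) (finite-Fin w)) universe
    ; rel    = λ R xs → ⌊ sat? A,P (map (proj₁ ∘ proj₁) xs) [] (λ-R R (map (proj₂ ∘ proj₁) xs)) ⌋
    }
    where
    A,P : Structure (τ ⊕ unary p)
    A,P = withParameters P
    universe : 𝒫 (U A × Fin w)
    universe (a , i) = ⌊ sat? A,P (a ∷ []) [] (λ-U i) ⌋

  Image : Pred (Structure τ′) (lsuc 0ℓ)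
  Image B = Σ[ P ∈ (Fin p → 𝒫 (U A)) ] (withParameters P ⊨ λ-valid) × B ≡ transduce P

AdmitsOrderedTreeDecompositions : ∀ {ℓ τ} → Pred (Structure τ) ℓ → Set (lsuc 0ℓ ⊔ ℓ)
AdmitsOrderedTreeDecompositions {τ = τ} 𝒞 =
  ∃[ k ] ∃[ w ] ∃[ p ] Σ[ Λ⋆ ∈ Transduction τ (τ ⋆) w p ]
    (∀ A → A ∈ 𝒞 →
      Satisfiable (Image Λ⋆ A) ×
      (∀ B → B ∈ Image Λ⋆ A →
        Σ[ E ∈ OrderedTreeExtension A ]
          (B ≅ OrderedTreeExtension.structure E) × OrderedTreeExtension.adhesion E ≤ k))

{-# OPTIONS --safe #-}
module Submission where

-- Let q be the quantifier rank of φ.  The tree decomposition is pruned bottom-up: among the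
-- children of a node that share their adhesion set and whose (pruned) cones have the same q-type
-- over it, only 2^q − 1 are retained.  Retained siblings with equal adhesion sets are then
-- distinguished by boundedly many colours, so, once the colours have been guessed, MSO defines a
-- depth-first linear order on the retained part and evaluates φ there.  The q-types of pruned
-- cones refer to the same definable order, hence MSO can also verify that the guess is a pruning.
--
-- Deleting one surplus cone does not affect φ: by order invariance, one may choose the order in
-- which the rest of the structure comes first and the 2^q equivalent sibling cones follow as
-- consecutive blocks, and an Ehrenfeucht–Fraïssé game of q rounds cannot tell 2^q from 2^q − 1
-- such blocks.  The surplus cones are deleted deepest first, so that all cones at the depth under
-- consideration are already pruned; no order on the whole structure is ever needed.  The resulting
-- sentence about ordered tree extensions is finally pulled back along the transduction.

open import Level using (Level)
open import Data.Bool.Base using (Bool; true; false; T; _∧_; _∨_; if_then_else_)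
open import Data.Bool.Properties using (T?; T-irrelevant; T-∧; T-∨) renaming (_≟_ to _≟ᴮ_)
open import Data.Empty using (⊥; ⊥-elim)
open import Data.Fin.Base as Fin
  using (Fin; zero; suc; toℕ; fromℕ<; combine; remQuot; funToFin; finToFun; _↑ˡ_; _↑ʳ_)
import Data.Fin.Properties as Fin
open import Data.List.Base as List
  using (List; []; _∷_; allFin; cartesianProductWith; concatMap; filterᵇ)
open import Data.List.Extrema.Nat using (xs≤max)
open import Data.List.Membership.Propositional renaming (_∈_ to _∈ˡ_)
open import Data.List.Membership.Propositional.Properties
  using (∈-allFin; ∈-cartesianProduct⁺; ∈-cartesianProductWith⁺; ∈-++⁺ˡ; ∈-++⁺ʳ; ∈-map⁺; ∈-concatMap⁺; ∈-filter⁺)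
import Data.List.Relation.Unary.All as ListAll
open import Data.List.Relation.Unary.Any as Any using (here; there)
open import Data.List.Relation.Unary.Any.Properties using (lookup-index)
open import Data.Maybe.Base as Maybe using (Maybe; just; nothing)
open import Data.Maybe.Properties using (just-injective; ≡-dec)
open import Data.Nat.Base hiding (compare)
open import Data.Nat.Properties
open import Data.Product.Base using (Σ-syntax; ∃; ∃-syntax; _×_; _,_; proj₁; proj₂; uncurry)
open import Data.Sum.Base as Sum using (_⊎_; inj₁; inj₂; reduce)
open import Data.Sum.Properties using (inj₁-injective; inj₂-injective)
open import Data.Unit.Base using (⊤; tt)
open import Data.Vec.Base as Vec using (Vec; []; _∷_; lookup; map; tabulate; _++_)
open import Data.Vec.Properties
  using (lookup-map; map-id; map-∘; map-cong; lookup∘tabulate; lookup-++ˡ; lookup-++ʳ; tabulate-cong; tabulate∘lookup)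
open import Data.Vec.Relation.Unary.All using (All; []; _∷_)
open import Function.Base using (_∘_; id)
open import Function.Bundles using (Inverse; _⇔_; mk⇔; Equivalence; mk↔ₛ′)
open import Function.Construct.Symmetry using (↔-sym)
open import Relation.Binary.Construct.Closure.ReflexiveTransitive using (Star; ε; _◅_; _◅◅_)
open import Relation.Binary.Construct.Closure.Symmetric using (fwd; bwd)
open import Relation.Binary.Definitions using (tri<; tri≈; tri>)
open import Relation.Binary.PropositionalEquality
open import Relation.Binary.Structures using (IsTotalOrder)
open import Relation.Nullary using (¬_; Dec; yes; no)
open import Relation.Nullary.Decidable
  using (⌊_⌋; toWitness; fromWitness; map′; decidable-stable; ¬?; _×-dec_)
open import Relation.Unary using (Pred; _∈_)
open import Defs

open Equivalence using (to; from)


-- Types of bounded quantifier rank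

-- An ordered tree extension orders every bag, and with it, lexicographically, the adhesion sets of
-- the children of a node. What MSO cannot order is an unbounded family of siblings with one
-- adhesion set; this is why cones are pruned. A colour is a pair of a type and a position below 2^q
-- - 1. There are boundedly many colours because the bound k on the adhesion lets types be taken
-- over tuples of length k that list the adhesion set. The same tuple lets cones act as summands of
-- an ordered sum although relations link them to the context: a relation can leave a cone only
-- through the adhesion set, whose elements are constants of the type. Types mention the order, the
-- order mentions colours, and colours are chosen by type; this is not circular, because the cone of
-- a node depends only on colours strictly below that node. The sentence need not force the guess to
-- be any particular pruning: it suffices that every uncoloured non-root node has enough coloured
-- twins, which is a definable condition.

T-ext : ∀ {b c} → (T b → T c) → (T c → T b) → b ≡ c
T-ext {true}  {true}  _ _ = refl
T-ext {true}  {false} f _ with () ← f _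
T-ext {false} {true}  _ g with () ← g _
T-ext {false} {false} _ _ = refl

⌊⌋-cong : ∀ {P Q : Set} (P? : Dec P) (Q? : Dec Q) → (P → Q) → (Q → P) → ⌊ P? ⌋ ≡ ⌊ Q? ⌋
⌊⌋-cong P? Q? f g = T-ext (fromWitness {a? = Q?} ∘ f ∘ toWitness {a? = P?})
                          (fromWitness {a? = P?} ∘ g ∘ toWitness {a? = Q?})

-- Bit strings coded as numbers, so that types form initial segments of ℕ.
bit : Bool → Fin 2
bit true  = suc zero
bit false = zero

bit⁻¹ : Fin 2 → Bool
bit⁻¹ zero    = false
bit⁻¹ (suc _) = true

bit⁻¹-bit : ∀ b → bit⁻¹ (bit b) ≡ b
bit⁻¹-bit true  = refl
bit⁻¹-bit false = refl

bit-bit⁻¹ : ∀ i → bit (bit⁻¹ i) ≡ i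
bit-bit⁻¹ zero       = refl
bit-bit⁻¹ (suc zero) = refl

funToFin-cong : ∀ {m n} {f g : Fin m → Fin n} → (∀ i → f i ≡ g i) → funToFin f ≡ funToFin g
funToFin-cong {zero}  e = refl
funToFin-cong {suc m} e = cong₂ combine (e zero) (funToFin-cong (e ∘ suc))

encode : ∀ {n} → (Fin n → Bool) → Fin (2 ^ n)
encode f = funToFin (bit ∘ f)

decode : ∀ {n} → Fin (2 ^ n) → Fin n → Bool
decode {n} θ i = bit⁻¹ (finToFun {2} {n} θ i)

decode-encode : ∀ {n} (f : Fin n → Bool) i → decode (encode f) i ≡ f i
decode-encode f i = trans (cong bit⁻¹ (Fin.finToFun-funToFin (bit ∘ f) i)) (bit⁻¹-bit (f i))

encode-cong : ∀ {n} {f g : Fin n → Bool} → (∀ i → f i ≡ g i) → encode f ≡ encode g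
encode-cong e = funToFin-cong (cong bit ∘ e)

encode-decode : ∀ {n} (θ : Fin (2 ^ n)) → encode {n} (decode {n} θ) ≡ θ
encode-decode {n} θ = trans (funToFin-cong (λ i → bit-bit⁻¹ (finToFun {2} {n} θ i)))
    (Fin.funToFin-finToFin {n} {2} θ)

encode-injective : ∀ {n} {f g : Fin n → Bool} → encode f ≡ encode g → ∀ i → f i ≡ g i
encode-injective {f = f} {g} e i =
  trans (sym (decode-encode f i)) (trans (cong (λ θ → decode θ i) e) (decode-encode g i))

∈-elements : ∀ {X} (fin : Finite X) x → x ∈ˡ elements fin
∈-elements (n , f) x = subst (_∈ˡ List.map (Inverse.from f) (allFin n)) (Inverse.strictlyInverseʳ f x)
  (∈-map⁺ (Inverse.from f) (∈-allFin (Inverse.to f x)))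

allVecs : ∀ {X : Set} → List X → ∀ r → List (Vec X r)
allVecs xs zero    = [] ∷ []
allVecs xs (suc r) = cartesianProductWith _∷_ xs (allVecs xs r)

∈-allVecs : ∀ {X : Set} {xs : List X} → (∀ x → x ∈ˡ xs) → ∀ {r} (v : Vec X r) → v ∈ˡ allVecs xs r
∈-allVecs all []      = here refl
∈-allVecs all (x ∷ v) = ∈-cartesianProductWith⁺ _∷_ (all x) (∈-allVecs all v)

module _ (υ : Vocabulary) where
  data Atom (n : ℕ) : Set where
    equal   : (i j : Fin n) → Atom n
    related : (R : Symbol υ) → Vec (Fin n) (arity υ R) → Atom n

  atoms : ∀ n → List (Atom n)
  atoms n = cartesianProductWith equal (allFin n) (allFin n) List.++
    concatMap (λ R → List.map (related R) (allVecs (allFin n) (arity υ R)))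
              (elements (Vocabulary.finite υ))

  ∈-atoms : ∀ {n} (α : Atom n) → α ∈ˡ atoms n
  ∈-atoms (equal i j)    = ∈-++⁺ˡ (∈-cartesianProductWith⁺ equal (∈-allFin i) (∈-allFin j))
  ∈-atoms {n} (related R is) = ∈-++⁺ʳ (cartesianProductWith equal (allFin n) (allFin n))
    (∈-concatMap⁺ (λ R → List.map (related R) (allVecs (allFin n) (arity υ R)))
      (Any.map (λ { refl → ∈-map⁺ (related R) (∈-allVecs ∈-allFin is) })
               (∈-elements (Vocabulary.finite υ) R)))

  #atoms : ℕ → ℕ
  #atoms n = List.length (atoms n)

  #Types : ℕ → ℕ → ℕ
  #Types zero    n = 2 ^ #atoms n
  #Types (suc q) n = #Types q n * 2 ^ #Types q (suc n)

module _ {υ : Vocabulary} {X : Set} (fin : Finite X) where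

  holds : Interpretation υ X → ∀ {n} → Vec X n → Atom υ n → Bool
  holds I a (equal i j)    = ⌊ finite-≟ fin (lookup a i) (lookup a j) ⌋
  holds I a (related R is) = I R (map (lookup a) is)

  abstract
    -- Types in the structure I with quantifiers ranging over D only.
    tp : Interpretation υ X → 𝒫 X → ∀ q {n} → Vec X n → Fin (#Types υ q n)
    extension? : ∀ I D q {n} (a : Vec X n) ξ → Dec (∃[ x ] T (D x) × tp I D q (x ∷ a) ≡ ξ)

    tp I D zero    {n} a = encode (λ i → holds I a (List.lookup (atoms υ n) i))
    tp I D (suc q) a     = combine (tp I D q a) (encode (λ ξ → ⌊ extension? I D q a ξ ⌋))
    extension? I D q a ξ = finite-∃? fin (λ x → T? (D x) ×-dec tp I D q (x ∷ a) Fin.≟ ξ)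

    tp-zero : ∀ I D {n} (a : Vec X n) → tp I D 0 a ≡ encode (λ i → holds I a (List.lookup (atoms υ n) i))
    tp-zero I D a = refl

    tp-suc : ∀ I D q {n} (a : Vec X n) →
             tp I D (suc q) a ≡ combine (tp I D q a) (encode (λ ξ → ⌊ extension? I D q a ξ ⌋))
    tp-suc I D q a = refl

    tp-cong : ∀ {I I′ D D′} → (∀ R xs → I R xs ≡ I′ R xs) → (∀ x → D x ≡ D′ x) →
              ∀ q {n} (a : Vec X n) → tp I D q a ≡ tp I′ D′ q a
    tp-cong {I} {I′} eI eD zero {n} a = encode-cong (λ i → go (List.lookup (atoms υ n) i))
      where
      go : ∀ α → holds I a α ≡ holds I′ a α
      go (equal i j)    = refl
      go (related R is) = eI R (map (lookup a) is)
    tp-cong {I} {I′} {D} {D′} eI eD (suc q) a = cong₂ combine (tp-cong eI eD q a) (encode-cong λ ξ →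
      ⌊⌋-cong (extension? I D q a ξ) (extension? I′ D′ q a ξ)
        (λ (x , d , e) → x , subst T (eD x) d , trans (sym (tp-cong eI eD q (x ∷ a))) e)
        (λ (x , d , e) → x , subst T (sym (eD x)) d , trans (tp-cong eI eD q (x ∷ a)) e))

  module _ {I I′ : Interpretation υ X} {D D′ : 𝒫 X} where

    abstract

      -- A code of rank `suc q` has the code of rank `q` as its first component, so lowering the
      -- rank is a projection.
      tp-down : ∀ q {n} (a b : Vec X n) → tp I D (suc q) a ≡ tp I′ D′ (suc q) b →
                tp I D q a ≡ tp I′ D′ q b
      tp-down q a b = Fin.combine-injectiveˡ (tp I D q a) _ (tp I′ D′ q b) _

      -- The bit for the extension type realised by x is set on the left; equal codes have equal
      -- bits, so some y realises it on the right.
      tp-forth : ∀ q {n} (a b : Vec X n) → tp I D (suc q) a ≡ tp I′ D′ (suc q) b →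
                 ∀ x → T (D x) → ∃[ y ] T (D′ y) × tp I D q (x ∷ a) ≡ tp I′ D′ q (y ∷ b)
      tp-forth q {n} a b e x d =
        let y , d′ , e′ = toWitness {a? = extension? I′ D′ q b ξ} (subst T bits
                            (fromWitness {a? = extension? I D q a ξ} (x , d , refl)))
        in y , d′ , sym e′
        where
        ξ : Fin (#Types υ q (suc n))
        ξ = tp I D q (x ∷ a)
        bits : ⌊ extension? I D q a ξ ⌋ ≡ ⌊ extension? I′ D′ q b ξ ⌋
        bits = encode-injective {f = λ ξ → ⌊ extension? I D q a ξ ⌋} {λ ξ → ⌊ extension? I′ D′ q b ξ ⌋}
          (Fin.combine-injectiveʳ (tp I D q a) _ (tp I′ D′ q b) _ e) ξ

      tp-holds : ∀ q {n} (a b : Vec X n) → tp I D q a ≡ tp I′ D′ q b →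
                 ∀ α → holds I a α ≡ holds I′ b α
      tp-holds zero {n} a b e α = subst (λ α → holds I a α ≡ holds I′ b α)
        (sym (lookup-index (∈-atoms υ α)))
        (encode-injective {f = λ i → holds I a (List.lookup (atoms υ n) i)}
                          {λ i → holds I′ b (List.lookup (atoms υ n) i)} e (Any.index (∈-atoms υ α)))
      tp-holds (suc q) a b e = tp-holds q a b (tp-down q a b e)

-- Ehrenfeucht–Fraïssé games on ordered sums

qr : ∀ {υ m s} → Formula υ FO m s → ℕ
qr (x ≐ y)     = 0
qr (atom R xs) = 0
qr (¬ᶠ φ)      = qr φ
qr (φ ∧ᶠ ψ)    = qr φ ⊔ qr ψ
qr (φ ∨ᶠ ψ)    = qr φ ⊔ qr ψ
qr (∃ᶠ φ)      = suc (qr φ)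
qr (∀ᶠ φ)      = suc (qr φ)

module BackAndForth {υ} (𝔸 𝔹 : Structure υ)
  (I : ℕ → ∀ {n} → Vec (U 𝔸) n → Vec (U 𝔹) n → Set)
  (equality : ∀ {q n} {a : Vec (U 𝔸) n} {b} → I q a b → ∀ i j →
              (lookup a i ≡ lookup a j) ⇔ (lookup b i ≡ lookup b j))
  (relation : ∀ {q n} {a : Vec (U 𝔸) n} {b} → I q a b → ∀ R is →
              T (rel 𝔸 R (map (lookup a) is)) ⇔ T (rel 𝔹 R (map (lookup b) is)))
  (forth : ∀ {q n} {a : Vec (U 𝔸) n} {b} → I (suc q) a b → ∀ x → ∃[ y ] I q (x ∷ a) (y ∷ b))
  (back  : ∀ {q n} {a : Vec (U 𝔸) n} {b} → I (suc q) a b → ∀ y → ∃[ x ] I q (x ∷ a) (y ∷ b))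
  where

  -- Positions respect atoms at every `q`, so spare rounds do no harm and the induction can run with
  -- `qr φ ≤ q` instead of equality.
  transfer : ∀ {q m} {a : Vec (U 𝔸) m} {b} (φ : Formula υ FO m 0) → qr φ ≤ q → I q a b →
             Sat 𝔸 a [] φ ⇔ Sat 𝔹 b [] φ
  transfer (x ≐ y)     _ i = equality i x y
  transfer (atom R xs) _ i = relation i R xs
  transfer (¬ᶠ φ)      r i = let e = transfer φ r i in mk⇔ (_∘ from e) (_∘ to e)
  transfer (φ ∧ᶠ ψ)    r i =
    let e = transfer φ (m⊔n≤o⇒m≤o (qr φ) (qr ψ) r) i
        f = transfer ψ (m⊔n≤o⇒n≤o (qr φ) (qr ψ) r) i
    in mk⇔ (λ (p , q) → to e p , to f q) (λ (p , q) → from e p , from f q)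
  transfer (φ ∨ᶠ ψ)    r i =
    let e = transfer φ (m⊔n≤o⇒m≤o (qr φ) (qr ψ) r) i
        f = transfer ψ (m⊔n≤o⇒n≤o (qr φ) (qr ψ) r) i
    in mk⇔ (λ { (inj₁ p) → inj₁ (to e p) ; (inj₂ q) → inj₂ (to f q) })
           (λ { (inj₁ p) → inj₁ (from e p) ; (inj₂ q) → inj₂ (from f q) })
  transfer (∃ᶠ φ) (s≤s r) i = mk⇔
    (λ (x , p) → let y , j = forth i x in y , to (transfer φ r j) p)
    (λ (y , p) → let x , j = back i y in x , from (transfer φ r j) p)
  transfer (∀ᶠ φ) (s≤s r) i = mk⇔
    (λ p y → let x , j = back i y in to (transfer φ r j) (p x))
    (λ p x → let y , j = forth i x in from (transfer φ r j) (p y))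

-- Numbers that cannot be told apart in q rounds as lengths of linear orders.
threshold : ℕ → ℕ
threshold zero    = 0
threshold (suc q) = suc (threshold q + threshold q)

_≈[_]_ : ℕ → ℕ → ℕ → Set
m ≈[ q ] n = m ≡ n ⊎ (threshold q ≤ m × threshold q ≤ n)

≈-sym : ∀ {q m n} → m ≈[ q ] n → n ≈[ q ] m
≈-sym (inj₁ e)       = inj₁ (sym e)
≈-sym (inj₂ (a , b)) = inj₂ (b , a)

threshold-step : ∀ q → threshold q ≤ threshold (suc q)
threshold-step q = m≤n⇒m≤1+n (m≤m+n (threshold q) _)

≈-down : ∀ {q m n} → m ≈[ suc q ] n → m ≈[ q ] n
≈-down (inj₁ e) = inj₁ e
≈-down {q} (inj₂ (a , b)) = inj₂ (≤-trans (threshold-step q) a , ≤-trans (threshold-step q) b)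

-- The reply to a move that splits a linear order. If both parts reach the threshold, exactly
-- `threshold q` points are left below the reply; otherwise a short part is copied exactly. The
-- other part is then long on both sides, since `threshold (suc q)` is twice `threshold q` plus one.
≈-split : ∀ {q} y z {n} → (y + suc z) ≈[ suc q ] n →
          ∃[ y′ ] ∃[ z′ ] n ≡ y′ + suc z′ × y ≈[ q ] y′ × z ≈[ q ] z′
≈-split y z (inj₁ e) = y , z , sym e , inj₁ refl , inj₁ refl
≈-split {q} y z {n} (inj₂ (a , b)) with threshold q ≤? y | threshold q ≤? z
... | yes p | yes r = t , n ∸ suc t , sym (m+[n∸m]≡n′ t<n) , inj₂ (p , ≤-refl) , inj₂ (r , rest)
  where
  t = threshold q
  t<n : suc t ≤ n
  t<n = ≤-trans (s≤s (m≤m+n t t)) b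
  m+[n∸m]≡n′ : ∀ {m n} → suc m ≤ n → m + suc (n ∸ suc m) ≡ n
  m+[n∸m]≡n′ {m} {n} l = trans (+-suc m _) (m+[n∸m]≡n l)
  rest : t ≤ n ∸ suc t
  rest = subst (_≤ n ∸ suc t) (m+n∸m≡n t t) (∸-monoˡ-≤ (suc t) b)
... | yes p | no ¬r = n ∸ suc z , z , sym (m∸n+n≡m z<n) , inj₂ (p , rest) , inj₁ refl
  where
  t = threshold q
  z<n : suc z ≤ n
  z<n = ≤-trans (≰⇒> ¬r) (≤-trans (threshold-step q) b)
  rest : t ≤ n ∸ suc z
  rest = m+n≤o⇒m≤o∸n t (≤-trans (≤-trans (+-monoʳ-≤ t (≰⇒> ¬r)) (n≤1+n _)) b)
... | no ¬p | _ = y , n ∸ suc y , sym eq , inj₁ refl , inj₂ (zr , rest)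
  where
  t = threshold q
  y<t : suc y ≤ t
  y<t = ≰⇒> ¬p
  y<n : suc y ≤ n
  y<n = ≤-trans y<t (≤-trans (threshold-step q) b)
  eq : y + suc (n ∸ suc y) ≡ n
  eq = trans (+-suc y _) (m+[n∸m]≡n y<n)
  zr : t ≤ z
  zr = +-cancelˡ-≤ (suc t) _ _ (≤-trans a (subst (_≤ suc t + z) (sym (+-suc y z))
      (+-monoˡ-≤ z (m≤n⇒m≤1+n y<t))))
  rest : t ≤ n ∸ suc y
  rest = m+n≤o⇒m≤o∸n t (≤-trans (≤-trans (+-monoʳ-≤ t y<t) (n≤1+n _)) b)

-- `size` and `size′` count the untouched blocks strictly between two corresponding pairs of touched
-- ones.
record Gap (q lo hi lo′ hi′ : ℕ) : Set where
  constructor gap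
  field
    {size size′} : ℕ
    hi≡          : hi ≡ suc (lo + size)
    hi′≡         : hi′ ≡ suc (lo′ + size′)
    size≈        : size ≈[ q ] size′

Gap-sym : ∀ {q lo hi lo′ hi′} → Gap q lo hi lo′ hi′ → Gap q lo′ hi′ lo hi
Gap-sym {q} (gap e e′ r) = gap e′ e (≈-sym {q} r)

Gap-down : ∀ {q lo hi lo′ hi′} → Gap (suc q) lo hi lo′ hi′ → Gap q lo hi lo′ hi′
Gap-down (gap e e′ r) = gap e e′ (≈-down r)

Gap-< : ∀ {q lo hi lo′ hi′} → Gap q lo hi lo′ hi′ → lo < hi
Gap-< (gap refl _ _) = s≤s (m≤m+n _ _)

Gap-split : ∀ {q lo hi lo′ hi′} → Gap (suc q) lo hi lo′ hi′ → ∀ {i} → lo < i → i < hi →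
            ∃[ i′ ] Gap q lo i lo′ i′ × Gap q i hi i′ hi′
Gap-split {q} {lo} {hi} {lo′} (gap {x} {x′} refl refl r) {i} lo<i i<hi =
  let y′ , z′ , e′ , ry , rz = ≈-split {q} y z (subst (_≈[ suc q ] x′) x≡ r)
  in suc (lo′ + y′) , gap i≡ refl ry ,
     gap hi≡ (cong suc (trans (cong (lo′ +_) e′) (trans (cong (lo′ +_) (+-suc y′ z′))
       (trans (+-suc lo′ _) (cong suc (sym (+-assoc lo′ y′ z′))))))) rz
  where
  y = i ∸ suc lo
  z = lo + x ∸ i
  i≡ : i ≡ suc (lo + y)
  i≡ = sym (m+[n∸m]≡n lo<i)
  hi≡ : suc (lo + x) ≡ suc (i + z)
  hi≡ = cong suc (sym (m+[n∸m]≡n (≤-pred i<hi)))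
  x≡ : x ≡ y + suc z
  x≡ = +-cancelˡ-≡ lo _ _ (begin
    lo + x             ≡⟨ suc-injective hi≡ ⟩
    i + z              ≡⟨ cong (_+ z) i≡ ⟩
    suc (lo + y + z)   ≡⟨ cong suc (+-assoc lo y z) ⟩
    suc (lo + (y + z)) ≡⟨ sym (+-suc lo (y + z)) ⟩
    lo + suc (y + z)   ≡⟨ cong (lo +_) (sym (+-suc y z)) ⟩
    lo + (y + suc z)   ∎)
    where open ≡-Reasoning

sub : ∀ {τ} (A : Structure τ) → 𝒫 (U A) → Structure τ
sub A S = record
  { U      = Elem S
  ; finite = finite-Elem (Structure.finite A) S
  ; rel    = λ R xs → rel A R (map proj₁ xs)
  }

restrict : ∀ {X} (S : 𝒫 X) → LinearOrder X → LinearOrder (Elem S)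
restrict {X} S o = record
  { leq = λ x y → leq o (proj₁ x) (proj₁ y)
  ; isTotalOrder = record
    { isPartialOrder = record
      { isPreorder = record
        { isEquivalence = isEquivalence
        ; reflexive = λ { refl → O.refl }
        ; trans = O.trans
        }
      ; antisym = λ p q → Elem-≡ S (O.antisym p q)
      }
    ; total = λ x y → O.total (proj₁ x) (proj₁ y)
    }
  }
  where module O = IsTotalOrder (LinearOrder.isTotalOrder o)

map-ext : ∀ {X Y : Set} {n} (xs : Vec X n) {f : X → Y} {ys : Vec Y n} →
          (∀ i → f (lookup xs i) ≡ lookup ys i) → map f xs ≡ ys
map-ext []       {ys = []}     e = refl
map-ext (x ∷ xs) {ys = y ∷ ys} e = cong₂ _∷_ (e zero) (map-ext xs (e ∘ suc))

module _ {X : Set} (blk : X → ℕ) (S : 𝒫 X) where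

  -- What remains of S after the blocks 1, …, lo have been deleted.
  remaining : ℕ → 𝒫 X
  remaining lo v = S v ∧ ((blk v ≡ᵇ 0) ∨ (lo <ᵇ blk v))

  remaining⁺ : ∀ {lo v} → T (S v) → blk v ≡ 0 ⊎ lo < blk v → T (remaining lo v)
  remaining⁺ s (inj₁ z) = from T-∧ (s , from T-∨ (inj₁ (≡⇒≡ᵇ _ _ z)))
  remaining⁺ s (inj₂ l) = from T-∧ (s , from T-∨ (inj₂ (<⇒<ᵇ l)))

  remaining⁻ : ∀ {lo v} → T (remaining lo v) → T (S v) × (blk v ≡ 0 ⊎ lo < blk v)
  remaining⁻ t with to T-∧ t
  ... | s , c with to T-∨ c
  ...   | inj₁ z = s , inj₁ (≡ᵇ⇒≡ _ _ z)
  ...   | inj₂ l = s , inj₂ (<ᵇ⇒< _ _ l)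

orderedSub : ∀ {τ} (A : Structure τ) → LinearOrder (U A) → 𝒫 (U A) → Structure (τ ⊕ ≤-vocabulary)
orderedSub A o S = sub A S ,≤ restrict S o

-- Block 0 is the context, in which every move is copied; the blocks 1, ..., N follow it in the
-- order `o`, and inside block i the game is played on the types given by `I i` and `D i` over the
-- constants `c̄`. The crucial hypothesis is `local`: a related tuple that enters a block consists
-- of elements of this block and of constants, so its truth is visible in the type of a single
-- block. Both sides are substructures of A, so equality of types in one carrier X is enough.
module Composition {τ} (A : Structure τ) (o : LinearOrder (U A))
  (blk : U A → ℕ) (N : ℕ) (blk≤N : ∀ v → blk v ≤ N) (S : 𝒫 (U A))
  {X : Set} (fin : Finite X) (ι : U A → X) (ι-injective : ∀ {u v} → ι u ≡ ι v → u ≡ v)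
  {k} (c̄ : Vec X k)
  (I : ℕ → Interpretation (τ ⊕ ≤-vocabulary) X) (D : ℕ → 𝒫 X)
  (D⇒blk : ∀ {i x} → T (D (suc i) x) → ∃[ v ] x ≡ ι v × blk v ≡ suc i × T (S v))
  (blk⇒D : ∀ {i v} → blk v ≡ suc i → T (D (suc i) (ι v)))
  (I-rel : ∀ i R xs → I i (inj₁ R) (map ι xs) ≡ rel A R xs)
  (I-leq : ∀ {i x y} → blk x ≡ suc i → blk y ≡ suc i →
           I (suc i) (inj₂ tt) (ι x ∷ ι y ∷ []) ≡ leq o x y)
  (blk<⇒leq : ∀ {x y} → blk x < blk y → T (leq o x y))
  (local : ∀ R xs → T (rel A R xs) → (∀ j → T (S (lookup xs j))) →
           ∀ {i} j → blk (lookup xs j) ≡ suc i → ∀ j′ → blk (lookup xs j′) ≡ suc i ⊎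
             (blk (lookup xs j′) ≡ 0 × ∃[ l ] lookup c̄ l ≡ ι (lookup xs j′)))
  (Q : ℕ)
  (homogeneous : ∀ i j → suc i ≤ N → suc j ≤ N →
    tp {τ ⊕ ≤-vocabulary} fin (I (suc i)) (D (suc i)) Q c̄ ≡ tp {τ ⊕ ≤-vocabulary} fin (I (suc j)) (D (suc j))
        Q c̄)
  where

  private
    module O = IsTotalOrder (LinearOrder.isTotalOrder o)

    beyond : ℕ → 𝒫 (U A)
    beyond = remaining blk S

    side : ℕ → Structure (τ ⊕ ≤-vocabulary)
    side lo = orderedSub A o (beyond lo)

  ty : ∀ q (i : ℕ) {n} → Vec X n → Fin (#Types (τ ⊕ ≤-vocabulary) q n)
  ty q i = tp {τ ⊕ ≤-vocabulary} fin (I i) (D i) q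

  homogeneous-down : ∀ q p → q + p ≡ Q → ∀ i j → suc i ≤ N → suc j ≤ N →
                     ty p (suc i) c̄ ≡ ty p (suc j) c̄
  homogeneous-down zero    p refl i j a b = homogeneous i j a b
  homogeneous-down (suc q) p refl i j a b = tp-down {τ ⊕ ≤-vocabulary} fin p c̄ c̄
    (homogeneous-down q (suc p) (+-suc q p) i j a b)

  homogeneous-≤ : ∀ {p} → p ≤ Q → ∀ i j → 0 < i → 0 < j → i ≤ N → j ≤ N → ty p i c̄ ≡ ty p j c̄
  homogeneous-≤ {p} p≤Q (suc i) (suc j) _ _ = homogeneous-down (Q ∸ p) p (m∸n+n≡m p≤Q) i j

  -- The blocks touched so far, in increasing order, with the elements chosen in them.
  data Chain (q : ℕ) (lo lo′ : ℕ) : Set where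
    end  : Gap q lo (suc N) lo′ (suc N) → Chain q lo lo′
    node : ∀ {i i′ n} (as bs : Vec X n) → Gap q lo i lo′ i′ →
           ty q i (as ++ c̄) ≡ ty q i′ (bs ++ c̄) → Chain q i i′ → Chain q lo lo′

  data In {q : ℕ} : ∀ {lo lo′} → Chain q lo lo′ → U A → U A → Set where
    here  : ∀ {lo lo′ i i′ n} {as bs : Vec X n} {g : Gap q lo i lo′ i′} {e ch x y} (l : Fin n) →
            lookup as l ≡ ι x → lookup bs l ≡ ι y → blk x ≡ i → blk y ≡ i′ →
            In (node as bs g e ch) x y
    there : ∀ {lo lo′ i i′ n} {as bs : Vec X n} {g : Gap q lo i lo′ i′} {e ch x y} →
            In ch x y → In (node as bs g e ch) x y

  flipᶜ : ∀ {q lo lo′} → Chain q lo lo′ → Chain q lo′ lo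
  flipᶜ (end g)              = end (Gap-sym g)
  flipᶜ (node as bs g e ch)  = node bs as (Gap-sym g) (sym e) (flipᶜ ch)

  In-flip : ∀ {q lo lo′} {ch : Chain q lo lo′} {x y} → In ch x y → In (flipᶜ ch) y x
  In-flip (here l a b p r) = here l b a r p
  In-flip (there m)        = there (In-flip m)

  down : ∀ {q lo lo′} → Chain (suc q) lo lo′ → Chain q lo lo′
  down (end g)             = end (Gap-down g)
  down {q} (node as bs g e ch) = node as bs (Gap-down g) (tp-down {τ ⊕ ≤-vocabulary} fin q (as ++ c̄)
      (bs ++ c̄) e) (down ch)

  In-down : ∀ {q lo lo′} {ch : Chain (suc q) lo lo′} {x y} → In ch x y → In (down ch) x y
  In-down (here l a b p r) = here l a b p r
  In-down (there m)        = there (In-down m)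

  Chain-< : ∀ {q lo lo′} → Chain q lo lo′ → lo ≤ N
  Chain-< (end g)             = ≤-pred (Gap-< g)
  Chain-< (node as bs g e ch) = ≤-trans (<⇒≤ (Gap-< g)) (Chain-< ch)

  In-<ˡ : ∀ {q lo lo′} {ch : Chain q lo lo′} {x y} → In ch x y → lo < blk x
  In-<ˡ (here {g = g} l a b refl refl) = Gap-< g
  In-<ˡ (there {g = g} m)        = <-trans (Gap-< g) (In-<ˡ m)

  In-<ʳ : ∀ {q lo lo′} {ch : Chain q lo lo′} {x y} → In ch x y → lo′ < blk y
  In-<ʳ m = In-<ˡ (In-flip m)

  In-mono : ∀ {q lo lo′} {ch : Chain q lo lo′} {x y u v} → In ch x y → In ch u v →
            blk x < blk u → blk y < blk v
  In-mono (here l a b refl refl) (here l₁ a₁ b₁ p₁ r₁) lt = ⊥-elim (<-irrefl (sym p₁) lt)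
  In-mono (here l a b refl refl) (there m′) lt = In-<ʳ m′
  In-mono (there m) (here l a b refl refl) lt = ⊥-elim (<-asym lt (In-<ˡ m))
  In-mono (there m) (there m′) lt = In-mono m m′ lt

  -- All pairs played in one block sit in one node of the chain. Hence equality, order and relations
  -- among them can be read off a single equality of types.
  record Located {q lo lo′} (ch : Chain q lo lo′) (x y : U A) : Set where
    field
      {size} : ℕ
      as bs  : Vec X size
      same   : ty q (blk x) (as ++ c̄) ≡ ty q (blk y) (bs ++ c̄)
      index  : Fin size
      atˡ    : lookup as index ≡ ι x
      atʳ    : lookup bs index ≡ ι y
      others : ∀ {u v} → In ch u v → blk u ≡ blk x →
               blk v ≡ blk y × ∃[ l ] lookup as l ≡ ι u × lookup bs l ≡ ι v

  locate : ∀ {q lo lo′} {ch : Chain q lo lo′} {x y} → In ch x y → Located ch x y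
  locate (here {as = as} {bs} {e = e} l a b refl refl) = record
    { as = as ; bs = bs ; same = e ; index = l ; atˡ = a ; atʳ = b
    ; others = λ { (here l′ a′ b′ p r) _ → r , l′ , a′ , b′
                 ; (there m) q → ⊥-elim (<-irrefl (sym q) (In-<ˡ m)) } }
  locate {q = q} {ch = node _ _ _ _ ch} {x} {y} (there m) = record
    { as = L.as ; bs = L.bs ; same = L.same ; index = L.index ; atˡ = L.atˡ ; atʳ = L.atʳ
    ; others = λ { (here l′ a′ b′ refl r) q → ⊥-elim (<-irrefl q (In-<ˡ m))
                 ; (there m′) q → L.others m′ q } }
    where module L = Located (locate m)

  record Reply {q lo lo′} (ch : Chain (suc q) lo lo′) (x : U A) : Set where
    field
      reply : U A
      inS   : T (S reply)
      chain : Chain q lo lo′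
      new   : In chain x reply
      old   : ∀ {u v} → In ch u v → In chain u v

  forthᴮ : ∀ {q i i′ n} (as bs : Vec X n) → 0 < i → 0 < i′ →
           ty (suc q) i (as ++ c̄) ≡ ty (suc q) i′ (bs ++ c̄) → ∀ x → blk x ≡ i →
           ∃[ y ] T (S y) × blk y ≡ i′ × ty q i ((ι x ∷ as) ++ c̄) ≡ ty q i′ ((ι y ∷ bs) ++ c̄)
  forthᴮ {q} {suc i} {suc i′} as bs _ _ e x b with tp-forth {τ ⊕ ≤-vocabulary} fin q (as ++ c̄) (bs ++ c̄) e
      (ι x) (blk⇒D b)
  ... | y , d , e′ with D⇒blk d
  ... | v , refl , b′ , s = v , s , b′ , e′

  module _ {q lo lo′ hi hi′ x} (q<Q : suc q ≤ Q) (lo<x : lo < blk x) (x<hi : blk x < hi)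
           (hi′≤ : hi′ ≤ suc N) (g : Gap (suc q) lo hi lo′ hi′) where

    private
      split : ∃[ i′ ] Gap q lo (blk x) lo′ i′ × Gap q (blk x) hi i′ hi′
      split = Gap-split g lo<x x<hi
      i′ = proj₁ split
      g₁ = proj₁ (proj₂ split)
      g₂ = proj₂ (proj₂ split)

      0<i : 0 < blk x
      0<i = ≤-<-trans z≤n lo<x

      0<i′ : 0 < i′
      0<i′ = ≤-<-trans z≤n (Gap-< (Gap-sym g₁))

      i′≤N : i′ ≤ N
      i′≤N = ≤-pred (≤-trans (Gap-< (Gap-sym g₂)) hi′≤)

    -- The first move into an untouched block. `Gap-split` chooses the block of the reply; nothing
    -- has been played in either block, so homogeneity over `c̄` alone is the type equality needed
    -- to answer inside it.
    insert : ∃[ i′ ] Gap q (blk x) hi i′ hi′ × ∃[ y ] T (S y) × (∀ rest →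
               Σ[ ch ∈ Chain q lo lo′ ] In ch x y × (∀ {u v} → In {lo = blk x} {i′} rest u v → In ch u v))
    insert =
      let y , s , b , e = forthᴮ {q} [] [] 0<i 0<i′
            (homogeneous-≤ q<Q (blk x) i′ 0<i 0<i′ (blk≤N x) i′≤N) x refl
      in i′ , g₂ , y , s , λ rest → node (ι x ∷ []) (ι y ∷ []) g₁ e rest , here zero refl refl refl b , there

  play : ∀ {q lo lo′} → suc q ≤ Q → (ch : Chain (suc q) lo lo′) → ∀ x → lo < blk x → Reply ch x
  play {q} q<Q (end g) x lo<x with insert q<Q lo<x (s≤s (blk≤N x)) ≤-refl g
  ... | i′ , g₂ , y , s , build with build (end g₂)
  ... | ch , new , _ = record { reply = y ; inS = s ; chain = ch ; new = new ; old = λ () }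
  play {q} q<Q (node {i} {i′} as bs g e ch) x lo<x = compare-node (<-cmp (blk x) i)
    where
    e↓ = tp-down {τ ⊕ ≤-vocabulary} fin q (as ++ c̄) (bs ++ c̄) e
    compare-node : _ → Reply (node as bs g e ch) x
    compare-node (tri< x<i _ _) with insert q<Q lo<x x<i (m≤n⇒m≤1+n (Chain-< (flipᶜ ch))) g
    ... | i′ , g₂ , y , s , build with build (node as bs g₂ e↓ (down ch))
    ... | ch′ , new , old = record { reply = y ; inS = s ; chain = ch′ ; new = new
      ; old = λ { (here l a b p r) → old (here l a b p r) ; (there m) → old (there (In-down m)) } }
    compare-node (tri≈ _ refl _)
      with forthᴮ {q} as bs (≤-<-trans z≤n lo<x) (≤-<-trans z≤n (Gap-< (Gap-sym g))) e x refl
    ... | y , s , b , e′ = record { reply = y ; inS = s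
      ; chain = node (ι x ∷ as) (ι y ∷ bs) (Gap-down g) e′ (down ch)
      ; new = here zero refl refl refl b
      ; old = λ { (here l a b p r) → here (suc l) a b p r ; (there m) → there (In-down m) } }
    compare-node (tri> _ _ i<x) with play q<Q ch x i<x
    ... | record { reply = y ; inS = s ; chain = ch′ ; new = new ; old = old } = record
      { reply = y ; inS = s ; chain = node as bs (Gap-down g) e↓ ch′ ; new = there new
      ; old = λ { (here l a b p r) → here l a b p r ; (there m) → there (old m) } }

  Match : ∀ {q lo lo′} → Chain q lo lo′ → U A → U A → Set
  Match ch x y = (blk x ≡ 0 × x ≡ y) ⊎ In ch x y

  Match-flip : ∀ {q lo lo′} {ch : Chain q lo lo′} {x y} → Match ch x y → Match (flipᶜ ch) y x
  Match-flip (inj₁ (z , refl)) = inj₁ (z , refl)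
  Match-flip (inj₂ m)          = inj₂ (In-flip m)

  touched : ∀ {q lo lo′} {ch : Chain q lo lo′} {x y} → In ch x y → 0 < blk x
  touched m = ≤-<-trans z≤n (In-<ˡ m)

  module _ {q lo lo′} {ch : Chain q lo lo′} where

    context≢block : ∀ {x u v} → In ch u v → blk x ≡ 0 → blk x ≢ blk u
    context≢block m z e = <-irrefl (trans (sym z) e) (touched m)

    block-0 : ∀ {x u v} → In ch u v → blk x ≡ 0 → ∀ {y} → x ≡ y → blk y < blk v
    block-0 m z refl rewrite z = touched (In-flip m)

    Match-≡ : ∀ {x y u v} → Match ch x y → Match ch u v → x ≡ u → y ≡ v
    Match-≡ (inj₁ (z , refl)) (inj₁ (_ , refl)) e = e
    Match-≡ (inj₁ (z , refl)) (inj₂ m) e = ⊥-elim (context≢block m z (cong blk e))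
    Match-≡ (inj₂ m) (inj₁ (z , refl)) e = ⊥-elim (context≢block m z (sym (cong blk e)))
    Match-≡ {x} {y} {u} {v} (inj₂ m) (inj₂ m′) refl =
      let module L = Located (locate m)
          _ , l , al , bl = L.others m′ refl
          h = tp-holds {τ ⊕ ≤-vocabulary} fin q (L.as ++ c̄) (L.bs ++ c̄) L.same (equal (L.index ↑ˡ k) (l ↑ˡ k))
      in ι-injective (trans (sym (trans (lookup-++ˡ L.bs c̄ L.index) L.atʳ))
           (trans (toWitness {a? = finite-≟ fin _ _} (subst T h (fromWitness {a? = finite-≟ fin _ _}
              (trans (lookup-++ˡ L.as c̄ L.index) (trans L.atˡ
                  (trans (sym al) (sym (lookup-++ˡ L.as c̄ l))))))))
             (trans (lookup-++ˡ L.bs c̄ l) bl)))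

    ¬leq : ∀ {x y} → blk y < blk x → ¬ T (leq o x y)
    ¬leq lt t = <-irrefl (cong blk (O.antisym (blk<⇒leq lt) t)) lt

    leq-resp : ∀ {i i′ x u y v} → blk x ≡ suc i → blk u ≡ suc i → blk y ≡ suc i′ → blk v ≡ suc i′ →
      I (blk x) (inj₂ tt) (ι x ∷ ι u ∷ []) ≡ I (blk y) (inj₂ tt) (ι y ∷ ι v ∷ []) → leq o x u ≡ leq o y v
    leq-resp p p′ r r′ h rewrite p | r = trans (sym (I-leq p p′)) (trans h (I-leq r r′))

    pred-suc : ∀ {m n} → m < n → n ≡ suc (pred n)
    pred-suc (s≤s _) = refl

    -- The context precedes all blocks on both sides, and corresponding blocks are met in the same
    -- order; only two elements of one block require the types.
    Match-≤ : ∀ {x y u v} → Match ch x y → Match ch u v → T (leq o x u) → T (leq o y v)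
    Match-≤ (inj₁ (_ , refl)) (inj₁ (_ , refl)) t = t
    Match-≤ (inj₁ (z , e)) (inj₂ m) t = blk<⇒leq (block-0 m z e)
    Match-≤ {x} (inj₂ m) (inj₁ (z , refl)) t = ⊥-elim (¬leq (subst (_< blk x) (sym z) (touched m)) t)
    Match-≤ {x} {y} {u} {v} (inj₂ m) (inj₂ m′) t with <-cmp (blk x) (blk u)
    ... | tri< lt _ _ = blk<⇒leq (In-mono m m′ lt)
    ... | tri> _ _ gt = ⊥-elim (¬leq gt t)
    ... | tri≈ _ eq _ =
      let module L = Located (locate m)
          eq′ , l , al , bl = L.others m′ (sym eq)
          h = tp-holds {τ ⊕ ≤-vocabulary} fin q (L.as ++ c̄) (L.bs ++ c̄) L.same
                (related (inj₂ tt) ((L.index ↑ˡ k) ∷ (l ↑ˡ k) ∷ []))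
          vˡ : lookup (L.as ++ c̄) (L.index ↑ˡ k) ∷ lookup (L.as ++ c̄) (l ↑ˡ k) ∷ [] ≡ ι x ∷ ι u ∷ []
          vˡ = cong₂ (λ a b → a ∷ b ∷ []) (trans (lookup-++ˡ L.as c̄ L.index) L.atˡ)
                 (trans (lookup-++ˡ L.as c̄ l) al)
          vʳ : lookup (L.bs ++ c̄) (L.index ↑ˡ k) ∷ lookup (L.bs ++ c̄) (l ↑ˡ k) ∷ [] ≡ ι y ∷ ι v ∷ []
          vʳ = cong₂ (λ a b → a ∷ b ∷ []) (trans (lookup-++ˡ L.bs c̄ L.index) L.atʳ)
                 (trans (lookup-++ˡ L.bs c̄ l) bl)
          px = pred-suc (In-<ˡ m)
          py = pred-suc (In-<ʳ m)
      in subst T (leq-resp px (trans (sym eq) px) py (trans eq′ py)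
           (trans (cong (I (blk x) (inj₂ tt)) (sym vˡ)) (trans h (cong (I (blk y) (inj₂ tt)) vʳ)))) t

    -- A tuple without entries in a block lies in the context and is answered by itself. Otherwise
    -- `local` places every entry in the tuple of one block or among the constants, and the claim is
    -- one atom of that block's type.
    Match-rel : ∀ R (xs ys : Vec (U A) (arity τ R)) → (∀ j → T (S (lookup xs j))) →
                (∀ j → Match ch (lookup xs j) (lookup ys j)) → T (rel A R xs) → T (rel A R ys)
    Match-rel R xs ys inS ms t with Fin.any? (λ j → ¬? (blk (lookup xs j) ≟ 0))
    ... | no none = subst (T ∘ rel A R) (trans (sym (tabulate∘lookup xs))
                      (trans (tabulate-cong same) (tabulate∘lookup ys))) t
      where
      same : ∀ j → lookup xs j ≡ lookup ys j
      same j with ms j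
      ... | inj₁ (_ , e) = e
      ... | inj₂ m = ⊥-elim (none (j , λ z → <-irrefl (sym z) (touched m)))
    ... | yes (j , nz) with ms j
    ...   | inj₁ (z , _) = ⊥-elim (nz z)
    ...   | inj₂ m = subst T (trans (sym (I-rel (blk (lookup xs j)) R xs))
        (trans (cong (I (blk (lookup xs j)) (inj₁ R)) (sym (vec L.as xs (λ i → proj₁ (proj₂ (ix i))))))
        (trans (tp-holds {τ ⊕ ≤-vocabulary} fin q (L.as ++ c̄) (L.bs ++ c̄) L.same (related (inj₁ R) is))
        (trans (cong (I (blk (lookup ys j)) (inj₁ R)) (vec L.bs ys (λ i → proj₂ (proj₂ (ix i)))))
        (I-rel (blk (lookup ys j)) R ys))))) t
      where
      module L = Located (locate m)
      ix : ∀ j′ → Σ[ l ∈ Fin (L.size + k) ] lookup (L.as ++ c̄) l ≡ ι (lookup xs j′)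
                                            × lookup (L.bs ++ c̄) l ≡ ι (lookup ys j′)
      ix j′ with local R xs t inS j (pred-suc (In-<ˡ m)) j′ | ms j′
      ... | inj₁ b | inj₁ (z , _) with () ← trans (sym z) b
      ... | inj₁ b | inj₂ m′ = let _ , l , al , bl = L.others m′ (trans b (sym (pred-suc (In-<ˡ m)))) in
              l ↑ˡ k , trans (lookup-++ˡ L.as c̄ l) al , trans (lookup-++ˡ L.bs c̄ l) bl
      ... | inj₂ (_ , l , cl) | inj₁ (_ , e) =
              L.size ↑ʳ l , trans (lookup-++ʳ L.as c̄ l) cl , trans (lookup-++ʳ L.bs c̄ l) (trans cl (cong ι e))
      ... | inj₂ (z , _) | inj₂ m′ = ⊥-elim (<-irrefl (sym z) (touched m′))
      is = tabulate (proj₁ ∘ ix)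
      vec : ∀ (zs : Vec X L.size) us → (∀ i → lookup (zs ++ c̄) (proj₁ (ix i)) ≡ ι (lookup us i)) →
            map (lookup (zs ++ c̄)) is ≡ map ι us
      vec zs us e = map-ext is λ i → trans (cong (lookup (zs ++ c̄)) (lookup∘tabulate (proj₁ ∘ ix) i))
                      (trans (e i) (sym (lookup-map i ι us)))

  record Position (lo lo′ q : ℕ) {n} (a : Vec (U (side lo)) n) (b : Vec (U (side lo′)) n) : Set where
    constructor position
    field
      bound   : q ≤ Q
      chain   : Chain q lo lo′
      matches : ∀ l → Match chain (proj₁ (lookup a l)) (proj₁ (lookup b l))

  Position-flip : ∀ {lo lo′ q n} {a : Vec _ n} {b} → Position lo lo′ q a b → Position lo′ lo q b a
  Position-flip (position r ch ms) = position r (flipᶜ ch) (Match-flip ∘ ms)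

  Position-equality : ∀ {lo lo′ q n} {a : Vec _ n} {b} → Position lo lo′ q a b → ∀ i j →
                      lookup a i ≡ lookup a j → lookup b i ≡ lookup b j
  Position-equality {lo′ = lo′} (position _ ch ms) i j e = Elem-≡ (beyond lo′)
      (Match-≡ (ms i) (ms j) (cong proj₁ e))

  Position-relation : ∀ {lo lo′ q n} {a : Vec _ n} {b} → Position lo lo′ q a b → ∀ R is →
                      T (rel (side lo) R (map (lookup a) is)) → T (rel (side lo′) R (map (lookup b) is))
  Position-relation (position _ ch ms) (inj₂ tt) (i ∷ j ∷ []) t = Match-≤ (ms i) (ms j) t
  Position-relation {lo} {lo′} {a = a} {b} (position _ ch ms) (inj₁ R) is t =
    Match-rel R (map proj₁ (map (lookup a) is)) (map proj₁ (map (lookup b) is))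
      (λ j → subst (T ∘ S) (sym (at a j)) (proj₁ (remaining⁻ blk S {lo} (proj₂ (lookup a (lookup is j))))))
      (λ j → subst₂ (Match ch) (sym (at a j)) (sym (at b j)) (ms (lookup is j))) t
    where
    at : ∀ {lo} (a : Vec (Elem (beyond lo)) _) j →
         lookup (map proj₁ (map (lookup a) is)) j ≡ proj₁ (lookup a (lookup is j))
    at a j = trans (lookup-map j proj₁ (map (lookup a) is)) (cong proj₁ (lookup-map j (lookup a) is))

  Position-forth : ∀ {lo lo′ q n} {a : Vec _ n} {b} → Position lo lo′ (suc q) a b → ∀ x →
                   ∃[ y ] Position lo lo′ q (x ∷ a) (y ∷ b)
  Position-forth {lo} {lo′} {q} {a = a} {b} (position r ch ms) (x , s) with remaining⁻ blk S {lo} s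
  ... | inS , inj₁ z = (x , remaining⁺ blk S {lo′} inS (inj₁ z)) , position (<⇒≤ r) (down ch)
      (λ { zero → inj₁ (z , refl) ; (suc l) → keep (ms l) })
    where
    keep : ∀ {x y} → Match ch x y → Match (down ch) x y
    keep (inj₁ p) = inj₁ p
    keep (inj₂ m) = inj₂ (In-down m)
  ... | inS , inj₂ lt = (R.reply , remaining⁺ blk S {lo′} R.inS (inj₂ (In-<ʳ R.new))) , position (<⇒≤ r) R.chain
      (λ { zero → inj₂ R.new ; (suc l) → keep (ms l) })
    where
    module R = Reply (play r ch x lt)
    keep : ∀ {x y} → Match ch x y → Match R.chain x y
    keep (inj₁ p) = inj₁ p
    keep (inj₂ m) = inj₂ (R.old m)

  Position-back : ∀ {lo lo′ q n} {a : Vec _ n} {b} → Position lo lo′ (suc q) a b → ∀ y →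
                  ∃[ x ] Position lo lo′ q (x ∷ a) (y ∷ b)
  Position-back p y = let x , p′ = Position-forth (Position-flip p) y in x , Position-flip p′

  Position-equality⇔ : ∀ {lo lo′ q n} {a : Vec _ n} {b} → Position lo lo′ q a b → ∀ i j →
                       (lookup a i ≡ lookup a j) ⇔ (lookup b i ≡ lookup b j)
  Position-equality⇔ p i j = mk⇔ (Position-equality p i j) (Position-equality (Position-flip p) i j)

  Position-relation⇔ : ∀ {lo lo′ q n} {a : Vec _ n} {b} → Position lo lo′ q a b → ∀ R is →
                       T (rel (side lo) R (map (lookup a) is)) ⇔ T (rel (side lo′) R (map (lookup b) is))
  Position-relation⇔ p R is = mk⇔ (Position-relation p R is) (Position-relation (Position-flip p) R is)

  composition : ∀ {lo lo′} → lo ≤ N → lo′ ≤ N → (N ∸ lo) ≈[ Q ] (N ∸ lo′) →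
                (φ : Sentence (τ ⊕ ≤-vocabulary) FO) → qr φ ≤ Q → (side lo ⊨ φ) ⇔ (side lo′ ⊨ φ)
  composition {lo} {lo′} p p′ g φ r = transfer φ r start
    where
    start : Position lo lo′ Q [] []
    -- Initially the blocks lo + 1, ..., N are untouched; the fictitious block `suc N` closes this
    -- last gap.
    start = position ≤-refl (end (gap (cong suc (sym (m+[n∸m]≡n p))) (cong suc (sym (m+[n∸m]≡n p′))) g)) (λ ())
    open BackAndForth (side lo) (side lo′) (Position lo lo′)
      Position-equality⇔ Position-relation⇔ Position-forth Position-back

-- Rooted trees and tree decompositions

module Tree (𝓣 : RootedTree) where
  open RootedTree 𝓣

  _≟ᴺ_ : (s t : Node) → Dec (s ≡ t)
  _≟ᴺ_ = finite-≟ finite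

  Anc : Node → Node → Set
  Anc = Star Edge

  anc-view : ∀ {s t} → Anc s t → s ≡ t ⊎ ∃[ p ] Anc s p × Edge p t
  anc-view ε = inj₁ refl
  anc-view (e ◅ π) with anc-view π
  ... | inj₁ refl        = inj₂ (_ , ε , e)
  ... | inj₂ (p , π′ , e′) = inj₂ (p , e ◅ π′ , e′)

  snoc : ∀ {s p t} → Anc s p → Edge p t → Anc s t
  snoc π e = π ◅◅ (e ◅ ε)

  -- Paths from the root, read from their last edge.
  data Path : Node → Set where
    []  : Path root
    _▻_ : ∀ {p t} → Path p → Edge p t → Path t

  _▻▻_ : ∀ {s t} → Path s → Anc s t → Path t
  π ▻▻ ε       = π
  π ▻▻ (e ◅ σ) = (π ▻ e) ▻▻ σ

  path : ∀ t → Path t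
  path t = [] ▻▻ reachable t

  length : ∀ {t} → Path t → ℕ
  length []      = 0
  length (π ▻ _) = suc (length π)

  -- The last edge of a path is forced, because parents are unique and the root has none. This makes
  -- depth independent of the path and is the source of acyclicity, which is not a field of
  -- `RootedTree`.
  length-unique : ∀ {t} (π σ : Path t) → length π ≡ length σ
  length-unique []      []      = refl
  length-unique []      (σ ▻ e) = ⊥-elim (root-no-parent _ e)
  length-unique (π ▻ e) []      = ⊥-elim (root-no-parent _ e)
  length-unique (π ▻ e) (σ ▻ e′) with refl ← parent-unique e e′ = cong suc (length-unique π σ)

  depth : Node → ℕ
  depth t = length (path t)

  depth-edge : ∀ {p t} → Edge p t → depth t ≡ suc (depth p)
  depth-edge {p} {t} e = length-unique (path t) (path p ▻ e)

  siblings-depth : ∀ {p s t} → Edge p s → Edge p t → depth s ≡ depth t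
  siblings-depth e e′ = trans (depth-edge e) (sym (depth-edge e′))

  anc-depth : ∀ {s t} → Anc s t → s ≡ t ⊎ depth s < depth t
  anc-depth ε = inj₁ refl
  anc-depth {s} (_◅_ {j = u} e π) with anc-depth π
  ... | inj₁ refl = inj₂ (subst (depth s <_) (sym (depth-edge e)) ≤-refl)
  ... | inj₂ lt   = inj₂ (<-trans (subst (depth s <_) (sym (depth-edge e)) ≤-refl) lt)

  anc-strict : ∀ {s t} → Anc s t → s ≢ t → depth s < depth t
  anc-strict π s≢t with anc-depth π
  ... | inj₁ e  = ⊥-elim (s≢t e)
  ... | inj₂ lt = lt

  anc-antisym : ∀ {s t} → Anc s t → Anc t s → s ≡ t
  anc-antisym π σ with anc-depth π | anc-depth σ
  ... | inj₁ e | _      = e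
  ... | _      | inj₁ e = sym e
  ... | inj₂ a | inj₂ b = ⊥-elim (<-asym a b)

  anc-parent : ∀ {s p t} → Anc s t → s ≢ t → Edge p t → Anc s p
  anc-parent π s≢t e with anc-view π
  ... | inj₁ s≡t = ⊥-elim (s≢t s≡t)
  ... | inj₂ (p , π′ , e′) = subst (Anc _) (parent-unique e′ e) π′

  anc-comparable : ∀ {s t u} → Anc s u → Anc t u → Anc s t ⊎ Anc t s
  anc-comparable ε       σ = inj₂ σ
  anc-comparable (_◅_ {j = u} e π) σ with anc-comparable π σ
  ... | inj₁ ut = inj₁ (e ◅ ut)
  ... | inj₂ tu with anc-view tu
  ...   | inj₁ refl = inj₁ (e ◅ ε)
  ...   | inj₂ (p , tp , e′) = inj₂ (subst (Anc _) (parent-unique e′ e) tp)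

  anc-root : ∀ {t} → Anc t root → t ≡ root
  anc-root π with anc-view π
  ... | inj₁ e = e
  ... | inj₂ (_ , _ , e) = ⊥-elim (root-no-parent _ e)

  siblings-≡ : ∀ {p s t} → Edge p s → Edge p t → Anc s t → s ≡ t
  siblings-≡ e e′ π with anc-depth π
  ... | inj₁ eq = eq
  ... | inj₂ lt = ⊥-elim (<-irrefl (siblings-depth e e′) lt)

  siblings-below : ∀ {p s t u} → Edge p s → Edge p t → Anc s u → Anc t u → s ≡ t
  siblings-below e e′ π σ with anc-comparable π σ
  ... | inj₁ st = siblings-≡ e e′ st
  ... | inj₂ ts = sym (siblings-≡ e′ e ts)

  ¬anc-parent : ∀ {p t} → Edge p t → ¬ Anc t p
  ¬anc-parent e π with anc-depth π
  ... | inj₁ refl = <-irrefl (depth-edge e) ≤-refl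
  ... | inj₂ lt = <-asym lt (subst (depth _ <_) (sym (depth-edge e)) ≤-refl)

  anc? : ∀ s t → Dec (Anc s t)
  anc? s t = go (path t)
    where
    go : ∀ {t} → Path t → Dec (Anc s t)
    go [] = map′ (λ { refl → ε }) anc-root (s ≟ᴺ root)
    go (_▻_ {p} {t} π e) with s ≟ᴺ t | go π
    ... | yes refl | _     = yes ε
    ... | no _     | yes σ = yes (snoc σ e)
    ... | no s≢t   | no ¬σ = no (λ σ → ¬σ (anc-parent σ s≢t e))

  root-anc : ∀ t → Anc root t
  root-anc = reachable

  parent? : ∀ t → (∃[ p ] Edge p t) ⊎ t ≡ root
  parent? t with path t
  ... | []    = inj₂ refl
  ... | _ ▻ e = inj₁ (_ , e)

module Tops {τ} {A : Structure τ} (Δ : TreeDecomposition A) where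
  open TreeDecomposition Δ
  open Tree tree

  Top : Node → U A → Set
  Top t v = T (β t v) × (∀ p → Edge p t → ¬ T (β p v))

  Top-exists : ∀ v → ∃[ t ] Top t v
  Top-exists v = let t , b = nonempty v in go (path t) b
    where
    go : ∀ {t} → Path t → T (β t v) → ∃[ t ] Top t v
    go [] b = root , b , λ p e → ⊥-elim (root-no-parent p e)
    go (_▻_ {p} {t} π e) b with T? (β p v)
    ... | yes b′ = go π b′
    ... | no ¬b  = t , b , λ p′ e′ b′ → ¬b (subst (λ p → T (β p v)) (parent-unique e′ e) b′)

  -- Connectedness gives an undirected walk from t to u through bags that contain v. Along it two
  -- facts are preserved: the current node is below t, and v is in all bags in between. A step
  -- upwards from t itself is impossible, as the parent's bag omits v.
  Top-above : ∀ {t v} → Top t v → ∀ u → T (β u v) → Anc t u × (∀ s → Anc t s → Anc s u → T (β s v))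
  Top-above {t} {v} (b , top) u bu = go (connected v t u b bu) ε λ s ts st →
      subst (λ s → T (β s v)) (anc-antisym ts st) b
    where
    Reached : Node → Set
    Reached w = Anc t w × (∀ s → Anc t s → Anc s w → T (β s v))
    go : ∀ {w} → Star _ w u → Anc t w → (∀ s → Anc t s → Anc s w → T (β s v)) → Reached u
    go ε π conv = π , conv
    go (fwd (e , _ , b′) ◅ σ) π conv = go σ (snoc π e) conv′
      where
      conv′ : ∀ s → Anc t s → Anc s _ → T (β s v)
      conv′ s ts sw with anc-view sw
      ... | inj₁ refl = b′
      ... | inj₂ (p , sp , e′) = conv s ts (subst (Anc s) (parent-unique e′ e) sp)
    go {w} (bwd (e , b′ , _) ◅ σ) π conv with t ≟ᴺ w
    ... | yes refl = ⊥-elim (top _ e b′)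
    ... | no t≢w   = go σ (anc-parent π t≢w e) λ s ts sw → conv s ts (snoc sw e)

  Top-unique : ∀ {s t v} → Top s v → Top t v → s ≡ t
  Top-unique a b = anc-antisym (proj₁ (Top-above a _ (proj₁ b))) (proj₁ (Top-above b _ (proj₁ a)))

-- Definable relations on ordered tree extensions

≡⇔ : {X Y : Set} → X ≡ Y → X ⇔ Y
≡⇔ refl = mk⇔ id id

data Sort : Set where
  𝓔 𝓝 𝓧 : Sort

-- 𝓔 ranges over the elements of A, 𝓝 over the nodes of the tree, 𝓧 over both.
record Model (τ : Vocabulary) : Set₁ where
  constructor model
  field
    {base} : Structure τ
    otx    : OrderedTreeExtension base

  open OrderedTreeExtension otx public renaming (structure to B)

  ⟦_⟧ : Sort → Set
  ⟦ 𝓔 ⟧ = U base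
  ⟦ 𝓝 ⟧ = Node
  ⟦ 𝓧 ⟧ = U base ⊎ Node

  inject : ∀ σ → ⟦ σ ⟧ → U B
  inject 𝓔 = inj₁
  inject 𝓝 = inj₂
  inject 𝓧 = id

  inject-injective : ∀ σ {a b} → inject σ a ≡ inject σ b → a ≡ b
  inject-injective 𝓔 = inj₁-injective
  inject-injective 𝓝 = inj₂-injective
  inject-injective 𝓧 = id

  Env : List Sort → Set
  Env []      = ⊤
  Env (σ ∷ Γ) = ⟦ σ ⟧ × Env Γ

  erase : ∀ {Γ} → Env Γ → Vec (U B) (List.length Γ)
  erase {[]}    _       = []
  erase {σ ∷ Γ} (a , ρ) = inject σ a ∷ erase ρ

infix 4 _∋_
data _∋_ : List Sort → Sort → Set where
  vz : ∀ {σ Γ} → σ ∷ Γ ∋ σ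
  vs : ∀ {σ σ′ Γ} → Γ ∋ σ → σ′ ∷ Γ ∋ σ

index : ∀ {Γ σ} → Γ ∋ σ → Fin (List.length Γ)
index vz     = zero
index (vs x) = suc (index x)

module _ {τ : Vocabulary} where
  open Model

  get : ∀ (M : Model τ) {Γ σ} → Env M Γ → Γ ∋ σ → ⟦ M ⟧ σ
  get M (a , ρ) vz     = a
  get M (a , ρ) (vs x) = get M ρ x

  lookup-erase : ∀ (M : Model τ) {Γ σ} (ρ : Env M Γ) (x : Γ ∋ σ) →
                 lookup (erase M ρ) (index x) ≡ inject M σ (get M ρ x)
  lookup-erase M (a , ρ) vz     = refl
  lookup-erase M (a , ρ) (vs x) = lookup-erase M ρ x

  lookups-erase : ∀ (M : Model τ) {Γ σ n} (ρ : Env M Γ) (xs : Vec (Γ ∋ σ) n) →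
                  map (lookup (erase M ρ)) (map index xs) ≡ map (inject M σ ∘ get M ρ) xs
  lookups-erase M ρ []       = refl
  lookups-erase M ρ (x ∷ xs) = cong₂ _∷_ (lookup-erase M ρ x) (lookups-erase M ρ xs)

  gets-extend : ∀ (M : Model τ) {Γ σ n} (ρ : Env M (σ ∷ Γ)) (xs : Vec (Γ ∋ σ) n) →
    proj₁ ρ ∷ map (get M {Γ} {σ} (proj₂ ρ)) xs ≡ map (get M {σ ∷ Γ} {σ} ρ) (vz ∷ map vs xs)
  gets-extend M {Γ} {σ} (a , ρ) xs = cong (a ∷_) (map-∘ (get M {σ ∷ Γ} {σ} (a , ρ)) vs xs)

Relation : Vocabulary → List Sort → ℕ → Set₁
Relation τ Γ k = (M : Model τ) → Model.Env M Γ → Vec (𝒫 (U (Model.B M))) k → Set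

-- A semantic relation together with a formula that defines it uniformly in all ordered tree
-- extensions. Definability proofs can then copy the shape of the relation's own definition.
record Def {τ Γ k} (P : Relation τ Γ k) : Set₁ where
  field
    formula : Formula (τ ⋆) MSO (List.length Γ) k
    correct : ∀ M ρ η → P M ρ η ⇔ Sat (Model.B M) (Model.erase M ρ) η formula

  -- Model checking on a finite structure makes every definable relation decidable; `inD?` and `le?`
  -- are obtained in this way.
  decide : ∀ M ρ η → Dec (P M ρ η)
  decide M ρ η = map′ (from (correct M ρ η)) (to (correct M ρ η))
                      (sat? (Model.B M) (Model.erase M ρ) η formula)

open Def public

module _ {τ Γ k} {P : Relation τ Γ k} where

  infixr 8 ¬ᵈ_
  ¬ᵈ_ : Def P → Def (λ M ρ η → ¬ P M ρ η)
  formula (¬ᵈ p) = ¬ᶠ formula p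
  correct (¬ᵈ p) M ρ η = let e = correct p M ρ η in mk⇔ (_∘ from e) (_∘ to e)

  ⇔ᵈ : {Q : Relation τ Γ k} → (∀ M ρ η → P M ρ η → Q M ρ η) → (∀ M ρ η → Q M ρ η → P M ρ η) → Def P → Def Q
  formula (⇔ᵈ f g p) = formula p
  correct (⇔ᵈ f g p) M ρ η = let e = correct p M ρ η in mk⇔ (to e ∘ g M ρ η) (f M ρ η ∘ from e)

  module _ {Q : Relation τ Γ k} where
    infixr 7 _×ᵈ_
    infixr 6 _⊎ᵈ_
    infixr 5 _→ᵈ_

    _×ᵈ_ : Def P → Def Q → Def (λ M ρ η → P M ρ η × Q M ρ η)
    formula (p ×ᵈ q) = formula p ∧ᶠ formula q
    correct (p ×ᵈ q) M ρ η = let e = correct p M ρ η ; f = correct q M ρ η in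
      mk⇔ (λ (a , b) → to e a , to f b) (λ (a , b) → from e a , from f b)

    _⊎ᵈ_ : Def P → Def Q → Def (λ M ρ η → P M ρ η ⊎ Q M ρ η)
    formula (p ⊎ᵈ q) = formula p ∨ᶠ formula q
    correct (p ⊎ᵈ q) M ρ η = let e = correct p M ρ η ; f = correct q M ρ η in
      mk⇔ (λ { (inj₁ a) → inj₁ (to e a) ; (inj₂ b) → inj₂ (to f b) })
          (λ { (inj₁ a) → inj₁ (from e a) ; (inj₂ b) → inj₂ (from f b) })

    _→ᵈ_ : Def P → Def Q → Def (λ M ρ η → P M ρ η → Q M ρ η)
    formula (p →ᵈ q) = ¬ᶠ formula p ∨ᶠ formula q
    correct (p →ᵈ q) M ρ η = mk⇔ forward
        (λ { (inj₁ n) a → ⊥-elim (n (to e a)) ; (inj₂ b) _ → from f b })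
      where
      e = correct p M ρ η
      f = correct q M ρ η
      forward : (P M ρ η → Q M ρ η) → Sat (Model.B M) (Model.erase M ρ) η (formula (p →ᵈ q))
      forward h with decide p M ρ η
      ... | yes a = inj₂ (to f (h a))
      ... | no ¬a = inj₁ (¬a ∘ from e)

decᵈ : ∀ {τ Γ k} {Q : Set} → Dec Q → Def {τ} {Γ} {k} (λ _ _ _ → Q)
formula (decᵈ (yes _)) = ∀ᶠ (zero ≐ zero)
formula (decᵈ (no  _)) = ¬ᶠ (∀ᶠ (zero ≐ zero))
correct (decᵈ (yes q)) M ρ η = mk⇔ (λ _ _ → refl) (λ _ → q)
correct (decᵈ (no ¬q)) M ρ η = mk⇔ (λ q _ → ¬q q) (λ n → ⊥-elim (n λ _ → refl))

⋀ᵈ : ∀ {τ Γ k n} {P : Fin n → Relation τ Γ k} → (∀ i → Def (P i)) → Def (λ M ρ η → ∀ i → P i M ρ η)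
⋀ᵈ {n = zero}  p = ⇔ᵈ (λ _ _ _ _ ()) (λ _ _ _ _ → tt) (decᵈ (yes tt))
⋀ᵈ {n = suc n} p = ⇔ᵈ (λ { _ _ _ (a , b) zero → a ; _ _ _ (a , b) (suc i) → b i })
                      (λ _ _ _ f → f zero , f ∘ suc) (p zero ×ᵈ ⋀ᵈ (p ∘ suc))

⋁ᵈ : ∀ {τ Γ k n} {P : Fin n → Relation τ Γ k} → (∀ i → Def (P i)) → Def (λ M ρ η → ∃[ i ] P i M ρ η)
⋁ᵈ {n = zero}  p = ⇔ᵈ {P = λ _ _ _ → ⊥} (λ _ _ _ ()) (λ { _ _ _ (() , _) }) (decᵈ (no id))
⋁ᵈ {n = suc n} p = ⇔ᵈ (λ { _ _ _ (inj₁ a) → zero , a ; _ _ _ (inj₂ (i , a)) → suc i , a })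
                      (λ { _ _ _ (zero , a) → inj₁ a ; _ _ _ (suc i , a) → inj₂ (i , a) })
                          (p zero ⊎ᵈ ⋁ᵈ (p ∘ suc))

module _ {τ : Vocabulary} where
  open Model

  guard : ∀ {m k} → Sort → Formula (τ ⋆) MSO (suc m) k
  guard 𝓔 = atom (inj₂ V-S) (zero ∷ [])
  guard 𝓝 = atom (inj₂ V-T) (zero ∷ [])
  guard 𝓧 = zero ≐ zero

  module _ {Γ : List Sort} {k : ℕ} where

    guard⁺ : ∀ (M : Model τ) σ (a : ⟦ M ⟧ σ) ρ (η : Vec _ k) →
             Sat (B M) (inject M σ a ∷ erase M {Γ} ρ) η (guard σ)
    guard⁺ M 𝓔 a ρ η = tt
    guard⁺ M 𝓝 a ρ η = tt
    guard⁺ M 𝓧 a ρ η = refl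

    guard⁻ : ∀ (M : Model τ) σ b ρ (η : Vec _ k) → Sat (B M) (b ∷ erase M {Γ} ρ) η (guard σ) →
             Σ[ a ∈ ⟦ M ⟧ σ ] b ≡ inject M σ a
    guard⁻ M 𝓔 (inj₁ a) ρ η _ = a , refl
    guard⁻ M 𝓝 (inj₂ a) ρ η _ = a , refl
    guard⁻ M 𝓧 a        ρ η _ = a , refl

    module _ {σ : Sort} {P : Relation τ (σ ∷ Γ) k} where

      ∃ᵈ : Def {τ} {σ ∷ Γ} {k} P → Def {τ} {Γ} {k} (λ M ρ η → Σ[ a ∈ ⟦ M ⟧ σ ] P M (a , ρ) η)
      formula (∃ᵈ p) = ∃ᶠ (guard σ ∧ᶠ formula p)
      correct (∃ᵈ p) M ρ η = mk⇔
        (λ (a , b) → inject M σ a , guard⁺ M σ a ρ η , to (correct p M (a , ρ) η) b)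
        backward
        where
        backward : _ → _
        backward (b , g , c) with guard⁻ M σ b ρ η g
        ... | a , refl = a , from (correct p M (a , ρ) η) c

      ∀ᵈ : Def {τ} {σ ∷ Γ} {k} P → Def {τ} {Γ} {k} (λ M ρ η → ∀ (a : ⟦ M ⟧ σ) → P M (a , ρ) η)
      formula (∀ᵈ p) = ∀ᶠ (¬ᶠ guard σ ∨ᶠ formula p)
      correct (∀ᵈ p) M ρ η = mk⇔ forward backward
        where
        forward : (∀ a → P M (a , ρ) η) → ∀ b → Sat (B M) (b ∷ erase M ρ) η (¬ᶠ guard σ ∨ᶠ formula p)
        forward f b with sat? (B M) (b ∷ erase M ρ) η (guard σ)
        ... | no ¬g = inj₁ ¬g
        ... | yes g with guard⁻ M σ b ρ η g
        ...   | a , refl = inj₂ (to (correct p M (a , ρ) η) (f a))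
        backward : (∀ b → Sat (B M) (b ∷ erase M ρ) η (¬ᶠ guard σ ∨ᶠ formula p)) → ∀ a → P M (a , ρ) η
        backward f a with f (inject M σ a)
        ... | inj₁ ¬g = ⊥-elim (¬g (guard⁺ M σ a ρ η))
        ... | inj₂ c  = from (correct p M (a , ρ) η) c

    atomᵈ : ∀ (R : Symbol τ) (xs : Vec (Γ ∋ 𝓧) (arity τ R)) →
            Def {τ} {Γ} {k} (λ M ρ η → T (rel (B M) (inj₁ R) (map (get M ρ) xs)))
    formula (atomᵈ R xs) = atom (inj₁ R) (map index xs)
    correct (atomᵈ R xs) M ρ η = ≡⇔ (cong (T ∘ rel (B M) (inj₁ R)) (sym (lookups-erase M ρ xs)))

    edgeᵈ : (x y : Γ ∋ 𝓝) → Def {τ} {Γ} {k} (λ M ρ η → Edge M (get M ρ x) (get M ρ y))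
    formula (edgeᵈ x y) = atom (inj₂ E-T) (index x ∷ index y ∷ [])
    correct (edgeᵈ x y) M ρ η = ≡⇔ (cong₂ (λ a b → T (rel (B M) (inj₂ E-T) (a ∷ b ∷ [])))
      (sym (lookup-erase M ρ x)) (sym (lookup-erase M ρ y)))

    bagᵈ : (x : Γ ∋ 𝓝) (y : Γ ∋ 𝓔) → Def {τ} {Γ} {k} (λ M ρ η → T (β M (get M ρ x) (get M ρ y)))
    formula (bagᵈ x y) = atom (inj₂ R-β) (index x ∷ index y ∷ [])
    correct (bagᵈ x y) M ρ η = ≡⇔ (cong₂ (λ a b → T (rel (B M) (inj₂ R-β) (a ∷ b ∷ [])))
      (sym (lookup-erase M ρ x)) (sym (lookup-erase M ρ y)))

    bag≤ᵈ : (t : Γ ∋ 𝓝) (x y : Γ ∋ 𝓔) → Def {τ} {Γ} {k} (λ M ρ η →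
      T (extendRel (β M (get M ρ t)) (leq (order M (get M ρ t))) (get M ρ x) (get M ρ y)))
    formula (bag≤ᵈ t x y) = atom (inj₂ R-≼) (index t ∷ index x ∷ index y ∷ [])
    correct (bag≤ᵈ t x y) M ρ η = ≡⇔ (trans
      (cong₂ (λ a b → T (rel (B M) (inj₂ R-≼) (inj₂ (get M ρ t) ∷ a ∷ b ∷ [])))
        (sym (lookup-erase M ρ x)) (sym (lookup-erase M ρ y)))
      (cong (λ a → T (rel (B M) (inj₂ R-≼) (a ∷ lookup (erase M ρ) (index x) ∷ lookup (erase M ρ) (index y) ∷
          [])))
        (sym (lookup-erase M ρ t))))

    ≡ᵈ : ∀ {σ} (x y : Γ ∋ σ) → Def {τ} {Γ} {k} (λ M ρ η → get M ρ x ≡ get M ρ y)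
    formula (≡ᵈ x y) = index x ≐ index y
    correct (≡ᵈ {σ} x y) M ρ η = mk⇔
      (λ e → trans (lookup-erase M ρ x) (trans (cong (inject M σ) e) (sym (lookup-erase M ρ y))))
      (λ e → inject-injective M σ (trans (sym (lookup-erase M ρ x)) (trans e (lookup-erase M ρ y))))

    element≡ᵈ : (x : Γ ∋ 𝓧) (y : Γ ∋ 𝓔) → Def {τ} {Γ} {k} (λ M ρ η → get M ρ x ≡ inj₁ (get M ρ y))
    formula (element≡ᵈ x y) = index x ≐ index y
    correct (element≡ᵈ x y) M ρ η = mk⇔
      (λ e → trans (lookup-erase M ρ x) (trans e (sym (lookup-erase M ρ y))))
      (λ e → trans (sym (lookup-erase M ρ x)) (trans e (lookup-erase M ρ y)))

    colourᵈ : (c : Fin k) (x : Γ ∋ 𝓝) → Def {τ} {Γ} {k} (λ M ρ η → T (lookup η c (inj₂ (get M ρ x))))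
    formula (colourᵈ c x) = index x ∈ˢ c
    correct (colourᵈ c x) M ρ η = ≡⇔ (cong (T ∘ lookup η c) (sym (lookup-erase M ρ x)))

    -- t is a descendant of s if it belongs to every set that contains s and is closed under edges.
    ancᵈ : (x y : Γ ∋ 𝓝) → Def {τ} {Γ} {k} (λ M ρ η → Star (Edge M) (get M ρ x) (get M ρ y))
    formula (ancᵈ x y) = ∀ˢ (¬ᶠ (index x ∈ˢ zero) ∨ᶠ
      ∃ᶠ ∃ᶠ (atom (inj₂ E-T) (suc zero ∷ zero ∷ []) ∧ᶠ suc zero ∈ˢ zero ∧ᶠ ¬ᶠ (zero ∈ˢ zero)) ∨ᶠ
      index y ∈ˢ zero)
    correct (ancᵈ x y) M ρ η = mk⇔ forward backward
      where
      open Tree (tree M)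
      x₀ = get M ρ x
      y₀ = get M ρ y
      Closed : 𝒫 (U (B M)) → Set
      Closed S = Sat (B M) (erase M ρ) (S ∷ η) (¬ᶠ (index x ∈ˢ zero) ∨ᶠ
        ∃ᶠ ∃ᶠ (atom (inj₂ E-T) (suc zero ∷ zero ∷ []) ∧ᶠ suc zero ∈ˢ zero ∧ᶠ ¬ᶠ (zero ∈ˢ zero)) ∨ᶠ
        index y ∈ˢ zero)
      forward : Anc x₀ y₀ → ∀ S → Closed S
      forward π S with T? (S (inj₂ x₀))
      ... | no n = inj₁ λ t → n (subst (T ∘ S) (lookup-erase M ρ x) t)
      ... | yes m with walk π m
        where
        walk : ∀ {s t} → Anc s t → T (S (inj₂ s)) →
               T (S (inj₂ t)) ⊎ (∃[ p ] ∃[ q ] Edge M p q × T (S (inj₂ p)) × ¬ T (S (inj₂ q)))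
        walk ε m = inj₁ m
        walk (_◅_ {j = u} e π) m with T? (S (inj₂ u))
        ... | yes m′ = walk π m′
        ... | no n   = inj₂ (_ , u , e , m , n)
      ...   | inj₁ m′ = inj₂ (inj₂ (subst (T ∘ S) (sym (lookup-erase M ρ y)) m′))
      ...   | inj₂ (p , q , e , mp , nq) = inj₂ (inj₁ (inj₂ p , inj₂ q , e , mp , nq))
      descendants : 𝒫 (U (B M))
      descendants (inj₁ _) = false
      descendants (inj₂ t) = ⌊ anc? x₀ t ⌋
      backward : (∀ S → Closed S) → Anc x₀ y₀
      backward f with f descendants
      ... | inj₁ n = ⊥-elim (n (subst (λ a → T (descendants a)) (sym (lookup-erase M ρ x))
          (fromWitness {a? = anc? x₀ x₀} ε)))
      ... | inj₂ (inj₁ (inj₂ p , inj₂ q , e , mp , nq)) =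
        ⊥-elim (nq (fromWitness {a? = anc? x₀ q} (snoc (toWitness {a? = anc? x₀ p} mp) e)))
      ... | inj₂ (inj₂ m) = toWitness {a? = anc? x₀ y₀} (subst (λ a → T (descendants a)) (lookup-erase M ρ y) m)

-- Pruned cones and their depth-first order

extendRel⁺ : ∀ {X} (S : 𝒫 X) r {x y} (p : T (S x)) (q : T (S y)) → T (r (x , p) (y , q)) → T (extendRel S r x y)
extendRel⁺ S r {x} {y} p q t with T? (S x) | T? (S y)
... | yes p′ | yes q′ = subst₂ (λ p q → T (r (x , p) (y , q))) (T-irrelevant p p′) (T-irrelevant q q′) t
... | yes _  | no ¬q  = ⊥-elim (¬q q)
... | no ¬p  | _      = ⊥-elim (¬p p)

extendRel⁻ : ∀ {X} (S : 𝒫 X) r {x y} → T (extendRel S r x y) →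
             Σ[ p ∈ T (S x) ] Σ[ q ∈ T (S y) ] T (r (x , p) (y , q))
extendRel⁻ S r {x} {y} t with T? (S x) | T? (S y)
... | yes p | yes q = p , q , t

least : ∀ {X : Set} {R : X → X → Set} (Q : X → Set) → (∀ x → Dec (Q x)) →
        (∀ {x y} → Q x → Q y → R x y ⊎ R y x) → (∀ {x y w} → R x y → R y w → R x w) →
        ∀ (xs : List X) {x} → x ∈ˡ xs → Q x → ∃[ m ] Q m × (∀ {y} → y ∈ˡ xs → Q y → R m y)
least {X} {R} Q Q? total trans xs {x} x∈ qx with go xs
  where
  go : ∀ xs → (∀ {y} → y ∈ˡ xs → ¬ Q y) ⊎ (∃[ m ] Q m × (∀ {y} → y ∈ˡ xs → Q y → R m y))
  go [] = inj₁ λ ()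
  go (x ∷ xs) with Q? x | go xs
  ... | no ¬q | inj₁ none = inj₁ λ { (here refl) → ¬q ; (there y) → none y }
  ... | no ¬q | inj₂ (m , q , min) = inj₂ (m , q , λ { (here refl) q → ⊥-elim (¬q q) ; (there y) → min y })
  ... | yes q | inj₁ none = inj₂ (x , q , λ { (here refl) q′ → reduce (total q q′) ; (there y) q′ →
      ⊥-elim (none y q′) })
  ... | yes q | inj₂ (m , qm , min) with total q qm
  ...   | inj₁ r = inj₂ (x , q , λ { (here refl) q′ → reduce (total q q′) ; (there y) q′ → trans r (min y q′) })
  ...   | inj₂ r = inj₂ (m , qm , λ { (here refl) _ → r ; (there y) → min y })
... | inj₁ none = ⊥-elim (none x∈ qx)
... | inj₂ found = found

infix 3 _↔ᵖ_
_↔ᵖ_ : Set → Set → Set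
P ↔ᵖ Q = (P → Q) × (Q → P)

module Pruning {τ} (M : Model τ) {K : ℕ} (η : Vec (𝒫 (U (Model.B M))) K) where
  open Model M
  open Tree tree public
  open Tops decomposition public

  Colour : Fin K → Node → Set
  Colour c t = T (lookup η c (inj₂ t))

  Retained : Node → Set
  Retained t = ∃[ c ] Colour c t

  -- d itself is exempt from being retained: a node that is about to be deleted must still have a
  -- pruned cone, whose type is compared with those of its siblings.
  Live : Node → Node → Set
  Live d t = Anc d t × (∀ u → Anc d u → d ≢ u → Anc u t → Retained u)

  -- The elements introduced in the pruned cone of d.
  InD : Node → U base → Set
  InD d v = ∃[ t ] Top t v × Live d t

  SameAdhesion : (p s t : Node) → Set
  SameAdhesion p s t = ∀ x → T (β p x) → T (β s x) ↔ᵖ T (β t x)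

  Bag≤ Bag< : Node → U base → U base → Set
  Bag≤ p x y = T (extendRel (β p) (leq (order p)) x y)
  Bag< p x y = Bag≤ p x y × x ≢ y

  -- The lexicographic order on the adhesion sets with p, read as 0-1 sequences along the order of
  -- the bag of p: at the first difference, s has 0 and t has 1.
  AdhesionLess : (p s t : Node) → Set
  AdhesionLess p s t = ∃[ x ] T (β p x) × T (β t x) × ¬ T (β s x) ×
    (∀ y → Bag< p y x → T (β s y) ↔ᵖ T (β t y))

  Before : (p s t : Node) → Set
  Before p s t = AdhesionLess p s t ⊎
    (SameAdhesion p s t × (∃[ c ] ∃[ c′ ] c Fin.< c′ × Colour c s × Colour c′ t))

  -- Depth-first order below d.
  Precedes : (d s t : Node) → Set
  Precedes d s t = (Anc s t × s ≢ t) ⊎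
    (∃[ p ] ∃[ s′ ] ∃[ t′ ] Anc d p × Edge p s′ × Edge p t′ × Before p s′ t′ × Anc s′ s × Anc t′ t)

  Le : Node → U base → U base → Set
  Le d x y = ∃[ s ] ∃[ t ] Top s x × Top t y × ((s ≡ t × Bag≤ s x y) ⊎ Precedes d s t)

  -- Colours are disjoint, and siblings with one adhesion set never share a colour. This is what
  -- makes `Before` a strict linear order on the retained children of a node.
  Proper : Set
  Proper = (∀ t c c′ → c Fin.< c′ → Colour c t → ¬ Colour c′ t) ×
    (∀ p u t c → Edge p u → Edge p t → SameAdhesion p u t → Colour c u → Colour c t → u ≡ t)

  module _ {p : Node} where
    private module O = IsTotalOrder (LinearOrder.isTotalOrder (order p))

    Bag≤-refl : ∀ {x} → T (β p x) → Bag≤ p x x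
    Bag≤-refl b = extendRel⁺ (β p) _ b b O.refl

    Bag≤-trans : ∀ {x y w} → Bag≤ p x y → Bag≤ p y w → Bag≤ p x w
    Bag≤-trans {x} {y} {w} a b with extendRel⁻ (β p) (leq (order p)) a | extendRel⁻ (β p) (leq (order p)) b
    ... | px , py , t | py′ , pw , t′ = extendRel⁺ (β p) _ px pw
      (O.trans t (subst (λ q → T (leq (order p) (y , q) (w , pw))) (T-irrelevant py′ py) t′))

    Bag≤-antisym : ∀ {x y} → Bag≤ p x y → Bag≤ p y x → x ≡ y
    Bag≤-antisym {x} {y} a b with extendRel⁻ (β p) (leq (order p)) a | extendRel⁻ (β p) (leq (order p)) b
    ... | px , py , t | py′ , px′ , t′ = cong proj₁ (O.antisym t
      (subst₂ (λ q q′ → T (leq (order p) (y , q) (x , q′))) (T-irrelevant py′ py) (T-irrelevant px′ px) t′))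

    Bag≤-total : ∀ {x y} → T (β p x) → T (β p y) → Bag≤ p x y ⊎ Bag≤ p y x
    Bag≤-total {x} {y} px py with O.total (x , px) (y , py)
    ... | inj₁ t = inj₁ (extendRel⁺ (β p) _ px py t)
    ... | inj₂ t = inj₂ (extendRel⁺ (β p) _ py px t)

    Bag≤-left : ∀ {x y} → Bag≤ p x y → T (β p x)
    Bag≤-left a = proj₁ (extendRel⁻ (β p) (leq (order p)) a)

    Bag<-trans : ∀ {x y w} → Bag< p x y → Bag< p y w → Bag< p x w
    Bag<-trans (a , n) (b , _) = Bag≤-trans a b , λ { refl → n (Bag≤-antisym a b) }

    -- The first difference between s and u is the earlier of the two given ones. They cannot
    -- coincide, since t would both contain and omit the element.
    AdhesionLess-trans : ∀ {s t u} → AdhesionLess p s t → AdhesionLess p t u → AdhesionLess p s u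
    AdhesionLess-trans (x , px , tx , ¬sx , low) (y , py , uy , ¬ty , low′)
      with finite-≟ (Structure.finite base) x y | Bag≤-total px py
    ... | yes refl | _ = ⊥-elim (¬ty tx)
    ... | no n | inj₁ xy = x , px , proj₁ (low′ x (xy , n)) tx , ¬sx , λ w w<x →
        let f , g = low w w<x ; f′ , g′ = low′ w (Bag<-trans w<x (xy , n)) in f′ ∘ f , g ∘ g′
    ... | no n | inj₂ yx = y , py , uy , (λ sy → ¬ty (proj₁ (low y (yx , n ∘ sym)) sy)) , λ w w<y →
        let f , g = low w (Bag<-trans w<y (yx , n ∘ sym)) ; f′ , g′ = low′ w w<y in f′ ∘ f , g ∘ g′

    SameAdhesion-sym : ∀ {s t} → SameAdhesion p s t → SameAdhesion p t s
    SameAdhesion-sym e x b = let f , g = e x b in g , f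

    SameAdhesion-trans : ∀ {s t u} → SameAdhesion p s t → SameAdhesion p t u → SameAdhesion p s u
    SameAdhesion-trans e e′ x b = let f , g = e x b ; f′ , g′ = e′ x b in f′ ∘ f , g ∘ g′

    AdhesionLess-total : ∀ {s t} → ¬ SameAdhesion p s t → AdhesionLess p s t ⊎ AdhesionLess p t s
    AdhesionLess-total {s} {t} n with least {R = Bag≤ p} Differ differ?
        (λ (a , _) (b , _) → Bag≤-total a b) Bag≤-trans (elements fin) (∈-elements fin (proj₁ difference))
            (proj₂ difference)
      where
      fin = Structure.finite base
      Differ : U base → Set
      Differ x = T (β p x) × β s x ≢ β t x
      differ? : ∀ x → Dec (Differ x)
      differ? x = T? (β p x) ×-dec ¬? (β s x ≟ᴮ β t x)
      difference : ∃ Differ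
      difference with finite-∃? fin differ?
      ... | yes d = d
      ... | no none = ⊥-elim (n λ x b → let e = decidable-stable (β s x ≟ᴮ β t x) (λ ne → none (x , b , ne))
                                     in subst T e , subst T (sym e))
    ... | x , (b , ne) , min with β s x in es | β t x in et
    ...   | true  | true  = ⊥-elim (ne refl)
    ...   | false | false = ⊥-elim (ne refl)
    ...   | false | true  = inj₁ (x , b , subst T (sym et) tt , subst T es , λ y (le , y≢x) → agree y le y≢x)
      where
      agree : ∀ y → Bag≤ p y x → y ≢ x → T (β s y) ↔ᵖ T (β t y)
      agree y le y≢x =
        let e = decidable-stable (β s y ≟ᴮ β t y)
                  (λ ne → y≢x (Bag≤-antisym le (min (∈-elements (Structure.finite base) y)
                      (Bag≤-left le , ne))))
        in subst T e , subst T (sym e)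
    ...   | true  | false = inj₂ (x , b , subst T (sym es) tt , subst T et , λ y (le , y≢x) → agree y le y≢x)
      where
      agree : ∀ y → Bag≤ p y x → y ≢ x → T (β t y) ↔ᵖ T (β s y)
      agree y le y≢x =
        let e = decidable-stable (β s y ≟ᴮ β t y)
                  (λ ne → y≢x (Bag≤-antisym le (min (∈-elements (Structure.finite base) y)
                      (Bag≤-left le , ne))))
        in subst T (sym e) , subst T e

    sameAdhesion? : ∀ s t → Dec (SameAdhesion p s t)
    sameAdhesion? s t = ∃?⇒∀? P? (finite-∃? (Structure.finite base) (λ x → ¬? (P? x)))
      where
      P? : ∀ x → Dec (T (β p x) → T (β s x) ↔ᵖ T (β t x))
      P? x with T? (β p x) | β s x ≟ᴮ β t x
      ... | no n  | _     = yes λ b → ⊥-elim (n b)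
      ... | yes b | yes e = yes λ _ → subst T e , subst T (sym e)
      ... | yes b | no ne = no λ f → let g , h = f b in ne (T-ext g h)

  module Ordered (proper : Proper) where

    colour-unique : ∀ {t c c′} → Colour c t → Colour c′ t → c ≡ c′
    colour-unique {t} {c} {c′} a b with Fin.<-cmp c c′
    ... | tri< lt _ _ = ⊥-elim (proj₁ proper t c c′ lt a b)
    ... | tri≈ _ e _  = e
    ... | tri> _ _ gt = ⊥-elim (proj₁ proper t c′ c gt b a)

    Before-irrefl : ∀ {p t} → ¬ Before p t t
    Before-irrefl (inj₁ (_ , _ , b , ¬b , _)) = ¬b b
    Before-irrefl (inj₂ (_ , c , c′ , lt , a , b)) = proj₁ proper _ c c′ lt a b

    Before-trans : ∀ {p s t u} → Before p s t → Before p t u → Before p s u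
    Before-trans (inj₁ a) (inj₁ b) = inj₁ (AdhesionLess-trans a b)
    Before-trans (inj₁ (x , px , tx , ¬sx , low)) (inj₂ (same , _)) =
      inj₁ (x , px , proj₁ (same x px) tx , ¬sx , λ y y<x →
        let f , g = low y y<x ; f′ , g′ = same y (Bag≤-left (proj₁ y<x)) in f′ ∘ f , g ∘ g′)
    Before-trans (inj₂ (same , _)) (inj₁ (x , px , ux , ¬tx , low)) =
      inj₁ (x , px , ux , ¬tx ∘ proj₁ (same x px) , λ y y<x →
        let f , g = same y (Bag≤-left (proj₁ y<x)) ; f′ , g′ = low y y<x in f′ ∘ f , g ∘ g′)
    Before-trans (inj₂ (same , c , c′ , lt , a , b)) (inj₂ (same′ , d , d′ , lt′ , a′ , b′)) with refl ←
        colour-unique b a′ =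
      inj₂ (SameAdhesion-trans same same′ , c , d′ , Fin.<-trans lt lt′ , a , b′)

    Before-total : ∀ {p s t} → Edge p s → Edge p t → Retained s → Retained t → s ≢ t → Before p s t ⊎
        Before p t s
    Before-total {p} {s} {t} e e′ (c , a) (c′ , b) s≢t with sameAdhesion? s t
    ... | no n with AdhesionLess-total n
    ...   | inj₁ l = inj₁ (inj₁ l)
    ...   | inj₂ l = inj₂ (inj₁ l)
    Before-total {p} {s} {t} e e′ (c , a) (c′ , b) s≢t | yes same with Fin.<-cmp c c′
    ...   | tri< lt _ _ = inj₁ (inj₂ (same , c , c′ , lt , a , b))
    ...   | tri≈ _ refl _ = ⊥-elim (s≢t (proj₂ proper p s t c e e′ same a b))
    ...   | tri> _ _ gt = inj₂ (inj₂ (SameAdhesion-sym same , c′ , c , gt , b , a))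

    Precedes-irrefl : ∀ {d t} → ¬ Precedes d t t
    Precedes-irrefl (inj₁ (_ , n)) = n refl
    Precedes-irrefl (inj₂ (p , s′ , t′ , _ , e , e′ , b , π , σ)) with refl ← siblings-below e e′ π σ =
        Before-irrefl b

    -- With two branchings, `t′` and `r′` are both ancestors of the middle node t and hence
    -- comparable. The branching nearer to the root decides; if they are the same node,
    -- `Before-trans` does.
    Precedes-trans : ∀ {d s t u} → Precedes d s t → Precedes d t u → Precedes d s u
    Precedes-trans {d} (inj₁ (π , n)) (inj₁ (σ , _)) = inj₁ (π ◅◅ σ , λ { refl → n (anc-antisym π σ) })
    Precedes-trans {d} {s} {t} {u} (inj₁ (π , n)) (inj₂ (p , t′ , u′ , dp , e , e′ , b , π′ , σ))
        with anc-comparable π π′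
    ... | inj₂ t′s = inj₂ (p , t′ , u′ , dp , e , e′ , b , t′s , σ)
    ... | inj₁ st′ with s ≟ᴺ t′
    ...   | yes refl = inj₂ (p , t′ , u′ , dp , e , e′ , b , ε , σ)
    ...   | no s≢t′ = inj₁ ((anc-parent st′ s≢t′ e ◅◅ e′ ◅ σ) , λ { refl →
            ¬anc-parent e′ (σ ◅◅ anc-parent st′ s≢t′ e) })
    Precedes-trans (inj₂ (p , s′ , t′ , dp , e , e′ , b , π , σ)) (inj₁ (σ′ , _)) =
      inj₂ (p , s′ , t′ , dp , e , e′ , b , π , σ ◅◅ σ′)
    Precedes-trans (inj₂ (p , s′ , t′ , dp , e , e′ , b , π , σ))
                   (inj₂ (q , r′ , u′ , dq , f , f′ , b′ , π′ , σ′)) with t′ ≟ᴺ r′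
    ... | yes refl with refl ← parent-unique e′ f = inj₂ (p , s′ , u′ , dp , e , f′ , Before-trans b b′ , π ,
        σ′)
    ... | no t′≢r′ with anc-comparable σ π′
    ...   | inj₁ t′r′ = inj₂ (p , s′ , t′ , dp , e , e′ , b , π , (anc-parent t′r′ t′≢r′ f ◅◅ f′ ◅ σ′))
    ...   | inj₂ r′t′ = inj₂ (q , r′ , u′ , dq , f , f′ , b′ , (anc-parent r′t′ (t′≢r′ ∘ sym) e′ ◅◅ e ◅ π) , σ′)

    -- Follow the two paths down from d until they part. The children at which they part are
    -- strictly below d, so liveness makes them retained and `Before` compares them.
    Precedes-total : ∀ {d s t} → Live d s → Live d t → s ≢ t → Precedes d s t ⊎ Precedes d t s
    Precedes-total {d} {s} {t} (π , r) (σ , r′) s≢t = go ε π σ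
      where
      go : ∀ {u} → Anc d u → Anc u s → Anc u t → Precedes d s t ⊎ Precedes d t s
      go du ε σ = inj₁ (inj₁ (σ , s≢t))
      go du π ε = inj₂ (inj₁ (π , s≢t ∘ sym))
      go du (_◅_ {j = s′} e π) (_◅_ {j = t′} e′ σ) with s′ ≟ᴺ t′
      ... | yes refl = go (snoc du e) π σ
      ... | no s′≢t′ with Before-total e e′ (r s′ (snoc du e) (λ { refl → ¬anc-parent e du }) π)
                            (r′ t′ (snoc du e′) (λ { refl → ¬anc-parent e′ du }) σ) s′≢t′
      ...   | inj₁ b = inj₁ (inj₂ (_ , s′ , t′ , du , e , e′ , b , π , σ))
      ...   | inj₂ b = inj₂ (inj₂ (_ , t′ , s′ , du , e′ , e , b , σ , π))

    Le-refl : ∀ {d x} → Le d x x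
    Le-refl {d} {x} = let t , top = Top-exists x in t , t , top , top , inj₁ (refl , Bag≤-refl (proj₁ top))

    Le-trans : ∀ {d x y w} → Le d x y → Le d y w → Le d x w
    Le-trans (s , t , a , b , r) (t′ , u , b′ , c , r′) with refl ← Top-unique b b′ = s , u , a , c , join r r′
      where
      join : _ → _ → _
      join (inj₁ (refl , l)) (inj₁ (refl , l′)) = inj₁ (refl , Bag≤-trans l l′)
      join (inj₁ (refl , _)) (inj₂ q) = inj₂ q
      join (inj₂ q) (inj₁ (refl , _)) = inj₂ q
      join (inj₂ q) (inj₂ q′) = inj₂ (Precedes-trans q q′)

    Le-antisym : ∀ {d x y} → Le d x y → Le d y x → x ≡ y
    Le-antisym {d} (s , t , a , b , r) (t′ , s′ , b′ , a′ , r′) with refl ← Top-unique b b′ | refl ←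
        Top-unique a a′ = join r r′
      where
      join : (s ≡ t × Bag≤ s _ _) ⊎ Precedes d s t → (t ≡ s × Bag≤ t _ _) ⊎ Precedes d t s → _
      join (inj₁ (refl , l)) (inj₁ (_ , l′)) = Bag≤-antisym l l′
      join (inj₁ (refl , _)) (inj₂ q) = ⊥-elim (Precedes-irrefl q)
      join (inj₂ q) (inj₁ (refl , _)) = ⊥-elim (Precedes-irrefl q)
      join (inj₂ q) (inj₂ q′) = ⊥-elim (Precedes-irrefl (Precedes-trans q q′))

    Le-total : ∀ {d x y} → InD d x → InD d y → Le d x y ⊎ Le d y x
    Le-total (s , a , l) (t , b , l′) with s ≟ᴺ t
    ... | yes refl with Bag≤-total (proj₁ a) (proj₁ b)
    ...   | inj₁ le = inj₁ (s , t , a , b , inj₁ (refl , le))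
    ...   | inj₂ le = inj₂ (s , t , b , a , inj₁ (refl , le))
    Le-total (s , a , l) (t , b , l′) | no s≢t with Precedes-total l l′ s≢t
    ...   | inj₁ q = inj₁ (s , t , a , b , inj₂ q)
    ...   | inj₂ q = inj₂ (t , s , b , a , inj₂ q)

-- Definability of cones and their types

module _ {τ : Vocabulary} {K : ℕ} where
  open Pruning

  module _ {Γ : List Sort} where

    private
      D : (∀ (M : Model τ) → Model.Env M Γ → Vec (𝒫 (U (Model.B M))) K → Set) → Set₁
      D = Def {τ} {Γ} {K}

    retainedᵈ : (t : Γ ∋ 𝓝) → D (λ M ρ η → Retained M η (get M ρ t))
    retainedᵈ t = ⋁ᵈ λ c → colourᵈ c t

    _↔ᵈ_ : ∀ {P Q : Relation τ Γ K} → Def P → Def Q → D (λ M ρ η → P M ρ η ↔ᵖ Q M ρ η)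
    p ↔ᵈ q = (p →ᵈ q) ×ᵈ (q →ᵈ p)

  module _ {Γ : List Sort} where

    private
      D : (∀ (M : Model τ) → Model.Env M Γ → Vec (𝒫 (U (Model.B M))) K → Set) → Set₁
      D = Def {τ} {Γ} {K}

    liveᵈ : (d t : Γ ∋ 𝓝) → D (λ M ρ η → Live M η (get M ρ d) (get M ρ t))
    liveᵈ d t = ancᵈ d t ×ᵈ ∀ᵈ (ancᵈ (vs d) vz →ᵈ ¬ᵈ (≡ᵈ (vs d) vz) →ᵈ ancᵈ vz (vs t) →ᵈ retainedᵈ vz)

    topᵈ : (t : Γ ∋ 𝓝) (v : Γ ∋ 𝓔) → D (λ M ρ η → Top M η (get M ρ t) (get M ρ v))
    topᵈ t v = bagᵈ t v ×ᵈ ∀ᵈ (edgeᵈ vz (vs t) →ᵈ ¬ᵈ (bagᵈ vz (vs v)))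

    sameAdhesionᵈ : (p s t : Γ ∋ 𝓝) → D (λ M ρ η → SameAdhesion M η (get M ρ p) (get M ρ s) (get M ρ t))
    sameAdhesionᵈ p s t = ∀ᵈ (bagᵈ (vs p) vz →ᵈ (bagᵈ (vs s) vz ↔ᵈ bagᵈ (vs t) vz))

    bag<ᵈ : (p : Γ ∋ 𝓝) (x y : Γ ∋ 𝓔) → D (λ M ρ η → Bag< M η (get M ρ p) (get M ρ x) (get M ρ y))
    bag<ᵈ p x y = bag≤ᵈ p x y ×ᵈ ¬ᵈ (≡ᵈ x y)

  module _ {Γ : List Sort} where

    private
      D : (∀ (M : Model τ) → Model.Env M Γ → Vec (𝒫 (U (Model.B M))) K → Set) → Set₁
      D = Def {τ} {Γ} {K}

    inDᵈ : (d : Γ ∋ 𝓝) (v : Γ ∋ 𝓔) → D (λ M ρ η → InD M η (get M ρ d) (get M ρ v))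
    inDᵈ d v = ∃ᵈ (topᵈ vz (vs v) ×ᵈ liveᵈ (vs d) vz)

    adhesionLessᵈ : (p s t : Γ ∋ 𝓝) → D (λ M ρ η → AdhesionLess M η (get M ρ p) (get M ρ s) (get M ρ t))
    adhesionLessᵈ p s t = ∃ᵈ (bagᵈ (vs p) vz ×ᵈ bagᵈ (vs t) vz ×ᵈ ¬ᵈ (bagᵈ (vs s) vz) ×ᵈ
      ∀ᵈ (bag<ᵈ (vs (vs p)) vz (vs vz) →ᵈ (bagᵈ (vs (vs s)) vz ↔ᵈ bagᵈ (vs (vs t)) vz)))

    beforeᵈ : (p s t : Γ ∋ 𝓝) → D (λ M ρ η → Before M η (get M ρ p) (get M ρ s) (get M ρ t))
    beforeᵈ p s t = adhesionLessᵈ p s t ⊎ᵈ (sameAdhesionᵈ p s t ×ᵈ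
      ⋁ᵈ λ c → ⋁ᵈ λ c′ → decᵈ (c Fin.<? c′) ×ᵈ colourᵈ c s ×ᵈ colourᵈ c′ t)

  module _ {Γ : List Sort} where

    private
      D : (∀ (M : Model τ) → Model.Env M Γ → Vec (𝒫 (U (Model.B M))) K → Set) → Set₁
      D = Def {τ} {Γ} {K}

    precedesᵈ : (d s t : Γ ∋ 𝓝) → D (λ M ρ η → Precedes M η (get M ρ d) (get M ρ s) (get M ρ t))
    precedesᵈ d s t = (ancᵈ s t ×ᵈ ¬ᵈ (≡ᵈ s t)) ⊎ᵈ ∃ᵈ (∃ᵈ (∃ᵈ (
      ancᵈ (vs (vs (vs d))) (vs (vs vz)) ×ᵈ edgeᵈ (vs (vs vz)) (vs vz) ×ᵈ edgeᵈ (vs (vs vz)) vz ×ᵈ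
      beforeᵈ (vs (vs vz)) (vs vz) vz ×ᵈ ancᵈ (vs vz) (vs (vs (vs s))) ×ᵈ ancᵈ vz (vs (vs (vs t))))))

  module _ {Γ : List Sort} where

    private
      D : (∀ (M : Model τ) → Model.Env M Γ → Vec (𝒫 (U (Model.B M))) K → Set) → Set₁
      D = Def {τ} {Γ} {K}

    leᵈ : (d : Γ ∋ 𝓝) (x y : Γ ∋ 𝓔) → D (λ M ρ η → Le M η (get M ρ d) (get M ρ x) (get M ρ y))
    leᵈ d x y = ∃ᵈ (∃ᵈ (topᵈ (vs vz) (vs (vs x)) ×ᵈ topᵈ vz (vs (vs y)) ×ᵈ
      ((≡ᵈ (vs vz) vz ×ᵈ bag≤ᵈ (vs vz) (vs (vs x)) (vs (vs y))) ⊎ᵈ precedesᵈ (vs (vs d)) (vs vz) vz)))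

    properᵈ : D (λ M ρ η → Proper M η)
    properᵈ = (∀ᵈ (⋀ᵈ λ c → ⋀ᵈ λ c′ → decᵈ (c Fin.<? c′) →ᵈ colourᵈ c vz →ᵈ ¬ᵈ (colourᵈ c′ vz))) ×ᵈ
      (∀ᵈ (∀ᵈ (∀ᵈ (⋀ᵈ λ c → edgeᵈ (vs (vs vz)) (vs vz) →ᵈ edgeᵈ (vs (vs vz)) vz →ᵈ
        sameAdhesionᵈ (vs (vs vz)) (vs vz) vz →ᵈ colourᵈ c (vs vz) →ᵈ colourᵈ c vz →ᵈ ≡ᵈ (vs vz) vz))))

  module Cones (M : Model τ) (η : Vec (𝒫 (U (Model.B M))) K) where
    open Model M

    abstract
      inD? : ∀ d v → Dec (InD M η d v)
      inD? d v = decide (inDᵈ {Γ = 𝓝 ∷ 𝓔 ∷ []} vz (vs vz)) M (d , v , tt) η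

      le? : ∀ d x y → Dec (Le M η d x y)
      le? d x y = decide (leᵈ {Γ = 𝓝 ∷ 𝓔 ∷ 𝓔 ∷ []} vz (vs vz) (vs (vs vz))) M (d , x , y , tt) η

    cone : Node → 𝒫 (U B)
    cone d (inj₁ v) = ⌊ inD? d v ⌋
    cone d (inj₂ _) = false

    -- Order atoms are cut down to the cone, because `Le d` need not be total elsewhere. They are
    -- false for arguments outside it, such as the elements of the adhesion set, which occur as
    -- constants of the types.
    coneLeq : Node → U B → U B → Bool
    coneLeq d (inj₁ x) (inj₁ y) = ⌊ inD? d x ×-dec inD? d y ×-dec le? d x y ⌋
    coneLeq d _        _        = false

    coneRel : Node → Interpretation (τ ⊕ ≤-vocabulary) (U B)
    coneRel d (inj₁ R) xs           = rel B (inj₁ R) xs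
    coneRel d (inj₂ _) (x ∷ y ∷ []) = coneLeq d x y

    coneType : ∀ (d : Node) q {n} → Vec (U B) n → Fin (#Types (τ ⊕ ≤-vocabulary) q n)
    coneType d = tp {τ ⊕ ≤-vocabulary} (Structure.finite B) (coneRel d) (cone d)

  open Cones

  ≡-boolᵈ : ∀ {Γ} {P : Relation τ Γ K} {b : ∀ (M : Model τ) → Model.Env M Γ → Vec (𝒫 (U (Model.B M))) K →
      Bool} c →
            (∀ M ρ η → T (b M ρ η) → P M ρ η) → (∀ M ρ η → P M ρ η → T (b M ρ η)) → Def P →
            Def {τ} {Γ} {K} (λ M ρ η → b M ρ η ≡ c)
  ≡-boolᵈ {b = b} true  f g p = ⇔ᵈ (λ M ρ η a → T-ext (λ _ → tt) (λ _ → g M ρ η a))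
      (λ M ρ η e → f M ρ η (subst T (sym e) tt)) p
  ≡-boolᵈ {b = b} false f g p = ⇔ᵈ (λ M ρ η n → T-ext (λ t → n (f M ρ η t)) (λ ()))
      (λ M ρ η e a → subst T e (g M ρ η a)) (¬ᵈ p)

  module _ {Γ : List Sort} where

    coneᵈ : (d : Γ ∋ 𝓝) (x : Γ ∋ 𝓧) → Def {τ} {Γ} {K} (λ M ρ η → T (cone M η (get M ρ d) (get M ρ x)))
    coneᵈ d x = ⇔ᵈ forward backward (∃ᵈ (element≡ᵈ (vs x) vz ×ᵈ inDᵈ (vs d) vz))
      where
      Witness : Relation τ Γ K
      Witness M ρ η = ∃[ v ] get M ρ x ≡ inj₁ v × InD M η (get M ρ d) v
      forward : ∀ M ρ η → Witness M ρ η → T (cone M η (get M ρ d) (get M ρ x))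
      forward M ρ η (v , e , i) = subst (λ a → T (cone M η (get M ρ d) a)) (sym e)
          (fromWitness {a? = inD? M η (get M ρ d) v} i)
      backward : ∀ M ρ η → T (cone M η (get M ρ d) (get M ρ x)) → Witness M ρ η
      backward M ρ η t with get M ρ x
      ... | inj₁ v = v , refl , toWitness {a? = inD? M η (get M ρ d) v} t

    coneLeqᵈ : (d : Γ ∋ 𝓝) (x y : Γ ∋ 𝓧) →
               Def {τ} {Γ} {K} (λ M ρ η → T (coneLeq M η (get M ρ d) (get M ρ x) (get M ρ y)))
    coneLeqᵈ d x y = ⇔ᵈ forward backward (∃ᵈ (∃ᵈ (element≡ᵈ (vs (vs x)) (vs vz) ×ᵈ element≡ᵈ (vs (vs y)) vz ×ᵈ
        inDᵈ (vs (vs d)) (vs vz) ×ᵈ inDᵈ (vs (vs d)) vz ×ᵈ leᵈ (vs (vs d)) (vs vz) vz)))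
      where
      Witness : Relation τ Γ K
      Witness M ρ η = ∃[ u ] ∃[ v ] get M ρ x ≡ inj₁ u × get M ρ y ≡ inj₁ v ×
        InD M η (get M ρ d) u × InD M η (get M ρ d) v × Le M η (get M ρ d) u v
      forward : ∀ M ρ η → Witness M ρ η → T (coneLeq M η (get M ρ d) (get M ρ x) (get M ρ y))
      forward M ρ η (u , v , e , e′ , r) = subst₂ (λ a b → T (coneLeq M η (get M ρ d) a b)) (sym e) (sym e′)
        (fromWitness {a? = inD? M η (get M ρ d) u ×-dec inD? M η (get M ρ d) v ×-dec le? M η (get M ρ d) u v} r)
      backward : ∀ M ρ η → T (coneLeq M η (get M ρ d) (get M ρ x) (get M ρ y)) → Witness M ρ η
      backward M ρ η t with get M ρ x | get M ρ y
      ... | inj₁ u | inj₁ v = u , v , refl , refl , toWitness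
          {a? = inD? M η (get M ρ d) u ×-dec inD? M η (get M ρ d) v ×-dec le? M η (get M ρ d) u v} t

    holdsᵈ : ∀ {n} (d : Γ ∋ 𝓝) (xs : Vec (Γ ∋ 𝓧) n) α b → Def {τ} {Γ} {K} (λ M ρ η →
      holds {τ ⊕ ≤-vocabulary} (Structure.finite (Model.B M)) (coneRel M η (get M ρ d)) (map (get M ρ) xs) α ≡
          b)
    holdsᵈ d xs (equal i j) b = ≡-boolᵈ b
      (λ M ρ η t → trans (sym (lookup-map i (get M ρ) xs)) (trans
          (toWitness {a? = finite-≟ (Structure.finite (Model.B M)) _ _} t) (lookup-map j (get M ρ) xs)))
      (λ M ρ η e → fromWitness {a? = finite-≟ (Structure.finite (Model.B M)) _ _}
          (trans (lookup-map i (get M ρ) xs) (trans e (sym (lookup-map j (get M ρ) xs)))))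
      (≡ᵈ (lookup xs i) (lookup xs j))
    holdsᵈ d xs (related (inj₁ R) is) b = ≡-boolᵈ b
      (λ M ρ η → subst (T ∘ rel (Model.B M) (inj₁ R)) (gets M ρ))
      (λ M ρ η → subst (T ∘ rel (Model.B M) (inj₁ R)) (sym (gets M ρ)))
      (atomᵈ R (map (lookup xs) is))
      where
      gets : ∀ M ρ → map (lookup (map (get M ρ) xs)) is ≡ map (get M ρ) (map (lookup xs) is)
      gets M ρ = trans (map-cong (λ i → lookup-map i (get M ρ) xs) is) (map-∘ (get M ρ) (lookup xs) is)
    holdsᵈ d xs (related (inj₂ tt) (i ∷ j ∷ [])) b = ≡-boolᵈ b
      (λ M ρ η → subst₂ (λ x y → T (coneLeq M η (get M ρ d) x y)) (lookup-map i (get M ρ) xs)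
          (lookup-map j (get M ρ) xs))
      (λ M ρ η → subst₂ (λ x y → T (coneLeq M η (get M ρ d) x y)) (sym (lookup-map i (get M ρ) xs))
          (sym (lookup-map j (get M ρ) xs)))
      (coneLeqᵈ d (lookup xs i) (lookup xs j))

  encodeᵈ : ∀ {Γ n} {f : Fin n → ∀ (M : Model τ) → Model.Env M Γ → Vec (𝒫 (U (Model.B M))) K → Bool} →
            (∀ i b → Def {τ} {Γ} {K} (λ M ρ η → f i M ρ η ≡ b)) → ∀ θ →
            Def {τ} {Γ} {K} (λ M ρ η → encode (λ i → f i M ρ η) ≡ θ)
  encodeᵈ {n = n} {f} p θ = ⇔ᵈ
    (λ M ρ η e → trans (encode-cong e) (encode-decode {n} θ))
    (λ M ρ η e i → trans (sym (decode-encode (λ i → f i M ρ η) i)) (cong (λ θ → decode {n} θ i) e))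
    (⋀ᵈ λ i → p i (decode {n} θ i))

  -- These are Hintikka formulas, relativised to the cone and with the order atom replaced by its
  -- definition. As there are finitely many types, θ prescribes a finite conjunction of realised and
  -- omitted extensions.
  coneTypeᵈ : ∀ {Γ} q {n} (d : Γ ∋ 𝓝) (xs : Vec (Γ ∋ 𝓧) n) θ →
              Def {τ} {Γ} {K} (λ M ρ η → coneType M η (get M ρ d) q (map (get M ρ) xs) ≡ θ)
  coneTypeᵈ zero {n} d xs θ = ⇔ᵈ
    (λ M ρ η → trans (tp-zero {τ ⊕ ≤-vocabulary} (Structure.finite (Model.B M)) (coneRel M η (get M ρ d))
        (cone M η (get M ρ d)) (map (get M ρ) xs)))
    (λ M ρ η → trans (sym (tp-zero {τ ⊕ ≤-vocabulary} (Structure.finite (Model.B M)) (coneRel M η (get M ρ d))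
        (cone M η (get M ρ d)) (map (get M ρ) xs))))
    (encodeᵈ (λ i b → holdsᵈ d xs (List.lookup (atoms (τ ⊕ ≤-vocabulary) n) i) b) θ)
  coneTypeᵈ {Γ} (suc q) {n} d xs θ = ⇔ᵈ
    (λ M ρ η (e , e′) → trans (suc-eq M ρ η) (trans (cong₂ combine e e′) (Fin.combine-remQuot {N} (2 ^ N′) θ)))
    (λ M ρ η e → Fin.combine-injective _ _ _ _ (trans (sym (suc-eq M ρ η))
        (trans e (sym (Fin.combine-remQuot {N} (2 ^ N′) θ)))))
    (coneTypeᵈ q d xs (proj₁ (remQuot {N} (2 ^ N′) θ)) ×ᵈ
     encodeᵈ (λ ξ b → ≡-boolᵈ b
       (λ M ρ η t → toWitness {a? = ext? M ρ η ξ} t)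
       (λ M ρ η e → fromWitness {a? = ext? M ρ η ξ} e)
       (∃ᵈ (coneᵈ (vs d) vz ×ᵈ ⇔ᵈ (λ M ρ η → trans (cong (coneType M η (get M ρ (vs {σ′ = 𝓧} d)) q)
           (gets-extend M ρ xs)))
                                  (λ M ρ η → trans (cong (coneType M η (get M ρ (vs {σ′ = 𝓧} d)) q)
                                      (sym (gets-extend M ρ xs))))
                                  (coneTypeᵈ q (vs d) (vz ∷ map vs xs) ξ))))
       (proj₂ (remQuot {N} (2 ^ N′) θ)))
    where
    N = #Types (τ ⊕ ≤-vocabulary) q n
    N′ = #Types (τ ⊕ ≤-vocabulary) q (suc n)
    ext? : ∀ M ρ η ξ → Dec _
    ext? M ρ η ξ = extension? {τ ⊕ ≤-vocabulary} (Structure.finite (Model.B M)) (coneRel M η (get M ρ d))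
        (cone M η (get M ρ d)) q (map (get M ρ) xs) ξ
    suc-eq : ∀ M ρ η → _
    suc-eq M ρ η = tp-suc {τ ⊕ ≤-vocabulary} (Structure.finite (Model.B M)) (coneRel M η (get M ρ d))
        (cone M η (get M ρ d)) q (map (get M ρ) xs)

-- Isomorphisms and transductions

module _ {τ} {A B : Structure τ} (iso : A ≅ B) where
  private
    f = Inverse.to (_≅_.bijection iso)
    g = Inverse.from (_≅_.bijection iso)
    fg : ∀ b → f (g b) ≡ b
    fg = Inverse.strictlyInverseˡ (_≅_.bijection iso)
    gf : ∀ a → g (f a) ≡ a
    gf = Inverse.strictlyInverseʳ (_≅_.bijection iso)

  Sat-≅ : ∀ {L m s} (φ : Formula τ L m s) (ρ : Vec (U A) m) {η : Vec (𝒫 (U A)) s} {η′ : Vec (𝒫 (U B)) s} →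
          (∀ i a → lookup η i a ≡ lookup η′ i (f a)) → Sat A ρ η φ ⇔ Sat B (map f ρ) η′ φ
  Sat-≅ (x ≐ y) ρ e rewrite lookup-map x f ρ | lookup-map y f ρ =
    mk⇔ (cong f) (λ e → trans (sym (gf _)) (trans (cong g e) (gf _)))
  Sat-≅ (atom R xs) ρ e = ≡⇔ (cong T (trans (_≅_.preserves iso R _) (cong (rel B R)
    (trans (sym (map-∘ f (lookup ρ) xs)) (map-cong (λ x → sym (lookup-map x f ρ)) xs)))))
  Sat-≅ (x ∈ˢ X) ρ {η′ = η′} e = ≡⇔ (cong T (trans (e X _) (cong (lookup η′ X) (sym (lookup-map x f ρ)))))
  Sat-≅ (¬ᶠ φ) ρ e = let h = Sat-≅ φ ρ e in mk⇔ (_∘ from h) (_∘ to h)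
  Sat-≅ (φ ∧ᶠ ψ) ρ e = let h = Sat-≅ φ ρ e ; h′ = Sat-≅ ψ ρ e in
    mk⇔ (λ (a , b) → to h a , to h′ b) (λ (a , b) → from h a , from h′ b)
  Sat-≅ (φ ∨ᶠ ψ) ρ e = let h = Sat-≅ φ ρ e ; h′ = Sat-≅ ψ ρ e in
    mk⇔ (λ { (inj₁ a) → inj₁ (to h a) ; (inj₂ b) → inj₂ (to h′ b) })
        (λ { (inj₁ a) → inj₁ (from h a) ; (inj₂ b) → inj₂ (from h′ b) })
  Sat-≅ (∃ᶠ φ) ρ {η′ = η′} e = mk⇔
    (λ (a , s) → f a , to (Sat-≅ φ (a ∷ ρ) e) s)
    (λ (b , s) → g b , from (Sat-≅ φ (g b ∷ ρ) e) (subst (λ b → Sat B (b ∷ map f ρ) η′ φ) (sym (fg b)) s))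
  Sat-≅ (∀ᶠ φ) ρ {η′ = η′} e = mk⇔
    (λ h b → subst (λ b → Sat B (b ∷ map f ρ) η′ φ) (fg b) (to (Sat-≅ φ (g b ∷ ρ) e) (h (g b))))
    (λ h a → from (Sat-≅ φ (a ∷ ρ) e) (h (f a)))
  Sat-≅ (∃ˢ φ) ρ e = mk⇔
    (λ (S , s) → S ∘ g , to (Sat-≅ φ ρ λ { zero a → cong S (sym (gf a)) ; (suc i) → e i }) s)
    (λ (S , s) → S ∘ f , from (Sat-≅ φ ρ λ { zero a → refl ; (suc i) → e i }) s)
  Sat-≅ (∀ˢ φ) ρ e = mk⇔
    (λ h S → to (Sat-≅ φ ρ λ { zero a → refl ; (suc i) → e i }) (h (S ∘ f)))
    (λ h S → from (Sat-≅ φ ρ λ { zero a → cong S (sym (gf a)) ; (suc i) → e i }) (h (S ∘ g)))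

module _ {τ} {A B : Structure τ} (iso : A ≅ B) where
  private
    f = Inverse.to (_≅_.bijection iso)
    g = Inverse.from (_≅_.bijection iso)
    fg : ∀ b → f (g b) ≡ b
    fg = Inverse.strictlyInverseˡ (_≅_.bijection iso)
    gf : ∀ a → g (f a) ≡ a
    gf = Inverse.strictlyInverseʳ (_≅_.bijection iso)

  ⊨-≅ : ∀ {L} (φ : Sentence τ L) → (A ⊨ φ) ⇔ (B ⊨ φ)
  ⊨-≅ φ = Sat-≅ iso φ [] {[]} {[]} (λ ())

  transport : LinearOrder (U A) → LinearOrder (U B)
  transport o = record
    { leq = λ x y → leq o (g x) (g y)
    ; isTotalOrder = record
      { isPartialOrder = record
        { isPreorder = record
          { isEquivalence = isEquivalence ; reflexive = λ { refl → O.refl } ; trans = O.trans }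
        ; antisym = λ p q → trans (sym (fg _)) (trans (cong f (O.antisym p q)) (fg _))
        }
      ; total = λ x y → O.total (g x) (g y)
      }
    }
    where module O = IsTotalOrder (LinearOrder.isTotalOrder o)

  ≅-ordered : ∀ o → (A ,≤ o) ≅ (B ,≤ transport o)
  ≅-ordered o = record { bijection = _≅_.bijection iso ; preserves = λ
    { (inj₁ R) xs → _≅_.preserves iso R xs
    ; (inj₂ _) (x ∷ y ∷ []) → cong₂ (leq o) (sym (gf x)) (sym (gf y)) } }

≅-sym : ∀ {τ} {A B : Structure τ} → A ≅ B → B ≅ A
≅-sym {B = B} iso = record
  { bijection = ↔-sym (_≅_.bijection iso)
  ; preserves = λ R xs → sym (trans (_≅_.preserves iso R _) (cong (rel B R)
      (trans (sym (map-∘ _ _ xs)) (trans (map-cong (Inverse.strictlyInverseˡ (_≅_.bijection iso)) xs)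
          (map-id xs)))))
  }

⊨ⁱⁿᵛ-≅ : ∀ {τ} {A B : Structure τ} → A ≅ B → ∀ φ → A ⊨ⁱⁿᵛ φ → B ⊨ⁱⁿᵛ φ
⊨ⁱⁿᵛ-≅ iso φ (o , p) = transport iso o , to (⊨-≅ (≅-ordered iso o) φ) p

⊨ⁱⁿᵛ-at : ∀ {τ} (φ : Sentence (τ ⊕ ≤-vocabulary) FO) → OrderInvariant {τ} φ → ∀ A o → (A ⊨ⁱⁿᵛ φ) ⇔ (A ,≤ o ⊨ φ)
⊨ⁱⁿᵛ-at φ invariant A o = mk⇔ (λ (o′ , q) → to (invariant A o′ o) q) (o ,_)

existsSets : ∀ {τ m k} n → Formula τ MSO m (n + k) → Formula τ MSO m k
existsSets zero    φ = φ
existsSets (suc n) φ = existsSets n (∃ˢ φ)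

Sat-existsSets : ∀ {τ m k} (A : Structure τ) (ρ : Vec (U A) m) (η : Vec (𝒫 (U A)) k) n φ →
  Sat A ρ η (existsSets n φ) ⇔ (∃[ ζ ] Sat A ρ (Vec._++_ {m = n} ζ η) φ)
Sat-existsSets A ρ η zero    φ = mk⇔ (λ p → [] , p) (λ { ([] , p) → p })
Sat-existsSets A ρ η (suc n) φ = let e = Sat-existsSets A ρ η n (∃ˢ φ) in mk⇔
  (λ p → let ζ , S , q = to e p in S ∷ ζ , q)
  (λ { (S ∷ ζ , q) → from e (ζ , S , q) })

closeSets : ∀ {τ m} n → Formula τ MSO m n → Formula τ MSO m 0
closeSets zero    φ = φ
closeSets (suc n) φ = closeSets n (∃ˢ φ)

Sat-closeSets : ∀ {τ m} (A : Structure τ) (ρ : Vec (U A) m) n φ →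
  Sat A ρ [] (closeSets n φ) ⇔ (∃[ η ] Sat A ρ η φ)
Sat-closeSets A ρ zero    φ = mk⇔ (λ p → [] , p) (λ { ([] , p) → p })
Sat-closeSets A ρ (suc n) φ = let e = Sat-closeSets A ρ n (∃ˢ φ) in mk⇔
  (λ p → let η , S , q = to e p in S ∷ η , q)
  (λ { (S ∷ η , q) → from e (η , S , q) })

⋁ᶠ : ∀ {τ m k n} → (Fin n → Formula τ MSO m k) → Formula τ MSO m k
⋁ᶠ {n = zero}  φ = ¬ᶠ (∀ᶠ (zero ≐ zero))
⋁ᶠ {n = suc n} φ = φ zero ∨ᶠ ⋁ᶠ (φ ∘ suc)

Sat-⋁ : ∀ {τ m k n} (A : Structure τ) (ρ : Vec (U A) m) (η : Vec (𝒫 (U A)) k) (φ : Fin n → _) →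
        Sat A ρ η (⋁ᶠ φ) ⇔ (∃[ i ] Sat A ρ η (φ i))
Sat-⋁ {n = zero}  A ρ η φ = mk⇔ (λ p → ⊥-elim (p λ _ → refl)) (λ ())
Sat-⋁ {n = suc n} A ρ η φ = let e = Sat-⋁ A ρ η (φ ∘ suc) in mk⇔
  (λ { (inj₁ p) → zero , p ; (inj₂ p) → let i , q = to e p in suc i , q })
  (λ { (zero , p) → inj₁ p ; (suc i , q) → inj₂ (from e (i , q)) })

lift : ∀ {m n} → (Fin m → Fin n) → Fin (suc m) → Fin (suc n)
lift f zero    = zero
lift f (suc i) = suc (f i)

module _ {τ : Vocabulary} {p : ℕ} where

  -- The parameters become free set variables, found at h.
  rename : ∀ {L m m′ s s′} → (Fin m → Fin m′) → (Fin s → Fin s′) → (Fin p → Fin s′) →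
           Formula (τ ⊕ unary p) L m s → Formula τ MSO m′ s′
  rename f g h (x ≐ y)                  = f x ≐ f y
  rename f g h (atom (inj₁ R) xs)       = atom R (map f xs)
  rename f g h (atom (inj₂ j) (x ∷ [])) = f x ∈ˢ h j
  rename f g h (x ∈ˢ X)                 = f x ∈ˢ g X
  rename f g h (¬ᶠ φ)                   = ¬ᶠ rename f g h φ
  rename f g h (φ ∧ᶠ ψ)                 = rename f g h φ ∧ᶠ rename f g h ψ
  rename f g h (φ ∨ᶠ ψ)                 = rename f g h φ ∨ᶠ rename f g h ψ
  rename f g h (∃ᶠ φ)                   = ∃ᶠ rename (lift f) g h φ
  rename f g h (∀ᶠ φ)                   = ∀ᶠ rename (lift f) g h φ
  rename f g h (∃ˢ φ)                   = ∃ˢ rename f (lift g) (suc ∘ h) φ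
  rename f g h (∀ˢ φ)                   = ∀ˢ rename f (lift g) (suc ∘ h) φ

  module _ {τ′ w} (Λ : Transduction τ τ′ w p) (A : Structure τ) (P : Fin p → 𝒫 (U A)) where

    Sat-rename : ∀ {L m m′ s s′} (φ : Formula (τ ⊕ unary p) L m s)
      {f : Fin m → Fin m′} {g : Fin s → Fin s′} {h : Fin p → Fin s′}
      {ρ : Vec (U A) m} {ρ′ : Vec (U A) m′} {η : Vec (𝒫 (U A)) s} {η′ : Vec (𝒫 (U A)) s′} →
      (∀ x → lookup ρ x ≡ lookup ρ′ (f x)) → (∀ X a → lookup η X a ≡ lookup η′ (g X) a) →
      (∀ j a → P j a ≡ lookup η′ (h j) a) →
      Sat (withParameters Λ A P) ρ η φ ⇔ Sat A ρ′ η′ (rename f g h φ)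
    Sat-rename (x ≐ y) e d c = ≡⇔ (cong₂ _≡_ (e x) (e y))
    Sat-rename (atom (inj₁ R) xs) {f} {ρ′ = ρ′} e d c =
      ≡⇔ (cong (T ∘ rel A R) (trans (map-cong e xs) (map-∘ (lookup ρ′) f xs)))
    Sat-rename (atom (inj₂ j) (x ∷ [])) {h = h} {η′ = η′} e d c =
        ≡⇔ (cong T (trans (c j _) (cong (lookup η′ (h j)) (e x))))
    Sat-rename (x ∈ˢ X) {g = g} {η′ = η′} e d c = ≡⇔ (cong T (trans (d X _) (cong (lookup η′ (g X)) (e x))))
    Sat-rename (¬ᶠ φ) e d c = let i = Sat-rename φ e d c in mk⇔ (_∘ from i) (_∘ to i)
    Sat-rename (φ ∧ᶠ ψ) e d c = let i = Sat-rename φ e d c ; j = Sat-rename ψ e d c in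
      mk⇔ (λ (a , b) → to i a , to j b) (λ (a , b) → from i a , from j b)
    Sat-rename (φ ∨ᶠ ψ) e d c = let i = Sat-rename φ e d c ; j = Sat-rename ψ e d c in
      mk⇔ (λ { (inj₁ a) → inj₁ (to i a) ; (inj₂ b) → inj₂ (to j b) })
          (λ { (inj₁ a) → inj₁ (from i a) ; (inj₂ b) → inj₂ (from j b) })
    Sat-rename (∃ᶠ φ) e d c =
      let i : ∀ a → _ ⇔ _
          i a = Sat-rename φ {ρ = a ∷ _} (λ { zero → refl ; (suc x) → e x }) d c
      in mk⇔ (λ (a , q) → a , to (i a) q) (λ (a , q) → a , from (i a) q)
    Sat-rename (∀ᶠ φ) e d c =
      let i : ∀ a → _ ⇔ _
          i a = Sat-rename φ {ρ = a ∷ _} (λ { zero → refl ; (suc x) → e x }) d c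
      in mk⇔ (λ q a → to (i a) (q a)) (λ q a → from (i a) (q a))
    Sat-rename (∃ˢ φ) e d c =
      let i : ∀ S → _ ⇔ _
          i S = Sat-rename φ {η = S ∷ _} e (λ { zero a → refl ; (suc X) → d X }) c
      in mk⇔ (λ (S , q) → S , to (i S) q) (λ (S , q) → S , from (i S) q)
    Sat-rename (∀ˢ φ) e d c =
      let i : ∀ S → _ ⇔ _
          i S = Sat-rename φ {η = S ∷ _} e (λ { zero a → refl ; (suc X) → d X }) c
      in mk⇔ (λ q S → to (i S) (q S)) (λ q S → from (i S) (q S))

module _ {τ τ′ w p} (Λ : Transduction τ τ′ w p) where
  open Transduction Λ

  existsElement : ∀ {m s} → (Fin p → Fin s) → (Fin w → Formula τ MSO (suc m) s) → Formula τ MSO m s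
  existsElement h φ = ⋁ᶠ λ i → ∃ᶠ (rename (λ _ → zero) (λ ()) h (λ-U i) ∧ᶠ φ i)

  extend : ∀ {m} → Fin w → (Fin m → Fin w) → Fin (suc m) → Fin w
  extend i ι zero    = i
  extend i ι (suc x) = ι x

  -- A set in the transduced structure is represented by w sets in A, one for each copy.
  addSets : ∀ {s s′} → (Fin s → Fin w → Fin s′) → Fin (suc s) → Fin w → Fin (w + s′)
  addSets {s′ = s′} g zero    i = i ↑ˡ s′
  addSets g (suc X) i = w ↑ʳ g X i

  -- The backwards translation along a transduction. An element variable keeps its name for the
  -- point in A, and `ι` fixes at translation time the copy in which it lies; quantification over
  -- copies becomes a finite disjunction.
  pullback : ∀ {L m s s′} → (Fin m → Fin w) → (Fin s → Fin w → Fin s′) → (Fin p → Fin s′) →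
             Formula τ′ L m s → Formula τ MSO m s′
  pullback ι g h (x ≐ y) with ι x Fin.≟ ι y
  ... | yes _ = x ≐ y
  -- Elements of different copies are distinct, so this is the constant false.
  ... | no  _ = ¬ᶠ (x ≐ x)
  pullback ι g h (atom R xs) = rename (lookup xs) (λ ()) h (λ-R R (map ι xs))
  pullback ι g h (x ∈ˢ X)    = x ∈ˢ g X (ι x)
  pullback ι g h (¬ᶠ φ)      = ¬ᶠ pullback ι g h φ
  pullback ι g h (φ ∧ᶠ ψ)    = pullback ι g h φ ∧ᶠ pullback ι g h ψ
  pullback ι g h (φ ∨ᶠ ψ)    = pullback ι g h φ ∨ᶠ pullback ι g h ψ
  pullback ι g h (∃ᶠ φ)      = existsElement h λ i → pullback (extend i ι) g h φ
  pullback ι g h (∀ᶠ φ)      = ¬ᶠ existsElement h λ i → ¬ᶠ pullback (extend i ι) g h φ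
  pullback ι g h (∃ˢ φ)      = existsSets w (pullback ι (addSets g) ((w ↑ʳ_) ∘ h) φ)
  pullback ι g h (∀ˢ φ)      = ¬ᶠ existsSets w (¬ᶠ pullback ι (addSets g) ((w ↑ʳ_) ∘ h) φ)

  module _ (A : Structure τ) (P : Fin p → 𝒫 (U A)) where
    private
      𝔅 = transduce Λ A P
      A,P = withParameters Λ A P

    point : U 𝔅 → U A
    point e = proj₁ (proj₁ e)

    copy : U 𝔅 → Fin w
    copy e = proj₂ (proj₁ e)

    copies : Vec (𝒫 (U A)) w → 𝒫 (U 𝔅)
    copies ζ e = lookup ζ (copy e) (point e)

    member : 𝒫 (U 𝔅) → Fin w → U A → Bool
    member S i a with T? ⌊ sat? A,P (a ∷ []) [] (λ-U i) ⌋
    ... | yes t = S ((a , i) , t)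
    -- Points outside the universe of the transduced structure are never read, so any value would
    -- do.
    ... | no _  = false

    member-≡ : ∀ S e → member S (copy e) (point e) ≡ S e
    member-≡ S ((a , i) , t) with T? ⌊ sat? A,P (a ∷ []) [] (λ-U i) ⌋
    ... | yes t′ = cong (λ t → S ((a , i) , t)) (T-irrelevant t′ t)
    ... | no ¬t  = ⊥-elim (¬t t)

    member-copies : ∀ S e → S e ≡ copies (tabulate (member S)) e
    member-copies S e = sym (trans (cong (λ X → X (point e)) (lookup∘tabulate (member S) (copy e)))
        (member-≡ S e))

    addSets-≡ : ∀ {s s′} {η : Vec (𝒫 (U 𝔅)) s} {η′ : Vec (𝒫 (U A)) s′} {g S ζ} →
      (∀ X e → lookup η X e ≡ lookup η′ (g X (copy e)) (point e)) → (∀ e → S e ≡ copies ζ e) →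
      ∀ X e → lookup (S ∷ η) X e ≡ lookup (ζ ++ η′) (addSets g X (copy e)) (point e)
    addSets-≡ {η′ = η′} {ζ = ζ} D d zero e =
      trans (d e) (sym (cong (λ X → X (point e)) (lookup-++ˡ ζ η′ (copy e))))
    addSets-≡ {η′ = η′} {g} {ζ = ζ} D d (suc X) e =
      trans (D X e) (sym (cong (λ X → X (point e)) (lookup-++ʳ ζ η′ (g X (copy e)))))

    Sat-existsElement : ∀ {m s} {ρ : Vec (U A) m} {η : Vec (𝒫 (U A)) s} {h} →
      (∀ j a → P j a ≡ lookup η (h j) a) → (φ : Fin w → Formula τ MSO (suc m) s) →
      Sat A ρ η (existsElement h φ) ⇔ (∃[ e ] Sat A (point e ∷ ρ) η (φ (copy e)))
    Sat-existsElement {ρ = ρ} {η} {h} H φ = mk⇔ forward backward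
      where
      disjunct : Fin w → Formula τ MSO _ _
      disjunct i = ∃ᶠ (rename (λ _ → zero) (λ ()) h (λ-U i) ∧ᶠ φ i)
      domain : ∀ i a → Sat A,P (a ∷ []) [] (λ-U i) ⇔ Sat A (a ∷ ρ) η (rename (λ _ → zero) (λ ()) h (λ-U i))
      domain i a = Sat-rename Λ A P (λ-U i) (λ { zero → refl }) (λ ()) H
      forward : Sat A ρ η (existsElement h φ) → ∃[ e ] Sat A (point e ∷ ρ) η (φ (copy e))
      forward q with to (Sat-⋁ A ρ η disjunct) q
      ... | i , a , u , r = ((a , i) , fromWitness {a? = sat? A,P (a ∷ []) [] (λ-U i)} (from (domain i a) u))
          , r
      backward : (∃[ e ] Sat A (point e ∷ ρ) η (φ (copy e))) → Sat A ρ η (existsElement h φ)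
      backward (((a , i) , t) , r) = from (Sat-⋁ A ρ η disjunct)
        (i , a , to (domain i a) (toWitness {a? = sat? A,P (a ∷ []) [] (λ-U i)} t) , r)

    Sat-pullback : ∀ {L m s s′} (φ : Formula τ′ L m s) {ι : Fin m → Fin w} {g : Fin s → Fin w → Fin s′}
        {h : Fin p → Fin s′}
      {ρ : Vec (U 𝔅) m} {ρ′ : Vec (U A) m} {η : Vec (𝒫 (U 𝔅)) s} {η′ : Vec (𝒫 (U A)) s′} →
      (∀ x → lookup ρ′ x ≡ point (lookup ρ x)) → (∀ x → ι x ≡ copy (lookup ρ x)) →
      (∀ X e → lookup η X e ≡ lookup η′ (g X (copy e)) (point e)) → (∀ j a → P j a ≡ lookup η′ (h j) a) →
      Sat 𝔅 ρ η φ ⇔ Sat A ρ′ η′ (pullback ι g h φ)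
    Sat-pullback (x ≐ y) {ι} E C D H with ι x Fin.≟ ι y
    ... | yes q = mk⇔ (λ e → trans (E x) (trans (cong point e) (sym (E y))))
                      (λ e → Elem-≡ _ (cong₂ _,_ (trans (sym (E x)) (trans e (E y)))
                          (trans (sym (C x)) (trans q (C y)))))
    ... | no ¬q = mk⇔ (λ e → ⊥-elim (¬q (trans (C x) (trans (cong copy e) (sym (C y))))))
        (λ n → ⊥-elim (n refl))
    Sat-pullback (atom R xs) {ι} {h = h} {ρ} {ρ′} E C D H = mk⇔
      (λ t → to renamed (subst (Sat A,P points [] ∘ λ-R R) indices
          (toWitness {a? = sat? A,P points [] (λ-R R _)} t)))
      (λ t → fromWitness {a? = sat? A,P points [] (λ-R R _)}
          (subst (Sat A,P points [] ∘ λ-R R) (sym indices) (from renamed t)))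
      where
      points = map point (map (lookup ρ) xs)
      indices : map copy (map (lookup ρ) xs) ≡ map ι xs
      indices = trans (sym (map-∘ copy (lookup ρ) xs)) (map-cong (sym ∘ C) xs)
      renamed = Sat-rename Λ A P (λ-R R (map ι xs)) {f = lookup xs} {h = h} {ρ = points}
        (λ j → trans (lookup-map j point (map (lookup ρ) xs))
            (trans (cong point (lookup-map j (lookup ρ) xs)) (sym (E (lookup xs j)))))
        (λ ()) H
    Sat-pullback (x ∈ˢ X) {ι} {g} {η′ = η′} E C D H = ≡⇔ (cong T (trans (D X _)
      (cong₂ (λ i a → lookup η′ (g X i) a) (sym (C x)) (sym (E x)))))
    Sat-pullback (¬ᶠ φ) E C D H = let i = Sat-pullback φ E C D H in mk⇔ (_∘ from i) (_∘ to i)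
    Sat-pullback (φ ∧ᶠ ψ) E C D H = let i = Sat-pullback φ E C D H ; j = Sat-pullback ψ E C D H in
      mk⇔ (λ (a , b) → to i a , to j b) (λ (a , b) → from i a , from j b)
    Sat-pullback (φ ∨ᶠ ψ) E C D H = let i = Sat-pullback φ E C D H ; j = Sat-pullback ψ E C D H in
      mk⇔ (λ { (inj₁ a) → inj₁ (to i a) ; (inj₂ b) → inj₂ (to j b) })
          (λ { (inj₁ a) → inj₁ (from i a) ; (inj₂ b) → inj₂ (from j b) })
    Sat-pullback (∃ᶠ φ) {ι} {g} {h} {ρ} {ρ′} {η} {η′} E C D H = mk⇔
      (λ (e , q) → from ex (e , to (inner e) q)) (λ q → let e , r = to ex q in e , from (inner e) r)
      where
      inner : ∀ e → Sat 𝔅 (e ∷ ρ) η φ ⇔ Sat A (point e ∷ ρ′) η′ (pullback (extend (copy e) ι) g h φ)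
      inner e = Sat-pullback φ (λ { zero → refl ; (suc x) → E x }) (λ { zero → refl ; (suc x) → C x }) D H
      ex = Sat-existsElement {ρ = ρ′} {η′} H (λ i → pullback (extend i ι) g h φ)
    Sat-pullback (∀ᶠ φ) {ι} {g} {h} {ρ} {ρ′} {η} {η′} E C D H = mk⇔
      (λ q r → let e , n = to ex r in n (to (inner e) (q e)))
      (λ n e → from (inner e) (decidable-stable (sat? A (point e ∷ ρ′) η′
          (pullback (extend (copy e) ι) g h φ)) λ m → n (from ex (e , m))))
      where
      inner : ∀ e → Sat 𝔅 (e ∷ ρ) η φ ⇔ Sat A (point e ∷ ρ′) η′ (pullback (extend (copy e) ι) g h φ)
      inner e = Sat-pullback φ (λ { zero → refl ; (suc x) → E x }) (λ { zero → refl ; (suc x) → C x }) D H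
      ex = Sat-existsElement {ρ = ρ′} {η′} H (λ i → ¬ᶠ pullback (extend i ι) g h φ)
    Sat-pullback {s′ = s′} (∃ˢ φ) {ι} {g} {h} {ρ} {ρ′} {η} {η′} E C D H = mk⇔
      (λ (S , q) → from ex (tabulate (member S) , to (inner S (tabulate (member S)) (member-copies S)) q))
      (λ q → let ζ , r = to ex q in copies ζ , from (inner (copies ζ) ζ (λ _ → refl)) r)
      where
      inner : ∀ S ζ → (∀ e → S e ≡ copies ζ e) →
        Sat 𝔅 ρ (S ∷ η) φ ⇔ Sat A ρ′ (ζ ++ η′) (pullback ι (addSets g) ((w ↑ʳ_) ∘ h) φ)
      inner S ζ d = Sat-pullback φ E C (addSets-≡ {η = η} {η′} {g} {S} {ζ} D d)
          (λ j a → trans (H j a) (sym (cong (λ X → X a) (lookup-++ʳ ζ η′ (h j)))))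
      ex = Sat-existsSets A ρ′ η′ w (pullback ι (addSets g) ((w ↑ʳ_) ∘ h) φ)
    Sat-pullback {s′ = s′} (∀ˢ φ) {ι} {g} {h} {ρ} {ρ′} {η} {η′} E C D H = mk⇔
      (λ q r → let ζ , n = to ex r in n (to (inner (copies ζ) ζ (λ _ → refl)) (q (copies ζ))))
      (λ n S → from (inner S (tabulate (member S)) (member-copies S))
          (decidable-stable (sat? A ρ′ (tabulate (member S) ++ η′) (pullback ι (addSets g) ((w ↑ʳ_) ∘ h) φ))
              λ m → n (from ex (tabulate (member S) , m))))
      where
      inner : ∀ S ζ → (∀ e → S e ≡ copies ζ e) →
        Sat 𝔅 ρ (S ∷ η) φ ⇔ Sat A ρ′ (ζ ++ η′) (pullback ι (addSets g) ((w ↑ʳ_) ∘ h) φ)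
      inner S ζ d = Sat-pullback φ E C (addSets-≡ {η = η} {η′} {g} {S} {ζ} D d)
          (λ j a → trans (H j a) (sym (cong (λ X → X a) (lookup-++ʳ ζ η′ (h j)))))
      ex = Sat-existsSets A ρ′ η′ w (¬ᶠ pullback ι (addSets g) ((w ↑ʳ_) ∘ h) φ)

  -- Existential quantification over the parameters suffices, because the sentence to be pulled back
  -- has the same truth value on every member of the image of a structure in the class.
  preimage : Sentence τ′ MSO → Sentence τ MSO
  preimage φ = existsSets p (rename (λ ()) (λ ()) (_↑ˡ 0) λ-valid ∧ᶠ pullback (λ ()) (λ ()) (_↑ˡ 0) φ)

  ⊨-preimage : ∀ A φ → (A ⊨ preimage φ) ⇔ (∃[ P ] (withParameters Λ A P ⊨ λ-valid) × (transduce Λ A P ⊨ φ))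
  ⊨-preimage A φ = mk⇔ forward backward
    where
    parts : ∀ P (ζ : Vec (𝒫 (U A)) p) → (∀ j a → P j a ≡ lookup ζ j a) →
      ((withParameters Λ A P ⊨ λ-valid) ⇔ Sat A [] (ζ ++ []) (rename (λ ()) (λ ()) (_↑ˡ 0) λ-valid)) ×
      ((transduce Λ A P ⊨ φ) ⇔ Sat A [] (ζ ++ []) (pullback (λ ()) (λ ()) (_↑ˡ 0) φ))
    parts P ζ e =
      Sat-rename Λ A P λ-valid {f = λ ()} {g = λ ()} {h = _↑ˡ 0} {ρ = []} {[]} {[]} {ζ ++ []} (λ ()) (λ ())
        (λ j a → trans (e j a) (sym (cong (λ X → X a) (lookup-++ˡ ζ [] j)))) ,
      Sat-pullback A P φ {λ ()} {λ ()} {_↑ˡ 0} {[]} {[]} {[]} {ζ ++ []} (λ ()) (λ ()) (λ ())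
        (λ j a → trans (e j a) (sym (cong (λ X → X a) (lookup-++ˡ ζ [] j))))
    Witness : Set
    Witness = ∃[ P ] (withParameters Λ A P ⊨ λ-valid) × (transduce Λ A P ⊨ φ)
    forward : A ⊨ preimage φ → Witness
    forward q with to (Sat-existsSets A [] [] p _) q
    ... | ζ , v , r = let i , j = parts (lookup ζ) ζ (λ _ _ → refl) in lookup ζ , from i v , from j r
    backward : Witness → A ⊨ preimage φ
    backward (P , v , r) =
      let i , j = parts P (tabulate P) (λ j a → sym (cong (λ X → X a) (lookup∘tabulate P j)))
      in from (Sat-existsSets A [] [] p _) (tabulate P , to i v , to j r)

-- Deleting one cone

module Lexicographic {X : Set} (key : X → ℕ) (loc : ℕ → X → X → Bool)
  (trans-loc : ∀ n {x y w} → key x ≡ n → key y ≡ n → key w ≡ n → T (loc n x y) → T (loc n y w) → T (loc n x w))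
  (antisym-loc : ∀ n {x y} → key x ≡ n → key y ≡ n → T (loc n x y) → T (loc n y x) → x ≡ y)
  (total-loc : ∀ n {x y} → key x ≡ n → key y ≡ n → T (loc n x y) ⊎ T (loc n y x)) where

  lexLeq : X → X → Bool
  lexLeq x y = (key x <ᵇ key y) ∨ ((key x ≡ᵇ key y) ∧ loc (key x) x y)

  lex⁺ : ∀ {x y} → key x < key y ⊎ (key x ≡ key y × T (loc (key x) x y)) → T (lexLeq x y)
  lex⁺ (inj₁ lt)      = from T-∨ (inj₁ (<⇒<ᵇ lt))
  lex⁺ (inj₂ (e , l)) = from T-∨ (inj₂ (from T-∧ (≡⇒≡ᵇ _ _ e , l)))

  lex⁻ : ∀ {x y} → T (lexLeq x y) → key x < key y ⊎ (key x ≡ key y × T (loc (key x) x y))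
  lex⁻ {x} {y} t with to (T-∨ {key x <ᵇ key y}) t
  ... | inj₁ lt = inj₁ (<ᵇ⇒< _ _ lt)
  ... | inj₂ r with to (T-∧ {key x ≡ᵇ key y}) r
  ...   | e , l = inj₂ (≡ᵇ⇒≡ _ _ e , l)

  private
    lex-trans : ∀ {x y w} → T (lexLeq x y) → T (lexLeq y w) → T (lexLeq x w)
    lex-trans {x} {y} {w} a b with lex⁻ {x} {y} a | lex⁻ {y} {w} b
    ... | inj₁ lt | inj₁ lt′ = lex⁺ (inj₁ (<-trans lt lt′))
    ... | inj₁ lt | inj₂ (e , _) = lex⁺ (inj₁ (subst (key x <_) e lt))
    ... | inj₂ (e , _) | inj₁ lt = lex⁺ (inj₁ (subst (_< key w) (sym e) lt))
    ... | inj₂ (e , l) | inj₂ (e′ , l′) = lex⁺ (inj₂ (trans e e′ ,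
            trans-loc (key x) refl (sym e) (sym (trans e e′)) l (subst (λ n → T (loc n y w)) (sym e) l′)))

    lex-antisym : ∀ {x y} → T (lexLeq x y) → T (lexLeq y x) → x ≡ y
    lex-antisym {x} {y} a b with lex⁻ {x} {y} a | lex⁻ {y} {x} b
    ... | inj₁ lt | inj₁ lt′ = ⊥-elim (<-asym lt lt′)
    ... | inj₁ lt | inj₂ (e , _) = ⊥-elim (<-irrefl (sym e) lt)
    ... | inj₂ (e , _) | inj₁ lt = ⊥-elim (<-irrefl (sym e) lt)
    ... | inj₂ (e , l) | inj₂ (_ , l′) = antisym-loc (key x) refl (sym e) l
        (subst (λ n → T (loc n y x)) (sym e) l′)

    lex-total : ∀ x y → T (lexLeq x y) ⊎ T (lexLeq y x)
    lex-total x y with <-cmp (key x) (key y)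
    ... | tri< lt _ _ = inj₁ (lex⁺ (inj₁ lt))
    ... | tri> _ _ gt = inj₂ (lex⁺ (inj₁ gt))
    ... | tri≈ _ e _ with total-loc (key x) {x} {y} refl (sym e)
    ...   | inj₁ l = inj₁ (lex⁺ (inj₂ (e , l)))
    ...   | inj₂ l = inj₂ (lex⁺ (inj₂ (sym e , subst (λ n → T (loc n y x)) e l)))

  lexOrder : LinearOrder X
  lexOrder = record
    { leq = lexLeq
    ; isTotalOrder = record
      { isPartialOrder = record
        { isPreorder = record
          { isEquivalence = isEquivalence
          ; reflexive = λ { {x} refl → reduce (lex-total x x) }
          ; trans = λ {x} {y} {w} → lex-trans {x} {y} {w}
          }
        ; antisym = λ {x} {y} → lex-antisym {x} {y}
        }
      ; total = lex-total
      }
    }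

  leq-local : ∀ {x y} → key x ≡ key y → lexLeq x y ≡ loc (key x) x y
  leq-local {x} {y} e = T-ext forward (λ l → lex⁺ (inj₂ (e , l)))
    where
    forward : T (lexLeq x y) → T (loc (key x) x y)
    forward t with lex⁻ {x} {y} t
    ... | inj₁ lt = ⊥-elim (<-irrefl e lt)
    ... | inj₂ (_ , l) = l

sub-≗ : ∀ {τ} (A : Structure τ) (S S′ : 𝒫 (U A)) → (∀ v → T (S v) → T (S′ v)) → (∀ v → T (S′ v) → T (S v)) →
        sub A S ≅ sub A S′
sub-≗ A S S′ f g = record
  { bijection = mk↔ₛ′ forward (λ (v , t) → v , g v t) (λ _ → Elem-≡ S′ refl) (λ _ → Elem-≡ S refl)
  ; preserves = λ R xs → cong (rel A R) (map-∘ proj₁ forward xs)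
  }
  where
  forward : Elem S → Elem S′
  forward (v , t) = v , f v t

sub-all : ∀ {τ} (A : Structure τ) (S : 𝒫 (U A)) → (∀ v → T (S v)) → A ≅ sub A S
sub-all A S all = record
  { bijection = mk↔ₛ′ forward proj₁ (λ _ → Elem-≡ S refl) (λ _ → refl)
  ; preserves = λ R xs → cong (rel A R) (trans (sym (map-id xs)) (map-∘ proj₁ forward xs))
  }
  where
  forward : U A → Elem S
  forward v = v , all v

allInj₁-map : ∀ {X Y : Set} {n} (xs : Vec X n) → allInj₁ {X} {Y} (map inj₁ xs) ≡ just xs
allInj₁-map []       = refl
allInj₁-map (x ∷ xs) = cong (Maybe.map (x ∷_)) (allInj₁-map xs)

module _ {τ} (M : Model τ) where
  open Model M

  rel-element : ∀ R (xs : Vec (U base) (arity τ R)) → rel B (inj₁ R) (map inj₁ xs) ≡ rel base R xs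
  rel-element R xs = cong (Maybe.maybe′ (rel base R) false) (allInj₁-map xs)

All-lookup : ∀ {X : Set} {P : X → Set} {n} {xs : Vec X n} → All P xs → ∀ i → P (lookup xs i)
All-lookup (p ∷ ps) zero    = p
All-lookup (p ∷ ps) (suc i) = All-lookup ps i

-- `Composition` indexes blocks by natural numbers, whereas the cones form a family over `Fin n`;
-- the default fills the indices beyond it.
lookupOr : ∀ {Y : Set} {n} → Y → (Fin n → Y) → ℕ → Y
lookupOr {n = zero}  d f j       = d
lookupOr {n = suc n} d f zero    = f zero
lookupOr {n = suc n} d f (suc j) = lookupOr d (f ∘ suc) j

lookupOr-toℕ : ∀ {Y : Set} {n} (d : Y) (f : Fin n → Y) i → lookupOr d f (toℕ i) ≡ f i
lookupOr-toℕ d f zero    = refl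
lookupOr-toℕ d f (suc i) = lookupOr-toℕ d (f ∘ suc) i

lookupOr-elim : ∀ {Y : Set} {n} (P : ℕ → Y → Set) (d : Y) (f : Fin n → Y) →
                (∀ j → P j d) → (∀ i → P (toℕ i) (f i)) → ∀ j → P j (lookupOr d f j)
lookupOr-elim {n = zero}  P d f pd pf j       = pd j
lookupOr-elim {n = suc n} P d f pd pf zero    = pf zero
lookupOr-elim {n = suc n} P d f pd pf (suc j) = lookupOr-elim (P ∘ suc) d (f ∘ suc) (pd ∘ suc) (pf ∘ suc) j

-- What the game needs from an order in which everything outside the family comes first, as block 0,
-- and each member i follows as block `suc (toℕ i)` in its own order `ord i`.
record Blocked {X : Set} {n : ℕ} (In : Fin n → X → Set) (ord : Fin n → X → X → Bool) : Set where
  field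
    block      : X → ℕ
    block≤n    : ∀ v → block v ≤ n
    block-in   : ∀ {i v} → In i v → block v ≡ suc (toℕ i)
    block-suc  : ∀ {j v} → block v ≡ suc j → ∃[ i ] toℕ i ≡ j × In i v
    block-0    : ∀ {v} → (∀ i → ¬ In i v) → block v ≡ 0
    blockOrder : LinearOrder X
    block-<    : ∀ {x y} → block x < block y → T (leq blockOrder x y)
    block-leq  : ∀ {i x y} → In i x → In i y → leq blockOrder x y ≡ ord i x y

  block-at : ∀ {v} i → block v ≡ suc (toℕ i) → In i v
  block-at i b with block-suc b
  ... | i′ , eq , d = subst (λ i → In i _) (Fin.toℕ-injective eq) d

module Blocks {X : Set} (fin : Finite X) {n : ℕ} (In : Fin n → X → Set) (in? : ∀ i v → Dec (In i v))
  (disjoint : ∀ {i j v} → In i v → In j v → i ≡ j) (ord : Fin n → X → X → Bool)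
  (ord-trans : ∀ {i x y w} → In i x → In i y → In i w → T (ord i x y) → T (ord i y w) → T (ord i x w))
  (ord-antisym : ∀ {i x y} → In i x → In i y → T (ord i x y) → T (ord i y x) → x ≡ y)
  (ord-total : ∀ {i x y} → In i x → In i y → T (ord i x y) ⊎ T (ord i y x)) where

  abstract
    block : X → ℕ
    block v with Fin.any? (λ i → in? i v)
    ... | yes (i , _) = suc (toℕ i)
    ... | no _        = 0

    block≤n : ∀ v → block v ≤ n
    block≤n v with Fin.any? (λ i → in? i v)
    ... | yes (i , _) = Fin.toℕ<n i
    ... | no _        = z≤n

    block-in : ∀ {i v} → In i v → block v ≡ suc (toℕ i)
    block-in {i} {v} d with Fin.any? (λ i → in? i v)
    ... | yes (j , d′) = cong (suc ∘ toℕ) (disjoint d′ d)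
    ... | no none      = ⊥-elim (none (i , d))

    block-suc : ∀ {j v} → block v ≡ suc j → ∃[ i ] toℕ i ≡ j × In i v
    block-suc {v = v} b with Fin.any? (λ i → in? i v)
    block-suc refl | yes (i , d) = i , refl , d

    block-0 : ∀ {v} → (∀ i → ¬ In i v) → block v ≡ 0
    block-0 {v} none with Fin.any? (λ i → in? i v)
    ... | yes (i , d) = ⊥-elim (none i d)
    ... | no _        = refl

  block-at : ∀ {v} i → block v ≡ suc (toℕ i) → In i v
  block-at i b with block-suc b
  ... | i′ , eq , d = subst (λ i → In i _) (Fin.toℕ-injective eq) d

  private
    number : X → ℕ
    number x = toℕ (Inverse.to (proj₂ fin) x)

    loc : ℕ → X → X → Bool
    -- The context may be ordered arbitrarily, thanks to order invariance; the enumeration of X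
    -- provides an order.
    loc zero    x y = number x ≤ᵇ number y
    loc (suc j) x y = lookupOr false (λ i → ord i x y) j

    loc⁻ : ∀ i {x y} → T (loc (suc (toℕ i)) x y) → T (ord i x y)
    loc⁻ i {x} {y} = subst T (lookupOr-toℕ false (λ i → ord i x y) i)

    loc⁺ : ∀ i {x y} → T (ord i x y) → T (loc (suc (toℕ i)) x y)
    loc⁺ i {x} {y} = subst T (sym (lookupOr-toℕ false (λ i → ord i x y) i))

    loc-trans : ∀ n {x y w} → block x ≡ n → block y ≡ n → block w ≡ n → T (loc n x y) → T (loc n y w) →
        T (loc n x w)
    loc-trans zero {x} {y} {w} _ _ _ a b = ≤⇒≤ᵇ (≤-trans (≤ᵇ⇒≤ (number x) (number y) a)
        (≤ᵇ⇒≤ (number y) (number w) b))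
    loc-trans (suc j) bx by bw a b with block-suc bx
    ... | i , refl , dx = loc⁺ i (ord-trans dx (block-at i by) (block-at i bw) (loc⁻ i a) (loc⁻ i b))

    loc-antisym : ∀ n {x y} → block x ≡ n → block y ≡ n → T (loc n x y) → T (loc n y x) → x ≡ y
    loc-antisym zero {x} {y} _ _ a b =
      trans (sym (Inverse.strictlyInverseʳ (proj₂ fin) x)) (trans (cong (Inverse.from (proj₂ fin))
        (Fin.toℕ-injective (≤-antisym (≤ᵇ⇒≤ (number x) (number y) a) (≤ᵇ⇒≤ (number y) (number x) b))))
            (Inverse.strictlyInverseʳ (proj₂ fin) y))
    loc-antisym (suc j) bx by a b with block-suc bx
    ... | i , refl , dx = ord-antisym dx (block-at i by) (loc⁻ i a) (loc⁻ i b)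

    loc-total : ∀ n {x y} → block x ≡ n → block y ≡ n → T (loc n x y) ⊎ T (loc n y x)
    loc-total zero {x} {y} _ _ = Sum.map ≤⇒≤ᵇ ≤⇒≤ᵇ (≤-total (number x) (number y))
    loc-total (suc j) bx by with block-suc bx
    ... | i , refl , dx = Sum.map (loc⁺ i) (loc⁺ i) (ord-total dx (block-at i by))

    module Lex = Lexicographic block loc loc-trans loc-antisym loc-total

  abstract
    blockOrder : LinearOrder X
    blockOrder = Lex.lexOrder

    block-< : ∀ {x y} → block x < block y → T (leq blockOrder x y)
    block-< lt = Lex.lex⁺ (inj₁ lt)

    block-leq : ∀ {i x y} → In i x → In i y → leq blockOrder x y ≡ ord i x y
    block-leq {i} {x} {y} dx dy = trans (Lex.leq-local (trans (block-in dx) (sym (block-in dy))))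
      (trans (cong (λ n → loc n x y) (block-in dx)) (lookupOr-toℕ false (λ i → ord i x y) i))

  blocked : Blocked In ord
  blocked = record
    { block = block ; block≤n = block≤n ; block-in = block-in ; block-suc = block-suc ; block-0 = block-0
    ; blockOrder = blockOrder ; block-< = block-< ; block-leq = block-leq }

module _ {τ} (M : Model τ) {K : ℕ} (η : Vec (𝒫 (U (Model.B M))) K) (proper : Pruning.Proper M η) where
  open Model M
  open Pruning M η
  open Cones M η
  open Ordered proper

  coneLeq⁻ : ∀ {d x y} → T (coneLeq d (inj₁ x) (inj₁ y)) → Le d x y
  coneLeq⁻ {d} {x} {y} t = proj₂ (proj₂ (toWitness {a? = inD? d x ×-dec inD? d y ×-dec le? d x y} t))

  coneLeq⁺ : ∀ {d x y} → InD d x → InD d y → Le d x y → T (coneLeq d (inj₁ x) (inj₁ y))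
  coneLeq⁺ {d} {x} {y} a b l = fromWitness {a? = inD? d x ×-dec inD? d y ×-dec le? d x y} (a , b , l)

  -- The cones of distinct siblings share no element: its top would be below both. Each is linearly
  -- ordered by its own depth-first order, so the cones can serve as consecutive blocks.
  module _ {p : Node} {n : ℕ} (e : Fin n → Node) (e-edge : ∀ i → Edge p (e i))
    (e-injective : ∀ {i j} → e i ≡ e j → i ≡ j) where

    disjoint : ∀ {i j v} → InD (e i) v → InD (e j) v → i ≡ j
    disjoint {i} {j} (t , top , l) (t′ , top′ , l′) = e-injective
      (siblings-below (e-edge i) (e-edge j) (proj₁ l) (subst (Anc (e j)) (Top-unique top′ top) (proj₁ l′)))

    blockedCones : Blocked (InD ∘ e) (λ i x y → coneLeq (e i) (inj₁ x) (inj₁ y))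
    blockedCones = Blocks.blocked (Structure.finite base) (InD ∘ e) (inD? ∘ e) disjoint
      (λ i x y → coneLeq (e i) (inj₁ x) (inj₁ y))
      (λ dx dy dw a b → coneLeq⁺ dx dw (Le-trans (coneLeq⁻ a) (coneLeq⁻ b)))
      (λ dx dy a b → Le-antisym (coneLeq⁻ a) (coneLeq⁻ b))
      (λ dx dy → Sum.map (coneLeq⁺ dx dy) (coneLeq⁺ dy dx) (Le-total dx dy))

module Deletion {τ} (M : Model τ) {K k Q m : ℕ} (η : Vec (𝒫 (U (Model.B M))) K)
  (φ : Sentence (τ ⊕ ≤-vocabulary) FO) (invariant : OrderInvariant {τ} φ) (qr≤Q : qr φ ≤ Q)
      (Q≤m : threshold Q ≤ m) where
  open Model M
  open Pruning M η
  open Cones M η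

  -- The cone of `e zero` is deleted, taking S to S′. `S-cone` and `cone-S` say that below each of
  -- the siblings S is exactly the pruned cone, so that the types of pruned cones describe the
  -- blocks actually present.
  module _ (p : Node) (e : Fin (suc m) → Node) (e-edge : ∀ i → Edge p (e i))
    (same : ∀ i → SameAdhesion p (e zero) (e i))
    (c̄ : Vec (U B) k) (covers : ∀ v → T (β p v) → T (β (e zero) v) → ∃[ l ] lookup c̄ l ≡ inj₁ v)
    (types : ∀ i j → coneType (e i) Q c̄ ≡ coneType (e j) Q c̄)
    (S S′ : 𝒫 (U base))
    (S-cone : ∀ i {v t} → Top t v → Anc (e i) t → T (S v) → InD (e i) v)
    (cone-S : ∀ i {v} → InD (e i) v → T (S v))
    (S⇒S′ : ∀ {v} → T (S v) → ¬ InD (e zero) v → T (S′ v))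
    (S′⇒S : ∀ {v} → T (S′ v) → T (S v) × ¬ InD (e zero) v)
    (blocks : Blocked (InD ∘ e) (λ i x y → coneLeq (e i) (inj₁ x) (inj₁ y))) where

    open Blocked blocks

    blockCone : ℕ → 𝒫 (U B)
    blockCone zero    = λ _ → false
    blockCone (suc j) = lookupOr (λ _ → false) (cone ∘ e) j

    blockRel : ℕ → Interpretation (τ ⊕ ≤-vocabulary) (U B)
    blockRel zero    = coneRel p
    blockRel (suc j) = lookupOr (coneRel p) (coneRel ∘ e) j

    cone⇒block : ∀ {j x} → T (blockCone (suc j) x) → ∃[ v ] x ≡ inj₁ v × block v ≡ suc j × T (S v)
    cone⇒block {j} {x} = lookupOr-elim (λ j (D : 𝒫 (U B)) → T (D x) → ∃[ v ] x ≡ inj₁ v × block v ≡ suc j ×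
        T (S v))
        (λ _ → false) (cone ∘ e) (λ _ ()) (element x) j
      where
      element : ∀ x i → T (cone (e i) x) → ∃[ v ] x ≡ inj₁ v × block v ≡ suc (toℕ i) × T (S v)
      element (inj₁ v) i t = let d = toWitness {a? = inD? (e i) v} t in v , refl , block-in d , cone-S i d

    block⇒cone : ∀ {j v} → block v ≡ suc j → T (blockCone (suc j) (inj₁ v))
    block⇒cone {j} {v} b = go (block-suc b)
      where
      go : ∀ {j} → ∃[ i ] toℕ i ≡ j × InD (e i) v → T (blockCone (suc j) (inj₁ v))
      go (i , refl , d) = subst (λ D → T (D (inj₁ v))) (sym (lookupOr-toℕ (λ _ → false) (cone ∘ e) i))
                                (fromWitness {a? = inD? (e i) v} d)

    blockRel-element : ∀ j R xs → blockRel j (inj₁ R) (map inj₁ xs) ≡ rel base R xs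
    blockRel-element zero    R xs = rel-element M R xs
    blockRel-element (suc j) R xs = lookupOr-elim
      (λ _ (I : Interpretation (τ ⊕ ≤-vocabulary) (U B)) → I (inj₁ R) (map inj₁ xs) ≡ rel base R xs)
      (coneRel p) (coneRel ∘ e) (λ _ → rel-element M R xs) (λ _ → rel-element M R xs) j

    blockRel-leq : ∀ {j x y} → block x ≡ suc j → block y ≡ suc j →
                   blockRel (suc j) (inj₂ tt) (inj₁ x ∷ inj₁ y ∷ []) ≡ leq blockOrder x y
    blockRel-leq {j} {x} {y} bx by = go (block-suc bx) by
      where
      go : ∀ {j} → ∃[ i ] toℕ i ≡ j × InD (e i) x → block y ≡ suc j →
           blockRel (suc j) (inj₂ tt) (inj₁ x ∷ inj₁ y ∷ []) ≡ leq blockOrder x y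
      go (i , refl , d) by = trans
        (cong (λ (I : Interpretation (τ ⊕ ≤-vocabulary) (U B)) → I (inj₂ tt) (inj₁ x ∷ inj₁ y ∷ []))
              (lookupOr-toℕ (coneRel p) (coneRel ∘ e) i))
        (sym (block-leq d (block-at i by)))

    adhesion-covered : ∀ i {w} → T (β p w) → T (β (e i) w) → ∃[ l ] lookup c̄ l ≡ inj₁ w
    adhesion-covered i {w} bp be = covers w bp (proj₂ (same i w bp) be)

    -- If the top s of w is at or below `e i`, then w belongs to block i. If s is strictly above,
    -- then w persists on the way down to `bag`, hence lies in the bags of both p and `e i`; it is
    -- in no block, because s is at or above p.
    block-or-adhesion : ∀ i {s bag w} → Anc (e i) bag → T (β bag w) → Top s w → T (S w) →
                        Anc (e i) s ⊎ Anc s (e i) → block w ≡ suc (toℕ i) ⊎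
                            (block w ≡ 0 × ∃[ l ] lookup c̄ l ≡ inj₁ w)
    block-or-adhesion i ie bw topₛ inS (inj₁ es) = inj₁ (block-in (S-cone i topₛ es inS))
    block-or-adhesion i {s} {w = w} ie bw topₛ inS (inj₂ se) = go (s ≟ᴺ e i)
      where
      between : ∀ t → Anc s t → Anc t _ → T (β t w)
      between = proj₂ (Top-above topₛ _ bw)
      go : Dec (s ≡ e i) → block w ≡ suc (toℕ i) ⊎ (block w ≡ 0 × ∃[ l ] lookup c̄ l ≡ inj₁ w)
      go (yes s≡e) = inj₁ (block-in (S-cone i topₛ (subst (λ t → Anc t s) s≡e ε) inS))
      go (no s≢e)  = inj₂ (block-0 none , adhesion-covered i (between p sp (e-edge i ◅ ie))
          (between (e i) se ie))
        where
        sp : Anc s p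
        sp = anc-parent se s≢e (e-edge i)
        none : ∀ i′ → ¬ InD (e i′) w
        none i′ (s′ , top′ , anc′ , _) =
          ¬anc-parent (e-edge i′) (subst (Anc (e i′)) (Top-unique top′ topₛ) anc′ ◅◅ sp)

    -- A related tuple lies in one bag. An entry in the cone of `e i` forces this bag below `e i`,
    -- and the tops of all other entries are ancestors of the bag, hence comparable with `e i`.
    local : ∀ R (xs : Vec (U base) (arity τ R)) → T (rel base R xs) → (∀ j → T (S (lookup xs j))) →
            ∀ {n} j → block (lookup xs j) ≡ suc n → ∀ j′ → block (lookup xs j′) ≡ suc n ⊎
              (block (lookup xs j′) ≡ 0 × ∃[ l ] lookup c̄ l ≡ inj₁ (lookup xs j′))
    local R xs r inS j b j′ = go (block-suc b) (Top-exists (lookup xs j′))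
        (TreeDecomposition.covers decomposition R xs r)
      where
      go : ∀ {n} → ∃[ i ] toℕ i ≡ n × InD (e i) (lookup xs j) → ∃[ s ] Top s (lookup xs j′) →
           Σ[ bag ∈ Node ] All (λ v → T (β bag v)) xs →
           block (lookup xs j′) ≡ suc n ⊎ (block (lookup xs j′) ≡ 0 × ∃[ l ] lookup c̄ l ≡ inj₁ (lookup xs j′))
      go (i , refl , t , top , anc , _) (s , topₛ) (bag , all) =
        block-or-adhesion i ie (All-lookup all j′) topₛ (inS j′)
          (anc-comparable ie (proj₁ (Top-above topₛ bag (All-lookup all j′))))
        where
        ie : Anc (e i) bag
        ie = anc ◅◅ proj₁ (Top-above top bag (All-lookup all j))

    blockType : ∀ j → Fin (#Types (τ ⊕ ≤-vocabulary) Q k)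
    blockType j = tp {τ ⊕ ≤-vocabulary} (Structure.finite B) (blockRel j) (blockCone j) Q c̄

    blockType-toℕ : ∀ i → blockType (suc (toℕ i)) ≡ coneType (e i) Q c̄
    blockType-toℕ i = cong₂ (λ (I : Interpretation (τ ⊕ ≤-vocabulary) (U B)) D →
        tp {τ ⊕ ≤-vocabulary} (Structure.finite B) I D Q c̄)
      (lookupOr-toℕ (coneRel p) (coneRel ∘ e) i) (lookupOr-toℕ (λ _ → false) (cone ∘ e) i)

    homogeneous : ∀ i j → suc i ≤ suc m → suc j ≤ suc m → blockType (suc i) ≡ blockType (suc j)
    homogeneous i j a b = subst₂ (λ i j → blockType (suc i) ≡ blockType (suc j)) (Fin.toℕ-fromℕ< a)
        (Fin.toℕ-fromℕ< b)
      (trans (blockType-toℕ _) (trans (types (fromℕ< a) (fromℕ< b)) (sym (blockType-toℕ _))))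

    private
      side : ℕ → 𝒫 (U base)
      side = remaining block S

      side-S : sub base (side 0) ≅ sub base S
      side-S = sub-≗ base (side 0) S (λ v t → proj₁ (remaining⁻ block S {0} t))
                                     (λ v s → remaining⁺ block S {0} s (zero-or-positive (block v)))
        where
        zero-or-positive : ∀ n → n ≡ 0 ⊎ 0 < n
        zero-or-positive zero    = inj₁ refl
        zero-or-positive (suc n) = inj₂ (s≤s z≤n)

      side-S′ : sub base (side 1) ≅ sub base S′
      side-S′ = sub-≗ base (side 1) S′ forward backward
        where
        forward : ∀ v → T (side 1 v) → T (S′ v)
        forward v t = S⇒S′ (proj₁ split) λ d → clash (block-in d) (proj₂ split)
          where
          split : T (S v) × (block v ≡ 0 ⊎ 1 < block v)
          split = remaining⁻ block S {1} t
          clash : block v ≡ 1 → ¬ (block v ≡ 0 ⊎ 1 < block v)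
          clash b (inj₁ z) = 0≢1+n (trans (sym z) b)
          clash b (inj₂ l) = <-irrefl (sym b) l
        backward : ∀ v → T (S′ v) → T (side 1 v)
        backward v t = go (block v) refl
          where
          go : ∀ n → block v ≡ n → T (side 1 v)
          go 0 b             = remaining⁺ block S {1} (proj₁ (S′⇒S t)) (inj₁ b)
          go 1 b             = ⊥-elim (proj₂ (S′⇒S t) (block-at zero b))
          go (suc (suc j)) b = remaining⁺ block S {1} (proj₁ (S′⇒S t))
              (inj₂ (subst (1 <_) (sym b) (s≤s (s≤s z≤n))))

      invariant-side : ∀ lo → (sub base (side lo) ⊨ⁱⁿᵛ φ) ⇔ (orderedSub base blockOrder (side lo) ⊨ φ)
      invariant-side lo = ⊨ⁱⁿᵛ-at {τ} φ invariant (sub base (side lo)) (restrict (side lo) blockOrder)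

      sides : (orderedSub base blockOrder (side 0) ⊨ φ) ⇔ (orderedSub base blockOrder (side 1) ⊨ φ)
      sides = Composition.composition base blockOrder block (suc m) block≤n S (Structure.finite B) inj₁
          inj₁-injective c̄
        blockRel blockCone cone⇒block block⇒cone blockRel-element blockRel-leq block-< local Q homogeneous
        -- There are m + 1 blocks before the deletion and m after it, both at least `threshold Q`.
        z≤n (s≤s z≤n) (inj₂ (m≤n⇒m≤1+n Q≤m , Q≤m)) φ qr≤Q

    -- On either side, invariance replaces the unspecified order by the restricted block order. The
    -- substructures may lie outside the class of the theorem; invariance still applies, being
    -- assumed for all structures.
    delete : (sub base S ⊨ⁱⁿᵛ φ) ⇔ (sub base S′ ⊨ⁱⁿᵛ φ)
    delete = mk⇔
      (λ q → ⊨ⁱⁿᵛ-≅ side-S′ φ (from (invariant-side 1) (to sides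
          (to (invariant-side 0) (⊨ⁱⁿᵛ-≅ (≅-sym side-S) φ q)))))
      (λ q → ⊨ⁱⁿᵛ-≅ side-S φ (from (invariant-side 0) (from sides
          (to (invariant-side 1) (⊨ⁱⁿᵛ-≅ (≅-sym side-S′) φ q)))))

-- Pruning the whole decomposition

bound : ∀ {X} → Finite X → (f : X → ℕ) → ∃[ n ] (∀ x → f x < n)
bound (n , b) f =
  let c , lt = go n (f ∘ Inverse.from b)
  in c , λ x → subst (λ y → f y < c) (Inverse.strictlyInverseʳ b x) (lt (Inverse.to b x))
  where
  go : ∀ n (g : Fin n → ℕ) → ∃[ c ] (∀ i → g i < c)
  go zero    g = 0 , λ ()
  go (suc n) g = let c , lt = go n (g ∘ suc) in suc (g zero) ⊔ c , λ
    { zero    → m≤m⊔n (suc (g zero)) c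
    ; (suc i) → ≤-trans (lt i) (m≤n⊔m (suc (g zero)) c) }

-- The colour `combine θ i` stands for the type θ and the position i among the retained siblings of
-- that type and adhesion set.
#Colours : Vocabulary → (Q k m : ℕ) → ℕ
#Colours τ Q k m = #Types (τ ⊕ ≤-vocabulary) Q k * m

module _ {τ : Vocabulary} {Q k m : ℕ} (M : Model τ) (η : Vec (𝒫 (U (Model.B M))) (#Colours τ Q k m)) where
  open Model M
  open Pruning M η
  open Cones M η

  Covers : Node → Node → Vec (U B) k → Set
  Covers p d c̄ = ∀ v → T (β p v) → T (β d v) → ∃[ l ] lookup c̄ l ≡ inj₁ v

  -- d may be deleted: it has m retained siblings that look the same.
  Redundant : (θ : Fin (#Types (τ ⊕ ≤-vocabulary) Q k)) → Node → Node → Vec (U B) k → Set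
  Redundant θ p d c̄ = Covers p d c̄ × coneType d Q c̄ ≡ θ ×
    (∀ i → ∃[ e ] Edge p e × SameAdhesion p d e × Colour (combine θ i) e × coneType e Q c̄ ≡ θ)

  -- This does not say that colours are true types or that retained siblings are few, only that
  -- every deletion is justified by m coloured twins. Soundness rests on this alone, and MSO can
  -- express it.
  Certified : Set
  Certified = Proper × (∀ p d → Edge p d → ¬ Retained d → ∃[ θ ] ∃[ c̄ ] Redundant θ p d c̄)

module Soundness {τ : Vocabulary} {k : ℕ} (M : Model τ)
  (φ : Sentence (τ ⊕ ≤-vocabulary) FO) (invariant : OrderInvariant {τ} φ)
  (η : Vec (𝒫 (U (Model.B M))) (#Colours τ (qr φ) k (threshold (qr φ))))
  (certified : Certified {Q = qr φ} {k} {threshold (qr φ)} M η) where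
  open Model M
  open Pruning M η
  open Cones M η

  private
    m = threshold (qr φ)
    K = #Colours τ (qr φ) k m
    proper : Proper
    proper = proj₁ certified
    N = proj₁ finite
    number : Node → Fin N
    number = Inverse.to (proj₂ finite)

  retained? : ∀ t → Dec (Retained t)
  retained? t = Fin.any? (λ c → T? (lookup η c (inj₂ t)))

  -- Nodes are deleted in decreasing order of rank.
  rank : Node → ℕ
  rank t = depth t * N + toℕ (number t)

  rank-mono : ∀ {s t} → depth s < depth t → rank s < rank t
  rank-mono {s} {t} lt = begin-strict
    depth s * N + toℕ (number s) <⟨ +-monoʳ-< (depth s * N) (Fin.toℕ<n (number s)) ⟩
    depth s * N + N              ≡⟨ +-comm (depth s * N) N ⟩
    suc (depth s) * N            ≤⟨ *-monoˡ-≤ N lt ⟩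
    depth t * N                  ≤⟨ m≤m+n (depth t * N) _ ⟩
    depth t * N + toℕ (number t) ∎
    where open ≤-Reasoning

  rank-injective : ∀ {s t} → rank s ≡ rank t → s ≡ t
  rank-injective {s} {t} e = go (<-cmp (depth s) (depth t))
    where
    go : _ → s ≡ t
    go (tri< lt _ _) = ⊥-elim (<-irrefl e (rank-mono lt))
    go (tri> _ _ gt) = ⊥-elim (<-irrefl (sym e) (rank-mono gt))
    go (tri≈ _ d _)  = trans (sym (Inverse.strictlyInverseʳ (proj₂ finite) s))
      (trans (cong (Inverse.from (proj₂ finite)) (Fin.toℕ-injective (+-cancelˡ-≡ (depth s * N) _ _
        (trans e (cong (λ d → d * N + toℕ (number t)) (sym d)))))) (Inverse.strictlyInverseʳ (proj₂ finite) t))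

  -- The root has no siblings and is never deleted, whether or not it carries a colour.
  Surplus : Node → Set
  Surplus u = (∃[ p ] Edge p u) × ¬ Retained u

  surplus? : ∀ u → Dec (Surplus u)
  surplus? u = finite-∃? finite (λ p → T? (edge p u)) ×-dec ¬? (retained? u)

  top : U base → Node
  top v = proj₁ (Top-exists v)

  -- What is left after deleting the cones of rank at least c.
  Left : ℕ → U base → Set
  Left c v = ∀ u → Surplus u → c ≤ rank u → ¬ Anc u (top v)

  abstract
    left? : ∀ c v → Dec (Left c v)
    left? c v = map′ (λ n u s l a → n (u , s , l , a)) (λ f (u , s , l , a) → f u s l a)
      (¬? (finite-∃? finite (λ u → surplus? u ×-dec (c ≤? rank u) ×-dec anc? u (top v))))

    left : ℕ → 𝒫 (U base)
    left c v = ⌊ left? c v ⌋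

    left⁺ : ∀ {c v} → Left c v → T (left c v)
    left⁺ {c} {v} = fromWitness {a? = left? c v}

    left⁻ : ∀ {c v} → T (left c v) → Left c v
    left⁻ {c} {v} = toWitness {a? = left? c v}

  root-cone : 𝒫 (U base)
  root-cone v = ⌊ inD? root v ⌋

  Left-all : ∀ {c} → (∀ u → rank u < c) → ∀ v → Left c v
  Left-all lt v u _ l _ = <-irrefl refl (≤-trans (lt u) l)

  Left-0⇒root : ∀ v → Left 0 v → InD root v
  Left-0⇒root v l = top v , proj₂ (Top-exists v) , root-anc (top v) , λ u _ r≢u a →
    decidable-stable (retained? u) λ n → l u (has-parent (parent? u) r≢u , n) z≤n a
    where
    has-parent : ∀ {u} → (∃[ p ] Edge p u) ⊎ u ≡ root → root ≢ u → ∃[ p ] Edge p u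
    has-parent (inj₁ e) _   = e
    has-parent (inj₂ e) r≢u = ⊥-elim (r≢u (sym e))

  root⇒Left-0 : ∀ v → InD root v → Left 0 v
  root⇒Left-0 v (t , topₜ , _ , live) u ((p , e) , n) _ a = n (live u (root-anc u)
    (λ r≡u → root-no-parent p (subst (Edge p) (sym r≡u) e))
    (subst (Anc u) (Top-unique (proj₂ (Top-exists v)) topₜ) a))

  module Step (c : ℕ) {d : Node} (rank-d : rank d ≡ c) {p : Node} (edge-d : Edge p d) (surplus-d : ¬ Retained d)
              {θ} {c̄ : Vec (U B) k} (redundant : Redundant {Q = qr φ} {k} {m} M η θ p d c̄) where

    twin : Fin m → Node
    twin i = proj₁ (proj₂ (proj₂ redundant) i)

    siblings : Fin (suc m) → Node
    siblings zero    = d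
    siblings (suc i) = twin i

    siblings-edge : ∀ i → Edge p (siblings i)
    siblings-edge zero    = edge-d
    siblings-edge (suc i) = proj₁ (proj₂ (proj₂ (proj₂ redundant) i))

    siblings-same : ∀ i → SameAdhesion p d (siblings i)
    siblings-same zero    x _ = id , id
    siblings-same (suc i) = proj₁ (proj₂ (proj₂ (proj₂ (proj₂ redundant) i)))

    twin-colour : ∀ i → Colour (combine θ i) (twin i)
    twin-colour i = proj₁ (proj₂ (proj₂ (proj₂ (proj₂ (proj₂ redundant) i))))

    siblings-type : ∀ i → coneType (siblings i) (qr φ) c̄ ≡ θ
    siblings-type zero    = proj₁ (proj₂ redundant)
    siblings-type (suc i) = proj₂ (proj₂ (proj₂ (proj₂ (proj₂ (proj₂ redundant) i))))

    -- The twins carry the distinct colours `combine θ i`, and d carries none.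
    siblings-injective : ∀ {i j} → siblings i ≡ siblings j → i ≡ j
    siblings-injective {zero}  {zero}  _ = refl
    siblings-injective {zero}  {suc j} e = ⊥-elim (surplus-d (_ , subst (Colour _) (sym e) (twin-colour j)))
    siblings-injective {suc i} {zero}  e = ⊥-elim (surplus-d (_ , subst (Colour _) e (twin-colour i)))
    siblings-injective {suc i} {suc j} e = cong suc (Fin.combine-injectiveʳ θ i θ j
      (Ordered.colour-unique proper (twin-colour i) (subst (Colour _) (sym e) (twin-colour j))))

    sibling-surplus : ∀ i → ¬ Retained (siblings i) → siblings i ≡ d
    sibling-surplus zero    _ = refl
    sibling-surplus (suc i) n = ⊥-elim (n (_ , twin-colour i))

    depth-≡ : ∀ i → depth (siblings i) ≡ depth d
    depth-≡ i = siblings-depth (siblings-edge i) edge-d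

    -- A node strictly below a sibling of d is deeper than d and so has rank above c. If it were
    -- surplus, its cone would already be gone; thus the path down to the top of a surviving element
    -- is retained.
    Left⇒cone : ∀ i {v t} → Top t v → Anc (siblings i) t → Left (suc c) v → InD (siblings i) v
    Left⇒cone i {v} {t} topₜ a l = t , topₜ , a , λ u su s≢u ut →
      decidable-stable (retained? u) λ n → l u (parent su s≢u , n) (deeper su s≢u)
        (subst (Anc u) (Top-unique topₜ (proj₂ (Top-exists v))) ut)
      where
      parent : ∀ {u} → Anc (siblings i) u → siblings i ≢ u → ∃[ q ] Edge q u
      parent su s≢u = go (anc-view su)
        where
        go : _ → _
        go (inj₁ e) = ⊥-elim (s≢u e)
        go (inj₂ (q , _ , e)) = q , e
      deeper : ∀ {u} → Anc (siblings i) u → siblings i ≢ u → suc c ≤ rank u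
      deeper {u} su s≢u = subst (_< rank u) rank-d (rank-mono
          (subst (_< depth u) (depth-≡ i) (anc-strict su s≢u)))

    -- A surplus u above the top of v is comparable with the sibling. Strictly below the sibling it
    -- would be retained by liveness; strictly above, its rank would be less than c; and if it is
    -- the sibling, it is d, whose rank is exactly c.
    cone⇒Left : ∀ i {v} → InD (siblings i) v → Left (suc c) v
    cone⇒Left i {v} (t , topₜ , st , live) u (_ , n) l ut = compare (anc-comparable st ut′)
      where
      ut′ : Anc u t
      ut′ = subst (Anc u) (Top-unique (proj₂ (Top-exists v)) topₜ) ut
      equal-case : siblings i ≡ u → ⊥
      equal-case e = <-irrefl (trans (sym rank-d) (cong rank
          (trans (sym (sibling-surplus i (subst (¬_ ∘ Retained) (sym e) n))) e))) l
      compare : Anc (siblings i) u ⊎ Anc u (siblings i) → ⊥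
      compare (inj₁ su) = go (siblings i ≟ᴺ u)
        where
        go : Dec (siblings i ≡ u) → ⊥
        go (yes e)  = equal-case e
        go (no s≢u) = n (live u su s≢u ut′)
      compare (inj₂ us) = go (anc-depth us)
        where
        go : u ≡ siblings i ⊎ depth u < depth (siblings i) → ⊥
        go (inj₁ e)  = equal-case (sym e)
        go (inj₂ lt) = <-asym l (subst (rank u <_) rank-d (rank-mono (subst (depth u <_) (depth-≡ i) lt)))

    cone-d : ∀ {v} → InD d v → Anc d (top v)
    cone-d {v} (t , topₜ , a , _) = subst (Anc d) (Top-unique topₜ (proj₂ (Top-exists v))) a

    Left-next : ∀ {v} → Left (suc c) v → ¬ InD d v → Left c v
    Left-next {v} l n u s c≤ a = go (c ≟ rank u)
      where
      go : Dec (c ≡ rank u) → ⊥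
      go (no ne) = l u s (≤∧≢⇒< c≤ ne) a
      go (yes e) = n (Left⇒cone zero (proj₂ (Top-exists v)) (subst (λ u → Anc u (top v))
          (sym (rank-injective (trans rank-d e))) a) l)

    types : ∀ i j → coneType (siblings i) (qr φ) c̄ ≡ coneType (siblings j) (qr φ) c̄
    types i j = trans (siblings-type i) (sym (siblings-type j))

    cone⇒kept : ∀ i {v t} → Top t v → Anc (siblings i) t → T (left (suc c) v) → InD (siblings i) v
    cone⇒kept i topₜ a l = Left⇒cone i topₜ a (left⁻ l)

    kept : ∀ i {v} → InD (siblings i) v → T (left (suc c) v)
    kept i d = left⁺ (cone⇒Left i d)

    still-kept : ∀ {v} → T (left (suc c) v) → ¬ InD (siblings zero) v → T (left c v)
    still-kept l n = left⁺ (Left-next (left⁻ l) n)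

    were-kept : ∀ {v} → T (left c v) → T (left (suc c) v) × ¬ InD (siblings zero) v
    were-kept l = left⁺ (λ u s c< a → left⁻ l u s (≤-trans (n≤1+n c) c<) a) ,
      λ i → left⁻ l d ((p , edge-d) , surplus-d) (≤-reflexive (sym rank-d)) (cone-d i)

    cones : Blocked (InD ∘ siblings) (λ i x y → coneLeq (siblings i) (inj₁ x) (inj₁ y))
    cones = blockedCones M η proper siblings siblings-edge siblings-injective

    step : (sub base (left (suc c)) ⊨ⁱⁿᵛ φ) ⇔ (sub base (left c) ⊨ⁱⁿᵛ φ)
    step = Deletion.delete {τ} M {K} {k} {qr φ} {m} η φ invariant ≤-refl ≤-refl p siblings siblings-edge
        siblings-same c̄
      (proj₁ redundant) types (left (suc c)) (left c) cone⇒kept kept still-kept were-kept cones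

  -- Ranks are injective, so at most one cone disappears at each step.
  step : ∀ c → (sub base (left (suc c)) ⊨ⁱⁿᵛ φ) ⇔ (sub base (left c) ⊨ⁱⁿᵛ φ)
  step c = go (finite-∃? finite (λ d → surplus? d ×-dec (rank d ≟ c)))
    where
    go : Dec (∃[ d ] Surplus d × rank d ≡ c) → _
    go (yes (d , ((p , e) , n) , r)) with proj₂ certified p d e n
    ... | θ , c̄ , redundant = Step.step c r e n redundant
    go (no none) = mk⇔ (⊨ⁱⁿᵛ-≅ iso φ) (⊨ⁱⁿᵛ-≅ (≅-sym iso) φ)
      where
      iso : sub base (left (suc c)) ≅ sub base (left c)
      iso = sub-≗ base (left (suc c)) (left c)
        (λ v l → left⁺ λ u s c≤ → left⁻ l u s (≤∧≢⇒< c≤ λ e → none (u , s , sym e)))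
        (λ v l → left⁺ λ u s c< → left⁻ l u s (≤-trans (n≤1+n c) c<))

  steps : ∀ c → (sub base (left c) ⊨ⁱⁿᵛ φ) ⇔ (sub base (left 0) ⊨ⁱⁿᵛ φ)
  steps zero    = mk⇔ id id
  steps (suc c) = mk⇔ (to (steps c) ∘ to (step c)) (from (step c) ∘ from (steps c))

  prune : (base ⊨ⁱⁿᵛ φ) ⇔ (sub base root-cone ⊨ⁱⁿᵛ φ)
  prune = mk⇔ (⊨ⁱⁿᵛ-≅ last φ ∘ to (steps C) ∘ ⊨ⁱⁿᵛ-≅ first φ)
              (⊨ⁱⁿᵛ-≅ (≅-sym first) φ ∘ from (steps C) ∘ ⊨ⁱⁿᵛ-≅ (≅-sym last) φ)
    where
    C = proj₁ (bound finite rank)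
    first : base ≅ sub base (left C)
    first = sub-all base (left C) (λ v → left⁺ (Left-all (proj₂ (bound finite rank)) v))
    last : sub base (left 0) ≅ sub base root-cone
    last = sub-≗ base (left 0) root-cone
      (λ v l → fromWitness {a? = inD? root v} (Left-0⇒root v (left⁻ l)))
      (λ v i → left⁺ (root⇒Left-0 v (toWitness {a? = inD? root v} i)))

-- Definability of the pruning

module _ {τ : Vocabulary} {K : ℕ} where

  existsVecᵈ : ∀ k (R : ∀ (M : Model τ) → Vec (𝒫 (U (Model.B M))) K → Model.Node M → Model.Node M →
      Vec (U (Model.B M)) k → Set) →
    (∀ {Γ} (p d : Γ ∋ 𝓝) (xs : Vec (Γ ∋ 𝓧) k) →
       Def {τ} {Γ} {K} (λ M ρ η → R M η (get M ρ p) (get M ρ d) (map (get M ρ) xs))) →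
    ∀ {Γ} (p d : Γ ∋ 𝓝) → Def {τ} {Γ} {K} (λ M ρ η → ∃[ c̄ ] R M η (get M ρ p) (get M ρ d) c̄)
  existsVecᵈ zero R r p d = ⇔ᵈ (λ M ρ η q → [] , q) (λ { M ρ η ([] , q) → q }) (r p d [])
  existsVecᵈ (suc k) R r p d = ⇔ᵈ
    (λ { M ρ η (c̄ , x , q) → x ∷ c̄ , q }) (λ { M ρ η (x ∷ c̄ , q) → c̄ , x , q })
    (existsVecᵈ k (λ M η p d c̄ → Σ[ x ∈ U (Model.B M) ] R M η p d (x ∷ c̄))
      (λ {Γ} p d xs → ∃ᵈ {σ = 𝓧} (⇔ᵈ
        (λ M ρ η → subst (R M η (get M ρ (vs {σ′ = 𝓧} p)) (get M ρ (vs {σ′ = 𝓧} d))) (sym (gets-extend M ρ xs)))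
        (λ M ρ η → subst (R M η (get M ρ (vs {σ′ = 𝓧} p)) (get M ρ (vs {σ′ = 𝓧} d))) (gets-extend M ρ xs))
        (r {𝓧 ∷ Γ} (vs p) (vs d) (vz ∷ map vs xs)))) p d)

  -- Relativised evaluation makes sense for every colouring and is definable as it stands. Only for
  -- a proper colouring is `Le` known to order the cone linearly, so that the ordered substructure
  -- can be formed.
  SatCone : (M : Model τ) → Vec (𝒫 (U (Model.B M))) K → Model.Node M → ∀ {m} → Vec (U (Model.base M)) m →
            Formula (τ ⊕ ≤-vocabulary) FO m 0 → Set
  SatCone M η d a (x ≐ y)                       = lookup a x ≡ lookup a y
  SatCone M η d a (atom (inj₁ R) xs)            = T (rel (Model.base M) R (map (lookup a) xs))
  SatCone M η d a (atom (inj₂ _) (x ∷ y ∷ []))  = Pruning.Le M η d (lookup a x) (lookup a y)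
  SatCone M η d a (¬ᶠ φ)                        = ¬ SatCone M η d a φ
  SatCone M η d a (φ ∧ᶠ ψ)                      = SatCone M η d a φ × SatCone M η d a ψ
  SatCone M η d a (φ ∨ᶠ ψ)                      = SatCone M η d a φ ⊎ SatCone M η d a ψ
  SatCone M η d a (∃ᶠ φ)                        = Σ[ v ∈ U (Model.base M) ] Pruning.InD M η d v ×
      SatCone M η d (v ∷ a) φ
  SatCone M η d a (∀ᶠ φ)                        = ∀ (v : U (Model.base M)) → Pruning.InD M η d v →
      SatCone M η d (v ∷ a) φ

  elementAtomᵈ : ∀ {Γ} (R : Symbol τ) (xs : Vec (Γ ∋ 𝓔) (arity τ R)) →
                 Def {τ} {Γ} {K} (λ M ρ η → T (rel (Model.base M) R (map (get M ρ) xs)))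
  formula (elementAtomᵈ R xs) = atom (inj₁ R) (map index xs)
  correct (elementAtomᵈ R xs) M ρ η = ≡⇔ (cong T (sym (trans
    (cong (rel (Model.B M) (inj₁ R)) (trans (lookups-erase M ρ xs) (map-∘ inj₁ (get M ρ) xs)))
    (rel-element M R (map (get M ρ) xs)))))

  satConeᵈ : ∀ {Γ m} (φ : Formula (τ ⊕ ≤-vocabulary) FO m 0) (d : Γ ∋ 𝓝) (xs : Vec (Γ ∋ 𝓔) m) →
             Def {τ} {Γ} {K} (λ M ρ η → SatCone M η (get M ρ d) (map (get M ρ) xs) φ)
  satConeᵈ (x ≐ y) d xs = ⇔ᵈ
    (λ M ρ η e → trans (lookup-map x (get M ρ) xs) (trans e (sym (lookup-map y (get M ρ) xs))))
    (λ M ρ η e → trans (sym (lookup-map x (get M ρ) xs)) (trans e (lookup-map y (get M ρ) xs)))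
    (≡ᵈ (lookup xs x) (lookup xs y))
  satConeᵈ (atom (inj₁ R) is) d xs = ⇔ᵈ
    (λ M ρ η → subst (T ∘ rel (Model.base M) R) (sym (gets M ρ)))
    (λ M ρ η → subst (T ∘ rel (Model.base M) R) (gets M ρ))
    (elementAtomᵈ R (map (lookup xs) is))
    where
    gets : ∀ M ρ → map (lookup (map (get M ρ) xs)) is ≡ map (get M ρ) (map (lookup xs) is)
    gets M ρ = trans (map-cong (λ i → lookup-map i (get M ρ) xs) is) (map-∘ (get M ρ) (lookup xs) is)
  satConeᵈ (atom (inj₂ _) (x ∷ y ∷ [])) d xs = ⇔ᵈ
    (λ M ρ η → subst₂ (Pruning.Le M η (get M ρ d)) (sym (lookup-map x (get M ρ) xs))
        (sym (lookup-map y (get M ρ) xs)))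
    (λ M ρ η → subst₂ (Pruning.Le M η (get M ρ d)) (lookup-map x (get M ρ) xs) (lookup-map y (get M ρ) xs))
    (leᵈ d (lookup xs x) (lookup xs y))
  satConeᵈ (¬ᶠ φ)   d xs = ¬ᵈ (satConeᵈ φ d xs)
  satConeᵈ (φ ∧ᶠ ψ) d xs = satConeᵈ φ d xs ×ᵈ satConeᵈ ψ d xs
  satConeᵈ (φ ∨ᶠ ψ) d xs = satConeᵈ φ d xs ⊎ᵈ satConeᵈ ψ d xs
  satConeᵈ {Γ} (∃ᶠ φ) d xs = ∃ᵈ (inDᵈ (vs d) vz ×ᵈ ⇔ᵈ
      (λ M ρ η → subst (λ a → SatCone M η (get M ρ (vs {σ′ = 𝓔} d)) a φ) (sym (gets-extend M ρ xs)))
      (λ M ρ η → subst (λ a → SatCone M η (get M ρ (vs {σ′ = 𝓔} d)) a φ) (gets-extend M ρ xs))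
      (satConeᵈ φ (vs d) (vz ∷ map vs xs)))
  satConeᵈ {Γ} (∀ᶠ φ) d xs = ∀ᵈ (inDᵈ (vs d) vz →ᵈ ⇔ᵈ
      (λ M ρ η → subst (λ a → SatCone M η (get M ρ (vs {σ′ = 𝓔} d)) a φ) (sym (gets-extend M ρ xs)))
      (λ M ρ η → subst (λ a → SatCone M η (get M ρ (vs {σ′ = 𝓔} d)) a φ) (gets-extend M ρ xs))
      (satConeᵈ φ (vs d) (vz ∷ map vs xs)))

module _ {τ : Vocabulary} {Q k m : ℕ} where
  private
    K = #Colours τ Q k m

  redundantᵈ : ∀ θ {Γ} (p d : Γ ∋ 𝓝) (xs : Vec (Γ ∋ 𝓧) k) → Def {τ} {Γ} {K}
    (λ M ρ η → Redundant {Q = Q} {k} {m} M η θ (get M ρ p) (get M ρ d) (map (get M ρ) xs))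
  redundantᵈ θ {Γ} p d xs = coversᵈ ×ᵈ coneTypeᵈ Q d xs θ ×ᵈ ⋀ᵈ λ i →
      ∃ᵈ (edgeᵈ (vs p) vz ×ᵈ sameAdhesionᵈ (vs p) (vs d) vz ×ᵈ colourᵈ (combine θ i) vz ×ᵈ
        ⇔ᵈ (λ M ρ η → trans (cong (Cones.coneType M η (proj₁ ρ) Q) (shift M ρ)))
           (λ M ρ η → trans (cong (Cones.coneType M η (proj₁ ρ) Q) (sym (shift M ρ))))
           (coneTypeᵈ Q vz (map vs xs) θ))
    where
    shift : ∀ M (ρ : Model.Env M (𝓝 ∷ Γ)) → map (get M {Γ} {𝓧} (proj₂ ρ)) xs ≡ map (get M {𝓝 ∷ Γ} {𝓧} ρ)
        (map vs xs)
    shift M (a , ρ) = map-∘ (get M {𝓝 ∷ Γ} {𝓧} (a , ρ)) vs xs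
    coversᵈ : Def {τ} {Γ} {K} (λ M ρ η → Covers {Q = Q} {k} {m} M η (get M ρ p) (get M ρ d) (map (get M ρ) xs))
    coversᵈ = ∀ᵈ (bagᵈ (vs p) vz →ᵈ bagᵈ (vs d) vz →ᵈ ⋁ᵈ λ l → ⇔ᵈ
      (λ M ρ η → trans (lookup-map l (get M {Γ} {𝓧} (proj₂ ρ)) xs))
      (λ M ρ η → trans (sym (lookup-map l (get M {Γ} {𝓧} (proj₂ ρ)) xs)))
      (element≡ᵈ (vs (lookup xs l)) vz))

  certifiedᵈ : ∀ {Γ} → Def {τ} {Γ} {K} (λ M ρ η → Certified {Q = Q} {k} {m} M η)
  certifiedᵈ = properᵈ ×ᵈ ∀ᵈ (∀ᵈ (edgeᵈ (vs vz) vz →ᵈ ¬ᵈ (retainedᵈ vz) →ᵈ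
    ⋁ᵈ λ θ → existsVecᵈ k (λ M η → Redundant {Q = Q} {k} {m} M η θ) (redundantᵈ θ) (vs vz) vz))

module _ {τ : Vocabulary} {K : ℕ} (M : Model τ) (η : Vec (𝒫 (U (Model.B M))) K) (proper : Pruning.Proper M η)
    where
  open Model M
  open Pruning M η
  open Cones M η
  private module O = Ordered proper

  coneOrder : ∀ d → LinearOrder (Elem (λ v → ⌊ inD? d v ⌋))
  coneOrder d = record
    { leq = λ x y → ⌊ le? d (proj₁ x) (proj₁ y) ⌋
    ; isTotalOrder = record
      { isPartialOrder = record
        { isPreorder = record
          { isEquivalence = isEquivalence
          ; reflexive = λ { {x} refl → fromWitness {a? = le? d (proj₁ x) (proj₁ x)} O.Le-refl }
          ; trans = λ {x} {y} {w} a b → fromWitness {a? = le? d (proj₁ x) (proj₁ w)}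
              (O.Le-trans (toWitness {a? = le? d (proj₁ x) (proj₁ y)} a)
                  (toWitness {a? = le? d (proj₁ y) (proj₁ w)} b))
          }
        ; antisym = λ {x} {y} a b → Elem-≡ (λ v → ⌊ inD? d v ⌋)
            (O.Le-antisym (toWitness {a? = le? d (proj₁ x) (proj₁ y)} a)
                (toWitness {a? = le? d (proj₁ y) (proj₁ x)} b))
        }
      ; total = total
      }
    }
    where
    total : ∀ (x y : Elem (λ v → ⌊ inD? d v ⌋)) → T ⌊ le? d (proj₁ x) (proj₁ y) ⌋ ⊎
        T ⌊ le? d (proj₁ y) (proj₁ x) ⌋
    total (x , i) (y , j) = Sum.map (fromWitness {a? = le? d x y}) (fromWitness {a? = le? d y x})
      (O.Le-total (toWitness {a? = inD? d x} i) (toWitness {a? = inD? d y} j))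

  orderedCone : Node → Structure (τ ⊕ ≤-vocabulary)
  orderedCone d = sub base (λ v → ⌊ inD? d v ⌋) ,≤ coneOrder d

  SatCone-correct : ∀ d {m} (a : Vec (Elem (λ v → ⌊ inD? d v ⌋)) m) (φ : Formula (τ ⊕ ≤-vocabulary) FO m 0) →
                    SatCone M η d (map proj₁ a) φ ⇔ Sat (orderedCone d) a [] φ
  SatCone-correct d a (x ≐ y) = mk⇔
    (λ e → Elem-≡ (λ v → ⌊ inD? d v ⌋) (trans (sym (lookup-map x proj₁ a)) (trans e (lookup-map y proj₁ a))))
    (λ e → trans (lookup-map x proj₁ a) (trans (cong proj₁ e) (sym (lookup-map y proj₁ a))))
  SatCone-correct d a (atom (inj₁ R) xs) = ≡⇔ (cong (T ∘ rel base R)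
    (trans (map-cong (λ x → lookup-map x proj₁ a) xs) (map-∘ proj₁ (lookup a) xs)))
  SatCone-correct d a (atom (inj₂ _) (x ∷ y ∷ [])) = mk⇔
    (λ l → fromWitness {a? = le? d (proj₁ (lookup a x)) (proj₁ (lookup a y))}
      (subst₂ (Le d) (lookup-map x proj₁ a) (lookup-map y proj₁ a) l))
    (λ t → subst₂ (Le d) (sym (lookup-map x proj₁ a)) (sym (lookup-map y proj₁ a))
      (toWitness {a? = le? d (proj₁ (lookup a x)) (proj₁ (lookup a y))} t))
  SatCone-correct d a (¬ᶠ φ) = let e = SatCone-correct d a φ in mk⇔ (_∘ from e) (_∘ to e)
  SatCone-correct d a (φ ∧ᶠ ψ) = let e = SatCone-correct d a φ ; f = SatCone-correct d a ψ in
    mk⇔ (λ (p , q) → to e p , to f q) (λ (p , q) → from e p , from f q)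
  SatCone-correct d a (φ ∨ᶠ ψ) = let e = SatCone-correct d a φ ; f = SatCone-correct d a ψ in
    mk⇔ (Sum.map (to e) (to f)) (Sum.map (from e) (from f))
  SatCone-correct d a (∃ᶠ φ) = mk⇔
    (λ (v , i , q) → (v , fromWitness {a? = inD? d v} i) , to
        (SatCone-correct d ((v , fromWitness {a? = inD? d v} i) ∷ a) φ) q)
    (λ ((v , t) , q) → v , toWitness {a? = inD? d v} t , from (SatCone-correct d ((v , t) ∷ a) φ) q)
  SatCone-correct d a (∀ᶠ φ) = mk⇔
    (λ { h (v , t) → to (SatCone-correct d ((v , t) ∷ a) φ) (h v (toWitness {a? = inD? d v} t)) })
    (λ h v i → from (SatCone-correct d ((v , fromWitness {a? = inD? d v} i) ∷ a) φ)
        (h (v , fromWitness {a? = inD? d v} i)))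

⊨-closeSets : ∀ {τ K} {P : Relation τ [] K} (p : Def {τ} {[]} {K} P) (M : Model τ) →
              (Model.B M ⊨ closeSets K (formula p)) ⇔ (∃[ η ] P M tt η)
⊨-closeSets {K = K} p M = mk⇔
  (λ s → let η , q = to (Sat-closeSets (Model.B M) [] K (formula p)) s in η , from (correct p M tt η) q)
  (λ (η , q) → from (Sat-closeSets (Model.B M) [] K (formula p)) (η , to (correct p M tt η) q))

module Evaluation {τ : Vocabulary} (k : ℕ) (φ : Sentence (τ ⊕ ≤-vocabulary) FO) where
  private
    m = threshold (qr φ)
    K = #Colours τ (qr φ) k m

  -- The vocabulary has no name for the root; the formula finds it as the node without a parent.
  PrunedModel : (M : Model τ) → Vec (𝒫 (U (Model.B M))) K → Set
  PrunedModel M η = Certified {Q = qr φ} {k} {m} M η ×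
    (Σ[ r ∈ Model.Node M ] (∀ p → ¬ Model.Edge M p r) × SatCone M η r [] φ)

  prunedModelᵈ : Def {τ} {[]} {K} (λ M ρ η → PrunedModel M η)
  prunedModelᵈ = certifiedᵈ {Q = qr φ} {k} {m} ×ᵈ ∃ᵈ (∀ᵈ (¬ᵈ (edgeᵈ vz (vs vz))) ×ᵈ satConeᵈ φ vz [])

  abstract
    prunedSentence : Sentence (τ ⋆) MSO
    prunedSentence = closeSets K (formula prunedModelᵈ)

    ⊨-prunedSentence : ∀ M → (Model.B M ⊨ prunedSentence) ⇔ (∃[ η ] PrunedModel M η)
    ⊨-prunedSentence = ⊨-closeSets prunedModelᵈ

  evaluate : OrderInvariant {τ} φ → ∀ M η → Certified {Q = qr φ} {k} {m} M η → ∀ r →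
      (∀ p → ¬ Model.Edge M p r) →
             (Model.base M ⊨ⁱⁿᵛ φ) ⇔ SatCone M η r [] φ
  evaluate invariant M η certified r no-parent = mk⇔
    (λ q → from (SatCone-correct M η (proj₁ certified) r [] φ) (to at (subst-root (to prune q))))
    (λ q → from prune (back-root (from at (to (SatCone-correct M η (proj₁ certified) r [] φ) q))))
    where
    open Model M
    open Cones M η
    r≡root : r ≡ root
    r≡root = go (Tree.parent? tree r)
      where
      go : (∃[ p ] Edge p r) ⊎ r ≡ root → r ≡ root
      go (inj₁ (p , e)) = ⊥-elim (no-parent p e)
      go (inj₂ e)       = e
    cone-at : Node → Set
    cone-at d = sub base (λ v → ⌊ inD? d v ⌋) ⊨ⁱⁿᵛ φ
    prune : (base ⊨ⁱⁿᵛ φ) ⇔ cone-at root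
    prune = Soundness.prune {τ} M φ invariant η certified
    subst-root : cone-at root → cone-at r
    subst-root = subst cone-at (sym r≡root)
    back-root : cone-at r → cone-at root
    back-root = subst cone-at r≡root
    at : cone-at r ⇔ (orderedCone M η (proj₁ certified) r ⊨ φ)
    at = ⊨ⁱⁿᵛ-at {τ} φ invariant (sub base (λ v → ⌊ inD? r v ⌋)) (coneOrder M η (proj₁ certified) r)

-- Existence of the pruning

module Count where

  count : (ℕ → Bool) → ℕ → ℕ
  count P zero    = 0
  count P (suc j) = if P j then suc (count P j) else count P j

  count-cong : ∀ {P P′} → (∀ i → P i ≡ P′ i) → ∀ j → count P j ≡ count P′ j
  count-cong e zero = refl
  count-cong {P} {P′} e (suc j) rewrite e j | count-cong {P} {P′} e j = refl

  count-step : ∀ P j → count P j ≤ count P (suc j)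
  count-step P j with P j
  ... | true  = n≤1+n _
  ... | false = ≤-refl

  count-mono : ∀ P {i j} → i ≤′ j → count P i ≤ count P j
  count-mono P ≤′-refl       = ≤-refl
  count-mono P (≤′-step i≤j) = ≤-trans (count-mono P i≤j) (count-step P _)

  count-< : ∀ P {i j} → T (P i) → i < j → count P i < count P j
  count-< P {i} {j} t i<j = ≤-trans one (count-mono P (≤⇒≤′ i<j))
    where
    one : count P i < count P (suc i)
    one with P i
    ... | true = ≤-refl

  -- The count starts at 0 and rises by at most one, exactly after each member, so every value below
  -- the final count is the position of some member.
  count-find : ∀ P j {x} → x < count P j → ∃[ i ] i < j × T (P i) × count P i ≡ x
  count-find P (suc j) {x} lt with P j in eq
  ... | false = let i , i<j , t , e = count-find P j lt in i , m≤n⇒m≤1+n i<j , t , e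
  ... | true with x ≟ count P j
  ...   | yes refl = j , ≤-refl , subst T (sym eq) tt , refl
  ...   | no ne = let i , i<j , t , e = count-find P j (≤∧≢⇒< (≤-pred lt) ne) in i , m≤n⇒m≤1+n i<j , t , e

open Count

abstract
  opaque-bool : ∀ {P : Set} → Dec P → Bool
  opaque-bool = ⌊_⌋

  opaque-bool⁺ : ∀ {P : Set} (P? : Dec P) → P → T (opaque-bool P?)
  opaque-bool⁺ P? = fromWitness {a? = P?}

  opaque-bool⁻ : ∀ {P : Set} (P? : Dec P) → T (opaque-bool P?) → P
  opaque-bool⁻ P? = toWitness {a? = P?}

toFin : ∀ n → ℕ → Maybe (Fin n)
toFin zero    _       = nothing
toFin (suc n) zero    = just zero
toFin (suc n) (suc i) = Maybe.map suc (toFin n i)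

toFin-< : ∀ n i (j : Fin n) → i ≡ toℕ j → toFin n i ≡ just j
toFin-< (suc n) zero    zero    e = refl
toFin-< (suc n) (suc i) (suc j) e = cong (Maybe.map suc) (toFin-< n i j (suc-injective e))

map-just : ∀ {X Y : Set} (f : X → Y) (x : Maybe X) {y} → Maybe.map f x ≡ just y → ∃[ x′ ] x ≡ just x′ × y ≡ f x′
map-just f (just x) refl = x , refl , refl

toFin-just : ∀ n i {j : Fin n} → toFin n i ≡ just j → toℕ j ≡ i
toFin-just (suc n) zero    refl = refl
toFin-just (suc n) (suc i) e with map-just suc (toFin n i) e
... | j , eq , refl = cong suc (toFin-just n i eq)

-- Types need tuples of length exactly k, while an adhesion set may have fewer elements.
pad : ∀ {X Y : Set} → Y → (X → Y) → List X → ∀ k → Vec Y k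
pad y f _        zero    = []
pad y f []       (suc k) = y ∷ pad y f [] k
pad y f (x ∷ xs) (suc k) = f x ∷ pad y f xs k

pad-∈ : ∀ {X Y : Set} (y : Y) (f : X → Y) {xs k x} → x ∈ˡ xs → List.length xs ≤ k →
    ∃[ l ] lookup (pad y f xs k) l ≡ f x
pad-∈ y f (here refl) (s≤s le) = zero , refl
pad-∈ y f (there x∈)  (s≤s le) = let l , e = pad-∈ y f x∈ le in suc l , e

filterᵇ-cong : ∀ {X : Set} {P P′ : X → Bool} → (∀ x → P x ≡ P′ x) → ∀ xs → filterᵇ P xs ≡ filterᵇ P′ xs
filterᵇ-cong e [] = refl
filterᵇ-cong {P = P} {P′} e (x ∷ xs) with P x | P′ x | e x
... | true  | _ | refl = cong (x ∷_) (filterᵇ-cong e xs)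
... | false | _ | refl = filterᵇ-cong e xs

∈-filterᵇ : ∀ {X : Set} (P : X → Bool) {x xs} → x ∈ˡ xs → T (P x) → x ∈ˡ filterᵇ P xs
∈-filterᵇ P = ∈-filter⁺ (T? ∘ P)

module Monotone {τ} (M : Model τ) {K : ℕ} (η η′ : Vec (𝒫 (U (Model.B M))) K)
  {d : Model.Node M} (agree : ∀ c t → Pruning.Anc M η d t → d ≢ t → Pruning.Colour M η c t →
      Pruning.Colour M η′ c t) where
  open Model M
  open Tree tree using (snoc; ¬anc-parent)
  private
    module P = Pruning M η
    module P′ = Pruning M η′

  InD-mono : ∀ {v} → P.InD d v → P′.InD d v
  InD-mono (t , top , a , live) = t , top , a , λ u du d≢u ut →
    let c , col = live u du d≢u ut in c , agree c u du d≢u col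

  Before-mono : ∀ {p s t} → P.Anc d p → Edge p s → Edge p t → P.Before p s t → P′.Before p s t
  Before-mono dp e e′ (inj₁ l) = inj₁ l
  Before-mono dp e e′ (inj₂ (same , c , c′ , lt , a , b)) = inj₂ (same , c , c′ , lt ,
    agree c _ (snoc dp e) (λ { refl → ¬anc-parent e dp }) a ,
    agree c′ _ (snoc dp e′) (λ { refl → ¬anc-parent e′ dp }) b)

  Le-mono : ∀ {x y} → P.Le d x y → P′.Le d x y
  Le-mono (s , t , a , b , inj₁ q)        = s , t , a , b , inj₁ q
  Le-mono (s , t , a , b , inj₂ (inj₁ q)) = s , t , a , b , inj₂ (inj₁ q)
  Le-mono (s , t , a , b , inj₂ (inj₂ (p , s′ , t′ , dp , e , e′ , before , π , σ))) =
    s , t , a , b , inj₂ (inj₂ (p , s′ , t′ , dp , e , e′ , Before-mono dp e e′ before , π , σ))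

-- Membership in the cone of d and its order consult only colours of nodes strictly below d. This
-- locality allows the colouring to be built bottom-up.
coneType-cong : ∀ {τ} (M : Model τ) {K} (η η′ : Vec (𝒫 (U (Model.B M))) K) {d : Model.Node M} →
  (∀ c t → Pruning.Anc M η d t → d ≢ t → Pruning.Colour M η c t → Pruning.Colour M η′ c t) →
  (∀ c t → Pruning.Anc M η′ d t → d ≢ t → Pruning.Colour M η′ c t → Pruning.Colour M η c t) →
  ∀ q {n} (a : Vec (U (Model.B M)) n) → Cones.coneType M η d q a ≡ Cones.coneType M η′ d q a
coneType-cong {τ} M η η′ {d} f g q a = tp-cong {τ ⊕ ≤-vocabulary} (Structure.finite (Model.B M)) rel-≡ cone-≡
    q a
  where
  module C = Cones M η
  module C′ = Cones M η′
  module F = Monotone M η η′ {d} f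
  module G = Monotone M η′ η {d} g
  cone-≡ : ∀ x → C.cone d x ≡ C′.cone d x
  cone-≡ (inj₁ v) = ⌊⌋-cong (C.inD? d v) (C′.inD? d v) F.InD-mono G.InD-mono
  cone-≡ (inj₂ _) = refl
  rel-≡ : ∀ R xs → C.coneRel d R xs ≡ C′.coneRel d R xs
  rel-≡ (inj₁ R) xs = refl
  rel-≡ (inj₂ _) (inj₁ x ∷ inj₁ y ∷ []) =
    ⌊⌋-cong (C.inD? d x ×-dec C.inD? d y ×-dec C.le? d x y) (C′.inD? d x ×-dec C′.inD? d y ×-dec C′.le? d x y)
      (λ (i , j , l) → F.InD-mono i , F.InD-mono j , F.Le-mono l)
          (λ (i , j , l) → G.InD-mono i , G.InD-mono j , G.Le-mono l)
  rel-≡ (inj₂ _) (inj₁ x ∷ inj₂ y ∷ []) = refl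
  rel-≡ (inj₂ _) (inj₂ x ∷ y ∷ []) = refl

module Existence {τ : Vocabulary} (M : Model τ) {k : ℕ} (adhesion≤k : Model.adhesion M ≤ k) (Q m : ℕ) where
  open Model M
  open Tree tree

  private
    NT = #Types (τ ⊕ ≤-vocabulary) Q k
    K = #Colours τ Q k m
    finU = Structure.finite base

  adhesionSet : Node → Node → List (U base)
  adhesionSet p d = filterᵇ (β p ∩ β d) (elements finU)

  adhesionSet≤k : ∀ {p d} → Edge p d → List.length (adhesionSet p d) ≤ k
  adhesionSet≤k {p} {d} e = ≤-trans (ListAll.lookup (xs≤max 0 _) (∈-map⁺ (λ (t , u) → card finU (β t ∩ β u))
    (∈-filterᵇ (uncurry edge) (∈-cartesianProduct⁺ (∈-elements finite p) (∈-elements finite d)) e))) adhesion≤k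

  constants : Node → Node → Vec (U B) k
  -- The padding is a node and hence lies in no cone and in no tuple of a relation of `τ`.
  constants p d = pad (inj₂ root) inj₁ (adhesionSet p d) k

  constants-cover : ∀ {p d} → Edge p d → ∀ v → T (β p v) → T (β d v) → ∃[ l ] lookup (constants p d) l ≡ inj₁ v
  constants-cover {p} {d} e v bp bd = pad-∈ (inj₂ root) inj₁
    (∈-filterᵇ (β p ∩ β d) (∈-elements finU v) (from T-∧ (bp , bd))) (adhesionSet≤k e)

  -- Adhesion sets do not depend on colours, so the empty colouring serves here, before any colours
  -- exist.
  open Pruning M {0} [] using () renaming
    (SameAdhesion to Same; sameAdhesion? to same?;
     SameAdhesion-sym to same-sym; SameAdhesion-trans to same-trans)

  -- The tuple is read off one enumeration of the universe. Siblings with equal adhesion sets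
  -- therefore have literally the same constants, over which their types can be compared.
  constants-cong : ∀ {p s t} → Same p s t → constants p s ≡ constants p t
  constants-cong {p} {s} {t} same = cong (λ xs → pad (inj₂ root) inj₁ xs k) (filterᵇ-cong eq (elements finU))
    where
    eq : ∀ x → (β p ∩ β s) x ≡ (β p ∩ β t) x
    eq x = T-ext (λ a → let b , c = to (T-∧ {β p x}) a in from T-∧ (b , proj₁ (same x b) c))
                 (λ a → let b , c = to (T-∧ {β p x}) a in from T-∧ (b , proj₂ (same x b) c))

  number : Node → ℕ
  number t = toℕ (Inverse.to (proj₂ finite) t)

  number-injective : ∀ {s t} → number s ≡ number t → s ≡ t
  number-injective {s} {t} e = trans (sym (Inverse.strictlyInverseʳ (proj₂ finite) s))
    (trans (cong (Inverse.from (proj₂ finite)) (Fin.toℕ-injective e))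
        (Inverse.strictlyInverseʳ (proj₂ finite) t))

  parent : Node → Node
  parent t = go (parent? t)
    where
    go : (∃[ p ] Edge p t) ⊎ t ≡ root → Node
    go (inj₁ (p , _)) = p
    -- A dummy value. It affects only the label of the root, which has no siblings and is strictly
    -- below no node.
    go (inj₂ _)       = root

  parent-≡ : ∀ {p t} → Edge p t → parent t ≡ p
  parent-≡ {p} {t} e with parent? t
  ... | inj₁ (q , e′) = parent-unique e′ e
  ... | inj₂ refl     = ⊥-elim (root-no-parent p e)

  parent-depth : ∀ {t w} → Edge (parent t) w → depth t ≤ depth w
  parent-depth {t} {w} e with parent? t
  ... | inj₁ (q , e′) = ≤-reflexive (siblings-depth e′ e)
  ... | inj₂ refl     = ≤-trans (≤-reflexive (length-unique (path root) [])) z≤n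

  Label : Set
  Label = Maybe (Fin K)

  labelled : (Node → Label) → Fin K → 𝒫 (U B)
  labelled lab c (inj₁ _) = false
  labelled lab c (inj₂ t) = ⌊ ≡-dec Fin._≟_ (lab t) (just c) ⌋

  abstract
    colouring : (Node → Label) → Vec (𝒫 (U B)) K
    colouring lab = tabulate (labelled lab)

    colour⁺ : ∀ lab {c t} → lab t ≡ just c → T (lookup (colouring lab) c (inj₂ t))
    colour⁺ lab {c} {t} e = subst (λ (X : 𝒫 (U B)) → T (X (inj₂ t))) (sym (lookup∘tabulate (labelled lab) c))
      (fromWitness {a? = ≡-dec Fin._≟_ (lab t) (just c)} e)

    colour⁻ : ∀ lab {c t} → T (lookup (colouring lab) c (inj₂ t)) → lab t ≡ just c
    colour⁻ lab {c} {t} x = toWitness {a? = ≡-dec Fin._≟_ (lab t) (just c)}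
      (subst (λ (X : 𝒫 (U B)) → T (X (inj₂ t))) (lookup∘tabulate (labelled lab) c) x)

  abstract
    type : (Node → Label) → Node → Vec (U B) k → Fin NT
    type lab t = Cones.coneType M (colouring lab) t Q

    type-≡ : ∀ lab t c̄ → Cones.coneType M (colouring lab) t Q c̄ ≡ type lab t c̄
    type-≡ lab t c̄ = refl

    type-cong : ∀ lab lab′ t c̄ → (∀ w → depth t < depth w → lab w ≡ lab′ w) → type lab t c̄ ≡ type lab′ t c̄
    type-cong lab lab′ t c̄ e = coneType-cong M (colouring lab) (colouring lab′)
      (λ c w a t≢w x → colour⁺ lab′ (trans (sym (e w (anc-strict a t≢w))) (colour⁻ lab x)))
      (λ c w a t≢w x → colour⁺ lab (trans (e w (anc-strict a t≢w)) (colour⁻ lab′ x))) Q c̄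

  module _ (lab : Node → Label) where
    ownType : Node → Fin NT
    ownType t = type lab t (constants (parent t) t)

    Alike : Node → Node → Set
    Alike t w = Edge (parent t) w × Same (parent t) t w × type lab w (constants (parent t) t) ≡ ownType t

    abstract
      alike? : ∀ t w → Dec (Alike t w)
      alike? t w = T? (edge (parent t) w) ×-dec same? {parent t} t w ×-dec
        (type lab w (constants (parent t) t) Fin.≟ ownType t)

    AlikeAt : Node → ℕ → Node → Set
    AlikeAt t i w = number w ≡ i × Alike t w

    alikeAt? : ∀ t i → Dec (∃ (AlikeAt t i))
    alikeAt? t i = finite-∃? finite {P = AlikeAt t i} (λ w → (number w ≟ i) ×-dec alike? t w)

    alikeAt : Node → ℕ → Bool
    alikeAt t i = opaque-bool (alikeAt? t i)

    alikeAt⁺ : ∀ {t w} → Alike t w → T (alikeAt t (number w))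
    alikeAt⁺ {t} {w} a = opaque-bool⁺ (alikeAt? t (number w)) (w , refl , a)

    alikeAt⁻ : ∀ {t i} → T (alikeAt t i) → ∃ (AlikeAt t i)
    alikeAt⁻ {t} {i} = opaque-bool⁻ (alikeAt? t i)

    position : Node → ℕ
    position t = count (alikeAt t) (number t)

    -- Position counts the alike siblings with smaller numbers. The first m of a class receive a
    -- colour; the others remain unlabelled and are the surplus ones.
    label : Node → Label
    label t = Maybe.map (combine (ownType t)) (toFin m (position t))

    label-just : ∀ {t c} → label t ≡ just c → ∃[ i ] toℕ i ≡ position t × c ≡ combine (ownType t) i
    label-just {t} e = let i , eq , c≡ = map-just (combine (ownType t)) (toFin m (position t)) e
                       in i , toFin-just m (position t) eq , c≡

    label-nothing : ∀ {t} → (∀ c → label t ≢ just c) → m ≤ position t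
    label-nothing {t} n = ≮⇒≥ λ lt → n _ (cong (Maybe.map (combine (ownType t)))
        (toFin-< m (position t) (fromℕ< lt) (sym (Fin.toℕ-fromℕ< lt))))

    label-at : ∀ {t} i → position t ≡ toℕ i → label t ≡ just (combine (ownType t) i)
    label-at {t} i e = cong (Maybe.map (combine (ownType t))) (toFin-< m (position t) i e)

  module _ {lab lab′ : Node → Label} where

    ownType-cong : ∀ {t} → (∀ w → depth t < depth w → lab w ≡ lab′ w) → ownType lab t ≡ ownType lab′ t
    ownType-cong {t} e = type-cong lab lab′ t (constants (parent t) t) e

    Alike-cong : ∀ {t w} → (∀ w → depth t < depth w → lab w ≡ lab′ w) → Alike lab t w → Alike lab′ t w
    Alike-cong {t} {w} e (edge , same , eq) = edge , same , trans
      (sym (type-cong lab lab′ w (constants (parent t) t) (λ u lt → e u (≤-<-trans (parent-depth edge) lt))))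
      (trans eq (ownType-cong e))

  -- The label of t depends on the types of t and its siblings, and these depend only on labels at
  -- strictly greater depth.
  label-cong : ∀ {lab lab′ t} → (∀ w → depth t < depth w → lab w ≡ lab′ w) → label lab t ≡ label lab′ t
  label-cong {lab} {lab′} {t} e = go (label lab t) refl
    where
    positions : position lab t ≡ position lab′ t
    positions = count-cong (λ i → T-ext
      (λ x → let w , e′ , a = alikeAt⁻ lab x in subst (T ∘ alikeAt lab′ t) e′ (alikeAt⁺ lab′ (Alike-cong e a)))
      (λ x → let w , e′ , a = alikeAt⁻ lab′ x in subst (T ∘ alikeAt lab t) e′
        (alikeAt⁺ lab (Alike-cong (λ w lt → sym (e w lt)) a)))) (number t)
    go : ∀ l → label lab t ≡ l → label lab t ≡ label lab′ t
    go nothing  eq = trans eq (sym (none (label lab′ t) refl))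
      where
      none : ∀ l → label lab′ t ≡ l → l ≡ nothing
      none nothing  _ = refl
      none (just c) eq′ = let i , x , _ = label-just lab′ eq′
                              c≡ = label-at lab i (trans positions (sym x)) in
        ⊥-elim (case (trans (sym eq) c≡))
        where
        case : ∀ {c : Fin K} → nothing ≡ just c → ⊥
        case ()
    go (just c) eq = let i , x , y = label-just lab eq in
      trans eq (trans (cong just (trans y (cong (λ θ → combine θ i) (ownType-cong e))))
                      (sym (label-at lab′ i (trans (sym positions) (sym x)))))

  -- Bottom-up recursion as a fixed-point iteration: every round recomputes all labels, and one more
  -- level, from the deepest upwards, becomes final.
  iterate : ℕ → Node → Label
  iterate zero    t = nothing
  iterate (suc f) t = label (iterate f) t

  private
    height : ∃[ h ] (∀ t → depth t < h)
    height = bound finite depth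
    h = proj₁ height

  -- After f rounds all nodes at depth at least h - f are settled. For f = 0 there are none, since h
  -- exceeds every depth.
  stable : ∀ f t → h ≤ f + depth t → iterate f t ≡ iterate (suc f) t
  stable zero    t le = ⊥-elim (<-irrefl refl (≤-trans (proj₂ height t) le))
  stable (suc f) t le = label-cong λ w lt → stable f w (≤-trans le
      (subst (_≤ f + depth w) (+-suc f (depth t)) (+-monoʳ-≤ f lt)))

  labelling : Node → Label
  labelling = iterate h

  abstract
    labelling-fixed : ∀ t → labelling t ≡ label labelling t
    labelling-fixed t = stable h t (m≤m+n h (depth t))

  private
    η = colouring labelling

  -- Alike nodes have the same parent, the same constants and the same type, so they define the same
  -- class of alike nodes.
  alike-same : ∀ {t u} → Alike labelling t u → ∀ {w} → Alike labelling t w → Alike labelling u w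
  alike-same {t} {u} (eu , su , θu) {w} (ew , sw , θw) = subst (λ p → Edge p w) (sym pu) ew ,
      subst (λ p → Same p u w) (sym pu) (same-trans (same-sym su) sw) ,
      trans (cong (type labelling w) cu) (trans θw (trans (sym θu) (cong (type labelling u) (sym cu))))
    where
    pu : parent u ≡ parent t
    pu = parent-≡ eu
    cu : constants (parent u) u ≡ constants (parent t) t
    cu = trans (cong (λ p → constants p u) pu) (sym (constants-cong su))

  alike-refl : ∀ {p t} → Edge p t → Alike labelling t t
  alike-refl {p} {t} e = subst (λ p → Edge p t) (sym (parent-≡ e)) e , (λ x b → id , id) , refl

  alike-ownType : ∀ {t u} → Alike labelling t u → ownType labelling u ≡ ownType labelling t
  alike-ownType {t} {u} (eu , su , θu) =
    trans (cong (type labelling u) (trans (cong (λ p → constants p u) (parent-≡ eu))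
        (sym (constants-cong su)))) θu

  -- Positions of alike nodes are counted in one common class, which makes them comparable.
  alike-position : ∀ {p t u} → Edge p t → Alike labelling t u →
      position labelling u ≡ count (alikeAt labelling t) (number u)
  alike-position {p} {t} {u} e a = count-cong (λ i → T-ext
    (λ x → let w , e′ , b = alikeAt⁻ labelling x in subst (T ∘ alikeAt labelling t) e′
        (alikeAt⁺ labelling (alike-same back b)))
    (λ x → let w , e′ , b = alikeAt⁻ labelling x in subst (T ∘ alikeAt labelling u) e′
        (alikeAt⁺ labelling (alike-same a b)))) (number u)
    where
    back : Alike labelling u t
    back = alike-same a (alike-refl e)

  colour-label : ∀ {c t} → T (lookup η c (inj₂ t)) → ∃[ i ] toℕ i ≡ position labelling t ×
      c ≡ combine (ownType labelling t) i
  colour-label {c} {t} x = label-just labelling (trans (sym (labelling-fixed t)) (colour⁻ labelling x))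

  -- Siblings with equal adhesion sets and equal colours have the same type, hence are alike, and
  -- the same position in their class. Distinct members of a class have distinct positions.
  proper : Pruning.Proper M η
  proper = (λ t c c′ lt x y → Fin.<⇒≢ lt (just-injective (trans (sym (colour⁻ labelling x))
      (colour⁻ labelling y)))) , distinct
    where
    distinct : ∀ p u t c → Edge p u → Edge p t → Same p u t → T (lookup η c (inj₂ u)) →
        T (lookup η c (inj₂ t)) → u ≡ t
    distinct p u t c e e′ same x y = go (colour-label x) (colour-label y)
      where
      go : ∃[ i ] toℕ i ≡ position labelling u × c ≡ combine (ownType labelling u) i →
           ∃[ i ] toℕ i ≡ position labelling t × c ≡ combine (ownType labelling t) i → u ≡ t
      go (i , xi , ci) (j , xj , cj) = compare (<-cmp (number u) (number t))
        where
        eq = Fin.combine-injective (ownType labelling u) i (ownType labelling t) j (trans (sym ci) cj)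
        positions : position labelling u ≡ position labelling t
        positions = trans (sym xi) (trans (cong toℕ (proj₂ eq)) xj)
        alike : Alike labelling u t
        alike = subst (λ p → Edge p t) (sym (parent-≡ e)) e′ , subst (λ p → Same p u t) (sym (parent-≡ e))
            same ,
          trans (cong (type labelling t) (trans (cong (λ p → constants p u) (parent-≡ e))
              (trans (constants-cong same)
            (cong (λ p → constants p t) (sym (parent-≡ e′)))))) (sym (proj₁ eq))
        alike′ : Alike labelling t u
        alike′ = alike-same alike (alike-refl e)
        compare : _ → u ≡ t
        compare (tri≈ _ n _)  = number-injective n
        compare (tri< lt _ _) = ⊥-elim (<-irrefl (trans (sym (alike-position e′ alike′)) positions)
          (count-< (alikeAt labelling t) (alikeAt⁺ labelling alike′) lt))
        compare (tri> _ _ gt) = ⊥-elim (<-irrefl (trans (sym (alike-position e alike)) (sym positions))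
          (count-< (alikeAt labelling u) (alikeAt⁺ labelling alike) gt))

  -- An unlabelled d has position at least m. So each i below m is the position of some alike
  -- sibling, whose colour is then the type of d paired with i.
  redundant : ∀ p d → Edge p d → ¬ Pruning.Retained M η d → Redundant {Q = Q} {k} {m} M η
      (ownType labelling d) p d (constants p d)
  redundant p d e n = constants-cover e , trans (type-≡ labelling d (constants p d))
      (cong (type labelling d) c≡) , twin
    where
    c≡ : constants p d ≡ constants (parent d) d
    c≡ = cong (λ p → constants p d) (sym (parent-≡ e))
    m≤ : m ≤ position labelling d
    m≤ = label-nothing labelling (λ c x → n (c , colour⁺ labelling (trans (labelling-fixed d) x)))
    twin : ∀ i → ∃[ w ] Edge p w × Pruning.SameAdhesion M η p d w ×
        Pruning.Colour M η (combine (ownType labelling d) i) w ×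
                 Cones.coneType M η w Q (constants p d) ≡ ownType labelling d
    twin i = go (count-find (alikeAt labelling d) (number d) (≤-trans (Fin.toℕ<n i) m≤))
      where
      go : ∃[ j ] j < number d × T (alikeAt labelling d j) × count (alikeAt labelling d) j ≡ toℕ i → _
      go (j , _ , x , eq) with alikeAt⁻ labelling x
      ... | w , refl , a@(ew , sw , θw) = w , subst (λ p → Edge p w) (parent-≡ e) ew ,
          subst (λ p → Same p d w) (parent-≡ e) sw ,
        colour⁺ labelling (trans (labelling-fixed w) (trans (label-at labelling i
            (trans (alike-position e a) eq))
          (cong (λ θ → just (combine θ i)) (alike-ownType a)))) ,
        trans (type-≡ labelling w (constants p d)) (trans (cong (type labelling w) c≡) θw)

  certified : ∃[ η ] Certified {Q = Q} {k} {m} M η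
  certified = η , proper , λ p d e n → ownType labelling d , constants p d , redundant p d e n

-- Correctness of the sentence and its pullback along the transduction

module _ {τ : Vocabulary} (k : ℕ) (φ : Sentence (τ ⊕ ≤-vocabulary) FO) (invariant : OrderInvariant {τ} φ) where
  open Evaluation k φ

  prunedSentence-correct : ∀ (M : Model τ) → Model.adhesion M ≤ k →
                           (Model.base M ⊨ⁱⁿᵛ φ) ⇔ (Model.B M ⊨ prunedSentence)
  prunedSentence-correct M adhesion≤k = mk⇔ forward backward
    where
    open Model M
    forward : base ⊨ⁱⁿᵛ φ → B ⊨ prunedSentence
    forward q = from (⊨-prunedSentence M)
      (η , c , root , root-no-parent , to (evaluate invariant M η c root root-no-parent) q)
      where
      open Existence M adhesion≤k (qr φ) (threshold (qr φ)) using (certified)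
      η = proj₁ certified
      c = proj₂ certified
    backward : B ⊨ prunedSentence → base ⊨ⁱⁿᵛ φ
    backward s = let η , c , r , no-parent , q = to (⊨-prunedSentence M) s
             in from (evaluate invariant M η c r no-parent) q

theorem3p2 : ∀ {ℓ : Level} (τ : Vocabulary) (𝒞 : Pred (Structure τ) ℓ) →
    AdmitsOrderedTreeDecompositions 𝒞 →
    (φ : Sentence (τ ⊕ ≤-vocabulary) FO) → OrderInvariant φ →
    Σ[ ψ ∈ Sentence τ MSO ] (∀ A → A ∈ 𝒞 → (A ⊨ⁱⁿᵛ φ) ⇔ (A ⊨ ψ))
theorem3p2 τ 𝒞 (k , w , p , Λ , admits) φ invariant = preimage Λ χ , λ A A∈𝒞 → mk⇔
    -- Nonemptiness of the image supplies the parameters.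
    (λ q → let B , P , valid , B≡ = proj₁ (admits A A∈𝒞) in
      from (⊨-preimage Λ A χ) (P , valid , to (at A A∈𝒞 P valid) q))
    (λ s → let P , valid , q = to (⊨-preimage Λ A χ) s in from (at A A∈𝒞 P valid) q)
  where
  χ : Sentence (τ ⋆) MSO
  χ = Evaluation.prunedSentence k φ
  at : ∀ A → A ∈ 𝒞 → ∀ P → withParameters Λ A P ⊨ Transduction.λ-valid Λ → (A ⊨ⁱⁿᵛ φ) ⇔ (transduce Λ A P ⊨ χ)
  -- Whatever the valid parameters, the result is an ordered tree extension of A of adhesion at most
  -- k, and the truth of `χ` on it depends only on A.
  at A A∈𝒞 P valid with proj₂ (admits A A∈𝒞) (transduce Λ A P) (P , valid , refl)
  ... | E , iso , adhesion≤k = mk⇔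
    (λ q → from (⊨-≅ iso χ) (to (prunedSentence-correct k φ invariant (model E) adhesion≤k) q))
    (λ q → from (prunedSentence-correct k φ invariant (model E) adhesion≤k) (to (⊨-≅ iso χ) q))
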